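{- Let $H=(V,E)$ be a connected hypergraph with $|V|\ge 2$, let $\Omega=\Omega(H)\subset\mathbb{R}^E_{\ge 0}$ be its multi-tree family, and let $\widehat{\Omega}$ be the Fulkerson blocker family of $\Omega$. Then $$\widehat{\Omega}=\left\{\frac{1}{|\mathscr{P}|-1}\mathbf{1}_{\delta(\mathscr{P})} : \mathscr{P}\text{ is a feasible partition of } V \text{ with } |\mathscr P|\ge 2 \text{ whose shrunk hypergraph } H_{\mathscr{P}} \text{ is vertex-biconnected}\right\}.$$
   Context: A hypergraph $H=(V,E)$ has a finite nonempty vertex set $V$ and a finite collection $E$ of subsets of $V$ (hyperedges), where repetitions are allowed (parallel hyperedges are distinct elements of $E$) and there are no loops (every hyperedge has at least two vertices). $H$ is connected if for every nonempty proper subset $X\subset V$ some hyperedge intersects both $X$ and $V\setminus X$. For $X\subseteq V$, $H[X]=(X,E[X])$ where $E[X]$ is the set of hyperedges contained in $X$. $\mathbf{1}_F\in\mathbb{R}^E$ is the indicator vector of $F\subseteq E$. Multi-tree family: a set (or multiset) $F$ of hyperedges is a hyperforest if $|F[X]|\le |X|-1$ for every nonempty $X\subseteq V$, where $F[X]$ is the collection of members of $F$ contained in $X$ (counted with multiplicity); a hyperforest with $|F|=|V|-1$ is a hypertree. For a multiset $A$ from $E$, $H[A]$ is the hypergraph with vertex set $\bigcup_{e\in A}e$ and hyperedges the members of $A$ (copies being parallel hyperedges), and its indicator vector $x^A\in\mathbb{R}^E_{\ge0}$ has $x^A(e)$ equal to the multiplicity of $e$ in $A$. $\Omega(H)$ is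 the set of all $x^A$ such that $H[A]$ is a hypertree with vertex set $V$. Blocker: for a set of vectors $\Gamma\subset\mathbb{R}^E_{\ge 0}$, $\operatorname{Adm}(\Gamma)=\{\rho\in\mathbb{R}^E_{\ge0}:\gamma^T\rho\ge 1\ \forall\gamma\in\Gamma\}$, and the Fulkerson blocker family $\widehat\Gamma$ is the set of extreme points of $\operatorname{Adm}(\Gamma)$. Partitions: for a partition $\mathscr P=\{V_1,\dots,V_k\}$ of $V$ (into nonempty parts), $|\mathscr P|=k$ and $\delta(\mathscr P)$ is the set of hyperedges intersecting at least two parts. $\mathscr P$ is feasible if every $H[V_i]$ is connected. For a hyperedge $f$, the contraction $H/f$ is obtained by merging the vertices of $f$ into one new vertex (in every hyperedge $e \ne f$ meeting $f$, replace $e\cap f$ by the new vertex) and removing resulting loops; $H/F$ is obtained by contracting all hyperedges of $F$. The shrunk hypergraph is $H_{\mathscr P}=H/(E\setminus\delta(\mathscr P))$; its vertices correspond to the parts of $\mathscr P$ and its hyperedges to $\delta(\mathscr P)$. Vertex-biconnected: for a vertex $v$, $H\setminus v$ is obtained by deleting $v$ from the vertex set and from all hyperedges containing it, discarding resulting empty hyperedges and loops. A (connected) hypergraph is vertex-biconnected if no single vertex deletion disconnects it. -}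

module Defs where

open import Algebra.Apartness.Bundles using (HeytingField; HeytingCommutativeRing)
open import Algebra.Bundles using (CommutativeRing)
import Algebra.Apartness.Properties.HeytingCommutativeRing as HeytingProperties
import Algebra.Definitions.RawMonoid as RawMonoidDefinitions
import Algebra.Properties.CommutativeMonoid.Sum as MonoidSum
import Algebra.Properties.Ring as RingProperties
open import Data.Bool.Base using (if_then_else_)
open import Data.Fin.Base using (Fin)
open import Data.Fin.Properties using (any?; _≟_)
open import Data.Fin.Subset
  using (Subset; inside; outside; ⊥; ⊤; _∈_; _⊆_; _⊂_; ∁; _∩_; _∪_; ⋃; _─_; _-_; ∣_∣; Nonempty)
open import Data.Fin.Subset.Properties using (_∈?_; _⊆?_; nonempty?)
open import Data.List.Base using (allFin; filter; foldl; map)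
open import Data.Nat.Base as ℕ using (ℕ; zero; suc; _∸_; NonZero)
import Data.Nat.Properties as ℕ
open import Data.Product using (Σ; ∃!; ∃-syntax; Σ-syntax; _×_; _,_; proj₁)
open import Data.Sum.Base using (_⊎_; inj₁; inj₂)
open import Data.Vec.Base using ([]; _∷_; tabulate)
open import Data.Vec.Functional using (Vector)
open import Function.Base using (_∘_)
open import Function.Bundles using (_⇔_; Equivalence)
open import Level using (Level; _⊔_) renaming (suc to lsuc)
open import Relation.Binary.Core using (Rel)
open import Relation.Binary.PropositionalEquality.Core using (_≡_)
open import Relation.Binary.Structures using (IsStrictPartialOrder)
open import Relation.Nullary using (¬_; does; ¬?; _×-dec_)
open import Relation.Unary using (Pred)
import Relation.Unary as U

fromDec : ∀ {n ℓ} {P : Pred (Fin n) ℓ} → U.Decidable P → Subset n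
fromDec P? = tabulate (does ∘ P?)

-- V = Fin n and E = Fin m; parallel hyperedges are distinct indices
-- with equal values of `edge`.  That V is nonempty is not a field, since
-- the theorem assumes 2 ≤ n.
record Hypergraph (n m : ℕ) : Set where
  field
    edge    : Fin m → Subset n
    noLoops : ∀ e → 2 ℕ.≤ ∣ edge e ∣

open Hypergraph public

-- Hypergraphs derived from one on Fin n and Fin m (induced
-- sub-hypergraphs, vertex deletions, contractions) keep the names of its
-- vertices and hyperedges.  The vertex set is `vertices`, the
-- hyperedges are the e ∈ edges, and such an e is the vertex subset
-- `ends e`.  For e ∉ edges the value of `ends e` is only bookkeeping.
record Minor (n m : ℕ) : Set where
  field
    vertices : Subset n
    edges    : Subset m
    ends     : Fin m → Subset n

open Minor public

whole : ∀ {n m} → Hypergraph n m → Minor n m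
whole H = record { vertices = ⊤ ; edges = ⊤ ; ends = edge H }

Connected : ∀ {n m} → Minor n m → Set
Connected G = ∀ X → Nonempty X → X ⊂ vertices G →
  ∃[ e ] (e ∈ edges G × Nonempty (ends G e ∩ X)
                      × Nonempty (ends G e ∩ (vertices G ─ X)))

infix 8 _[_]
_[_] : ∀ {n m} → Minor n m → Subset n → Minor n m
G [ X ] = record
  { vertices = X
  ; edges    = fromDec (λ e → (e ∈? edges G) ×-dec (ends G e ⊆? X))
  ; ends     = ends G
  }

-- Hyperedges left with fewer than two vertices are exactly the empty
-- ones and the loops.
infixl 7 _∖_
_∖_ : ∀ {n m} → Minor n m → Fin n → Minor n m
G ∖ v = record
  { vertices = vertices G - v
  ; edges    = fromDec (λ e → (e ∈? edges G) ×-dec (2 ℕ.≤? ∣ ends G e - v ∣))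
  ; ends     = λ e → ends G e - v
  }

-- The singleton of the least element of a nonempty set.
least : ∀ {n} → Subset n → Subset n
least []            = []
least (inside  ∷ p) = inside  ∷ ⊥
least (outside ∷ p) = outside ∷ least p

-- X with the vertices of f identified; the merged vertex is named after
-- the least vertex of f.
merge : ∀ {n} → Subset n → Subset n → Subset n
merge f X = if does (nonempty? (X ∩ f)) then (X ─ f) ∪ least f else X

-- The contracted hyperedge itself becomes a loop and so is removed.
infixl 7 _/_ _//_
_/_ : ∀ {n m} → Minor n m → Fin m → Minor n m
G / f = record
  { vertices = merge (ends G f) (vertices G)
  ; edges    = fromDec (λ e → (e ∈? edges G) ×-dec (2 ℕ.≤? ∣ merge (ends G f) (ends G e) ∣))
  ; ends     = λ e → merge (ends G f) (ends G e)
  }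

-- Successive contraction.  A member of F that has meanwhile become a
-- loop has a single end, and contracting it changes nothing.
_//_ : ∀ {n m} → Minor n m → Subset m → Minor n m
G // F = foldl _/_ G (filter (_∈? F) (allFin _))

VertexBiconnected : ∀ {n m} → Minor n m → Set
VertexBiconnected G = Connected G × (∀ v → v ∈ vertices G → Connected (G ∖ v))

record Partition (n k : ℕ) : Set where
  field
    part     : Fin k → Subset n
    nonempty : ∀ i → Nonempty (part i)
    covers   : ∀ v → ∃! _≡_ (λ i → v ∈ part i)

open Partition public

δ : ∀ {n m k} → Hypergraph n m → Partition n k → Subset m
δ H P = fromDec (λ e → any? λ i → any? λ j → ¬? (i ≟ j)
  ×-dec nonempty? (edge H e ∩ part P i) ×-dec nonempty? (edge H e ∩ part P j))

Feasible : ∀ {n m k} → Hypergraph n m → Partition n k → Set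
Feasible H P = ∀ i → Connected (whole H [ part P i ])

shrunk : ∀ {n m k} → Hypergraph n m → Partition n k → Minor n m
shrunk H P = whole H // ∁ (δ H P)

-- A multiset of hyperedges is given by its multiplicities.
Multiset : ℕ → Set
Multiset m = Fin m → ℕ

size : ∀ {m} → Multiset m → ℕ
size = MonoidSum.sum ℕ.+-0-commutativeMonoid

module _ {n m : ℕ} (H : Hypergraph n m) where

  -- A[X]: the members of A contained in X.
  within : Multiset m → Subset n → Multiset m
  within A X e = if does (edge H e ⊆? X) then A e else 0

  -- The vertex set of H[A].
  span : Multiset m → Subset n
  span A = ⋃ (map (edge H) (filter (λ e → 1 ℕ.≤? A e) (allFin m)))

  IsHyperforest : Multiset m → Set
  IsHyperforest A = ∀ X → Nonempty X → X ⊆ span A → size (within A X) ℕ.≤ ∣ X ∣ ∸ 1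

  IsHypertree : Multiset m → Set
  IsHypertree A = IsHyperforest A × size A ≡ ∣ span A ∣ ∸ 1

  IsMultiTree : Multiset m → Set
  IsMultiTree A = IsHypertree A × span A ≡ ⊤

-- Ordered fields in the constructive sense: the apartness x # y means
-- x < y or y < x, so that < is cotransitive and tight, but it need not be
-- decidable.  Constructive real numbers are an instance, and classically
-- these are exactly the (linearly) ordered fields.
record OrderedField (c ℓ₁ ℓ₂ ℓ₃ : Level) : Set (lsuc (c ⊔ ℓ₁ ⊔ ℓ₂ ⊔ ℓ₃)) where
  infix 4 _<_ _≤_
  field
    heytingField : HeytingField c ℓ₁ ℓ₂

  open HeytingField heytingField public

  field
    _<_                  : Rel Carrier ℓ₃
    isStrictPartialOrder : IsStrictPartialOrder _≈_ _<_
    #⇔<⊎>                : ∀ x y → (x # y) ⇔ (x < y ⊎ y < x)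
    +-monoˡ-<            : ∀ z {x y} → x < y → x + z < y + z
    *-pos                : ∀ {x y} → 0# < x → 0# < y → 0# < x * y

  _≤_ : Rel Carrier ℓ₃
  x ≤ y = ¬ (y < x)

  commutativeRing : CommutativeRing c ℓ₁
  commutativeRing = HeytingCommutativeRing.commutativeRing heytingCommutativeRing

  open CommutativeRing commutativeRing public
    using (ring; +-commutativeMonoid; +-rawMonoid)

  -- n ⋆ x is x + … + x with n summands.
  open RawMonoidDefinitions +-rawMonoid public using () renaming (_×_ to _⋆_)

  private
    module < = IsStrictPartialOrder isStrictPartialOrder
    open RingProperties ring
    open HeytingProperties heytingCommutativeRing

  0<1 : 0# < 1#
  0<1 with Equivalence.to (#⇔<⊎> 1# 0#) 1#0
  ... | inj₂ p = p
  ... | inj₁ p = <.<-respʳ-≈ -1*-1≈1 (*-pos 0<-1 0<-1)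
    where
    0<-1 : 0# < - 1#
    0<-1 = <.<-respʳ-≈ (+-identityˡ (- 1#))
             (<.<-respˡ-≈ (-‿inverseʳ 1#) (+-monoˡ-< (- 1#) p))
    -1*-1≈1 : - 1# * - 1# ≈ 1#
    -1*-1≈1 = trans (-1*x≈-x (- 1#)) (-‿involutive 1#)

  0<1+n : ∀ n → 0# < suc n ⋆ 1#
  0<1+n ℕ.zero  = <.<-respʳ-≈ (sym (+-identityʳ 1#)) 0<1
  0<1+n (suc n) = <.trans (0<1+n n)
    (<.<-respˡ-≈ (+-identityˡ (suc n ⋆ 1#)) (+-monoˡ-< (suc n ⋆ 1#) 0<1))

  1+n-invertible : ∀ n → Σ Carrier λ x → (suc n ⋆ 1#) * x ≈ 1#
  1+n-invertible n =
    let (x , _ , eq) = #⇒invertible (Equivalence.from (#⇔<⊎> _ _) (inj₂ (0<1+n n)))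
    in x , trans (*-congʳ (sym (x-0≈x (suc n ⋆ 1#)))) eq

  -- 1 / n
  recip : ∀ n .{{_ : NonZero n}} → Carrier
  recip (suc n) = proj₁ (1+n-invertible n)

module _ {c ℓ₁ ℓ₂ ℓ₃} (K : OrderedField c ℓ₁ ℓ₂ ℓ₃) where
  open OrderedField K using (Carrier; 0#; 1#; _≈_; _<_; _≤_; _+_; _*_; _⋆_; recip)
    renaming (_-_ to _⊖_)

  Equal : ∀ {m} → Rel (Vector Carrier m) ℓ₁
  Equal x y = ∀ e → x e ≈ y e

  dot : ∀ {m} → Vector Carrier m → Vector Carrier m → Carrier
  dot x y = MonoidSum.sum (OrderedField.+-commutativeMonoid K) (λ e → x e * y e)

  Adm : ∀ {m ℓ} → Pred (Vector Carrier m) ℓ → Pred (Vector Carrier m) (c ⊔ ℓ₃ ⊔ ℓ)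
  Adm Γ ρ = (∀ e → 0# ≤ ρ e) × (∀ γ → Γ γ → 1# ≤ dot γ ρ)

  ExtremePoint : ∀ {m ℓ} → Pred (Vector Carrier m) ℓ →
                 Pred (Vector Carrier m) (c ⊔ ℓ₁ ⊔ ℓ₃ ⊔ ℓ)
  ExtremePoint S x = S x × (∀ y z t → S y → S z → 0# < t → t < 1# →
    Equal x (λ e → t * y e + (1# ⊖ t) * z e) → Equal x y × Equal x z)

  Blocker : ∀ {m ℓ} → Pred (Vector Carrier m) ℓ →
            Pred (Vector Carrier m) (c ⊔ ℓ₁ ⊔ ℓ₃ ⊔ ℓ)
  Blocker Γ = ExtremePoint (Adm Γ)

  multiplicityVector : ∀ {m} → Multiset m → Vector Carrier m
  multiplicityVector A e = A e ⋆ 1#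

  indicator : ∀ {m} → Subset m → Vector Carrier m
  indicator F e = if does (e ∈? F) then 1# else 0#

  Ω : ∀ {n m} → Hypergraph n m → Pred (Vector Carrier m) ℓ₁
  Ω H γ = ∃[ A ] (IsMultiTree H A × Equal γ (multiplicityVector A))

  partitionVector : ∀ {n m k} → Hypergraph n m → Partition n k → 2 ℕ.≤ k → Vector Carrier m
  partitionVector {k = k} H P 2≤k e = recip (k ∸ 1) * indicator (δ H P) e
    where instance
    k∸1≢0 : NonZero (k ∸ 1)
    k∸1≢0 = ℕ.>-nonZero (ℕ.m<n⇒0<n∸m 2≤k)

{-# OPTIONS --safe #-}

-- Call a multiset A of hyperedges a base if it has n ∸ 1 members and fewer than ∣ X ∣ of them lie in
-- any nonempty X; a set X is tight if exactly ∣ X ∣ ∸ 1 do.  Tight sets that meet are closed under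
-- union and intersection, so a base may exchange a member f for e whenever f lies in the smallest
-- tight set around e.  Hence any base can be moved into a given Z as far as possible, and then its
-- part in Z spans every component of Z tightly.
--
-- Counting members inside the parts shows that the vector of a partition P is admissible and is
-- tight exactly at the bases spanning each part.  If it is a convex combination of y and z, then y
-- has weight 1 on all these bases, so y takes equal values on cut hyperedges that can be exchanged;
-- biconnectedness links any two cut hyperedges by exchanges, and y is the vector of P.
--
-- Conversely let ρ be extreme, Z its zero set and P the partition into components of Z.  Moving
-- bases into Z shows that ρ minus a small multiple of the vector of P stays admissible after
-- rescaling, so ρ is that vector.  A cut vertex of the shrunk hypergraph would split it into a
-- proper convex combination.  Equality and order on K are not decidable, so this only proves the
-- double negation of the existence of P; but then each ρ e is one of finitely many numbers that are
-- pairwise apart, cotransitivity tells which one, and P is found by a finite search.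
module Submission where

-- A base may contain several copies of a hyperedge, and a hyperedge does not behave like a path, so
-- there are no fundamental cycles to exchange along. The smallest tight set around `e` takes their
-- place, and every argument about bases is a count combined with uncrossing.
--
-- Biconnectedness enters by contradiction. Suppose the cut hyperedges fall into two classes without
-- exchanges between them. Some part meets both classes. Take a base in which no cut hyperedge at
-- this part can be exchanged for a hyperedge of another kind. Around the part each class then grows
-- a tight set. A member joining the part to the rest of their intersection would lie in both
-- classes, so the two sets share only the part, which is therefore a cut vertex.
--
-- For an extreme `ρ`, the direction of the perturbation is forced: a vector vanishing on `Z` cannot
-- get heavier when a base is moved into `Z`, and on the resulting bases the cut vector has weight
-- exactly one.
--
-- The shrunk hypergraph arises by iterated renaming. It is used only through a vertex map whose
-- fibres are the parts, and biconnectedness is restated in `H`.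

open import Defs
open import Algebra.Bundles using (CommutativeRing)
import Algebra.Properties.CommutativeMonoid.Mult as Mult
import Algebra.Properties.CommutativeMonoid.Sum as MonoidSum
import Algebra.Properties.Group as GroupProperties
import Algebra.Properties.Semiring.Mult as SemiringMult
import Algebra.Properties.Semiring.Sum as SemiringSum
import Algebra.Solver.Ring.NaturalCoefficients.Default as SemiringSolver
open import Data.Bool.Base using (if_then_else_)
open import Data.Empty using (⊥-elim)
open import Data.Fin.Base using (Fin; zero; suc; fromℕ<; toℕ)
import Data.Fin.Properties as Fin
open import Data.Fin.Subset
  using (Subset; inside; outside; ⊤; ⁅_⁆; _∈_; _∉_; _⊆_; _⊂_; ∁; _∩_; _∪_; ⋃; _─_; _-_; ∣_∣; Nonempty)
open import Data.Fin.Subset.Properties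
open import Data.List.Base using (List; []; _∷_; foldl; filter; allFin)
import Data.List.Membership.Propositional as List
open import Data.List.Membership.Propositional.Properties using (∈-filter⁺; ∈-filter⁻; ∈-allFin; ∈-map⁺)
import Data.List.Relation.Unary.Any as Any
open import Data.Nat.Base using (ℕ; zero; suc; _+_; _∸_; _≤_; _<_; z≤n; s≤s; NonZero; >-nonZero)
import Data.Nat.Properties as ℕ
open import Data.Nat.Tactic.RingSolver using (solve-∀)
open import Data.Product.Base using (_×_; _,_; proj₁; proj₂; ∃; ∃-syntax; Σ-syntax)
open import Data.Sum.Base using (_⊎_; inj₁; inj₂)
open import Data.Vec.Base using (Vec; []; _∷_; lookup; here; there; tabulate)
open import Data.Vec.Functional using (Vector)
open import Data.Vec.Properties using (lookup⇒[]=; []=⇒lookup; lookup∘tabulate)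
open import Function.Base using (_∘_; id; case_of_)
open import Function.Bundles using (Equivalence)
open import Relation.Binary.Definitions using (tri<; tri≈; tri>)
open import Relation.Binary.PropositionalEquality
  using (_≡_; _≢_; refl; sym; trans; cong; cong₂; subst; subst₂; module ≡-Reasoning)
import Relation.Binary.Reasoning.Setoid as SetoidReasoning
open import Relation.Binary.Structures using (IsStrictPartialOrder)
open import Relation.Nullary
  using (¬_; Dec; yes; no; does; contradiction; ¬?; _×-dec_; decidable-stable)
open import Relation.Nullary.Decidable
  using (dec-true; dec-false; map′; _→-dec_; _⊎-dec_; ¬¬-excluded-middle)
open import Relation.Unary using (_≐_)
import Relation.Unary as U

open MonoidSum ℕ.+-0-commutativeMonoid using (sum; sum-cong-≗; ∑-distrib-+; ∑-comm)

private variable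
  n m k : ℕ

-- Sums and finite subsets

-- The format of the counting arguments: `l ≤ r` is the sum of all available inequalities, the
-- identity is left to the ring solver, and `s` is the slack that remains.
linear-≤ : ∀ {a b l r} s → l ≤ r → a + r + s ≡ b + l → a ≤ b
linear-≤ {a} {b} {l} {r} s l≤r eq = ℕ.+-cancelʳ-≤ r a b (begin
  a + r      ≤⟨ ℕ.m≤m+n (a + r) s ⟩
  a + r + s  ≡⟨ eq ⟩
  b + l      ≤⟨ ℕ.+-monoʳ-≤ b l≤r ⟩
  b + r      ∎)
  where open ℕ.≤-Reasoning

module _ {p} {P : Fin n → Set p} (P? : U.Decidable P) where

  ∈-fromDec⁺ : ∀ {v} → P v → v ∈ fromDec P?
  ∈-fromDec⁺ {v} p = lookup⇒[]= v _
    (trans (lookup∘tabulate (does ∘ P?) v) (dec-true (P? v) p))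

  ∈-fromDec⁻ : ∀ {v} → v ∈ fromDec P? → P v
  ∈-fromDec⁻ {v} v∈ with P? v | trans (sym (lookup∘tabulate (does ∘ P?) v)) ([]=⇒lookup v∈)
  ... | yes p | _ = p
  ... | no  _ | ()

x∈p─q⇒x∉q : ∀ {x} (p q : Subset n) → x ∈ p ─ q → x ∉ q
x∈p─q⇒x∉q (inside ∷ p) (outside ∷ q) here ()
x∈p─q⇒x∉q (_ ∷ p) (_ ∷ q) (there x∈) (there x∈q) = x∈p─q⇒x∉q p q x∈ x∈q

∪-⊆ : {X Y Z : Subset n} → X ⊆ Z → Y ⊆ Z → X ∪ Y ⊆ Z
∪-⊆ {X = X} {Y} X⊆Z Y⊆Z v∈ with x∈p∪q⁻ X Y v∈
... | inj₁ v∈X = X⊆Z v∈X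
... | inj₂ v∈Y = Y⊆Z v∈Y

∩-⊇ : {X Y Z : Subset n} → Z ⊆ X → Z ⊆ Y → Z ⊆ X ∩ Y
∩-⊇ Z⊆X Z⊆Y v∈ = x∈p∩q⁺ (Z⊆X v∈ , Z⊆Y v∈)

⊈⇒∃ : {X Y : Subset n} → ¬ (X ⊆ Y) → ∃[ v ] (v ∈ X × v ∉ Y)
⊈⇒∃ {X = X} {Y} X⊈Y with Fin.any? (λ v → (v ∈? X) ×-dec ¬? (v ∈? Y))
... | yes found = found
... | no  none  = contradiction
  (λ {v} v∈X → decidable-stable (v ∈? Y) (λ v∉Y → none (v , v∈X , v∉Y))) X⊈Y

∣p∪q∣+∣p∩q∣ : ∀ (p q : Subset n) → ∣ p ∪ q ∣ + ∣ p ∩ q ∣ ≡ ∣ p ∣ + ∣ q ∣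
∣p∪q∣+∣p∩q∣ [] [] = refl
∣p∪q∣+∣p∩q∣ (outside ∷ p) (outside ∷ q) = ∣p∪q∣+∣p∩q∣ p q
∣p∪q∣+∣p∩q∣ (outside ∷ p) (inside ∷ q) =
  trans (cong suc (∣p∪q∣+∣p∩q∣ p q)) (sym (ℕ.+-suc ∣ p ∣ ∣ q ∣))
∣p∪q∣+∣p∩q∣ (inside ∷ p) (outside ∷ q) = cong suc (∣p∪q∣+∣p∩q∣ p q)
∣p∪q∣+∣p∩q∣ (inside ∷ p) (inside ∷ q) = cong suc
  (trans (ℕ.+-suc _ _) (trans (cong suc (∣p∪q∣+∣p∩q∣ p q)) (sym (ℕ.+-suc ∣ p ∣ ∣ q ∣))))

∣p∣+∣q─p∣≤∣q∣ : {p q : Subset n} → p ⊆ q → ∣ p ∣ + ∣ q ─ p ∣ ≤ ∣ q ∣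
∣p∣+∣q─p∣≤∣q∣ {n = n} {p} {q} p⊆q = begin
  ∣ p ∣ + ∣ q ─ p ∣                    ≡⟨ ∣p∪q∣+∣p∩q∣ p (q ─ p) ⟨
  ∣ p ∪ (q ─ p) ∣ + ∣ p ∩ (q ─ p) ∣    ≡⟨ cong (∣ p ∪ (q ─ p) ∣ +_) (trans (cong ∣_∣
    (Empty-unique λ (u , u∈) → x∈p─q⇒x∉q q p (p∩q⊆q p (q ─ p) u∈) (p∩q⊆p p (q ─ p) u∈)))
    (∣⊥∣≡0 n)) ⟩
  ∣ p ∪ (q ─ p) ∣ + 0                  ≡⟨ ℕ.+-identityʳ _ ⟩
  ∣ p ∪ (q ─ p) ∣                      ≤⟨ p⊆q⇒∣p∣≤∣q∣ (∪-⊆ p⊆q (p─q⊆p q p)) ⟩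
  ∣ q ∣                                ∎
  where open ℕ.≤-Reasoning

⟦_⟧ : ∀ {p} {P : Set p} → Dec P → ℕ
⟦ P? ⟧ = if does P? then 1 else 0

∣p∣≡∑ : ∀ (p : Subset n) → ∣ p ∣ ≡ sum (λ v → ⟦ v ∈? p ⟧)
∣p∣≡∑ []            = refl
∣p∣≡∑ (inside  ∷ p) = cong suc (∣p∣≡∑ p)
∣p∣≡∑ (outside ∷ p) = ∣p∣≡∑ p

sum-mono : {f g : Fin n → ℕ} → (∀ i → f i ≤ g i) → sum f ≤ sum g
sum-mono {n = zero}  f≤g = z≤n
sum-mono {n = suc n} f≤g = ℕ.+-mono-≤ (f≤g zero) (sum-mono (f≤g ∘ suc))

sum-zero : {f : Fin n → ℕ} → (∀ i → f i ≡ 0) → sum f ≡ 0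
sum-zero {n = zero}  _   = refl
sum-zero {n = suc n} f≡0 = cong₂ _+_ (f≡0 zero) (sum-zero (f≡0 ∘ suc))

term≤sum : ∀ (f : Fin n → ℕ) i → f i ≤ sum f
term≤sum f zero    = ℕ.m≤m+n (f zero) _
term≤sum f (suc i) = ℕ.≤-trans (term≤sum (f ∘ suc) i) (ℕ.m≤n+m _ (f zero))

sum-single : {f : Fin n → ℕ} → ∀ i → (∀ j → j ≢ i → f j ≡ 0) → sum f ≡ f i
sum-single {f = f} zero f≡0 =
  trans (cong (f zero +_) (sum-zero (λ j → f≡0 (suc j) λ ()))) (ℕ.+-identityʳ _)
sum-single (suc i) f≡0  = cong₂ _+_ (f≡0 zero λ ())
  (sum-single i (λ j j≢i → f≡0 (suc j) (j≢i ∘ Fin.suc-injective)))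

sum-unit : ∀ (e : Fin m) → sum (λ g → ⟦ g Fin.≟ e ⟧) ≡ 1
sum-unit e = trans (sum-single e λ g g≢e → cong (λ b → if b then 1 else 0) (dec-false (g Fin.≟ e) g≢e))
  (cong (λ b → if b then 1 else 0) (dec-true (e Fin.≟ e) refl))

sum-ones : ∀ n → sum {n} (λ _ → 1) ≡ n
sum-ones zero    = refl
sum-ones (suc n) = cong suc (sum-ones n)

module _ {Q : Subset n → Set} (Q? : U.Decidable Q) where

  abstract
    maximal : ∀ X → Q X → ∃[ Y ] (X ⊆ Y × Q Y × (∀ Z → Q Z → ¬ (Y ⊂ Z)))
    maximal X q = grow n X q (ℕ.m≤m+n n ∣ X ∣)
      where
      -- The fuel bounds the number of vertices still missing from `X`; every enlargement uses up at
      -- least one.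
      grow : ∀ fuel X → Q X → n ≤ fuel + ∣ X ∣ →
             ∃[ Y ] (X ⊆ Y × Q Y × (∀ Z → Q Z → ¬ (Y ⊂ Z)))
      grow fuel X q bound with anySubset? (λ Z → Q? Z ×-dec (X ⊂? Z))
      ... | no none = X , id , q , λ Z qZ X⊂Z → none (Z , qZ , X⊂Z)
      grow zero X q bound | yes (Z , qZ , X⊂Z) = contradiction
        (ℕ.≤-trans (p⊂q⇒∣p∣<∣q∣ X⊂Z) (∣p∣≤n Z)) (ℕ.≤⇒≯ bound)
      grow (suc fuel) X q bound | yes (Z , qZ , X⊂Z)
        with grow fuel Z qZ (ℕ.≤-trans bound
               (ℕ.≤-trans (ℕ.≤-reflexive (sym (ℕ.+-suc fuel ∣ X ∣)))
                 (ℕ.+-monoʳ-≤ fuel (p⊂q⇒∣p∣<∣q∣ X⊂Z))))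
      ... | Y , Z⊆Y , qY , max = Y , Z⊆Y ∘ proj₁ X⊂Z , qY , max

  abstract
    minimal : ∀ X → Q X → ∃[ Y ] (Y ⊆ X × Q Y × (∀ Z → Q Z → ¬ (Z ⊂ Y)))
    minimal X q = shrink ∣ X ∣ X q ℕ.≤-refl
      where
      shrink : ∀ fuel X → Q X → ∣ X ∣ ≤ fuel →
               ∃[ Y ] (Y ⊆ X × Q Y × (∀ Z → Q Z → ¬ (Z ⊂ Y)))
      shrink fuel X q bound with anySubset? (λ Z → Q? Z ×-dec (Z ⊂? X))
      ... | no none = X , id , q , λ Z qZ Z⊂X → none (Z , qZ , Z⊂X)
      shrink zero X q bound | yes (Z , qZ , Z⊂X) = contradiction
        (ℕ.≤-trans (p⊂q⇒∣p∣<∣q∣ Z⊂X) bound) λ ()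
      shrink (suc fuel) X q bound | yes (Z , qZ , Z⊂X)
        with shrink fuel Z qZ (ℕ.≤-pred (ℕ.≤-trans (p⊂q⇒∣p∣<∣q∣ Z⊂X) bound))
      ... | Y , Y⊆Z , qY , min = Y , proj₁ Z⊂X ∘ Y⊆Z , qY , min

-- Forests and tight sets

Multi : {n : ℕ} → Subset n → Set
Multi X = ∃[ u ] ∃[ w ] (u ∈ X × w ∈ X × u ≢ w)

2≤∣p∣⇒Multi : (p : Subset n) → 2 ≤ ∣ p ∣ → Multi p
2≤∣p∣⇒Multi (outside ∷ p) 2≤ with 2≤∣p∣⇒Multi p 2≤
... | u , w , u∈ , w∈ , u≢w = suc u , suc w , there u∈ , there w∈ , u≢w ∘ Fin.suc-injective
2≤∣p∣⇒Multi {suc n} (inside ∷ p) (s≤s 1≤) with nonempty? p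
... | yes (w , w∈) = zero , suc w , here , there w∈ , λ ()
... | no  empty    = contradiction
  (subst (1 ≤_) (trans (cong ∣_∣ (Empty-unique empty)) (∣⊥∣≡0 n)) 1≤) λ ()

Multi⇒2≤∣p∣ : (p : Subset n) → Multi p → 2 ≤ ∣ p ∣
Multi⇒2≤∣p∣ p (u , w , u∈ , w∈ , u≢w) = begin
  2                ≡⟨ cong suc (sym (∣⁅x⁆∣≡1 u)) ⟩
  suc ∣ ⁅ u ⁆ ∣    ≤⟨ p⊂q⇒∣p∣<∣q∣ ((λ v∈ → subst (_∈ p) (sym (x∈⁅y⁆⇒x≡y u v∈)) u∈)
                                 , w , w∈ , x≢y⇒x∉⁅y⁆ (u≢w ∘ sym)) ⟩
  ∣ p ∣            ∎
  where open ℕ.≤-Reasoning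

nonempty⇒1≤∣p∣ : {p : Subset n} → Nonempty p → 1 ≤ ∣ p ∣
nonempty⇒1≤∣p∣ {p = p} (v , v∈) = subst (_≤ ∣ p ∣) (∣⁅x⁆∣≡1 v)
  (p⊆q⇒∣p∣≤∣q∣ (λ u∈ → subst (_∈ p) (sym (x∈⁅y⁆⇒x≡y v u∈)) v∈))

module _ (A : Multiset m) where

  adjoin remove : Fin m → Multiset m
  adjoin e g = A g + ⟦ g Fin.≟ e ⟧
  remove f g = A g ∸ ⟦ g Fin.≟ f ⟧

  remove-other : ∀ {f g} → g ≢ f → remove f g ≡ A g
  remove-other {f} {g} g≢f with g Fin.≟ f
  ... | yes g≡f = contradiction g≡f g≢f
  ... | no  _   = refl

  adjoin-other : ∀ {e g} → g ≢ e → adjoin e g ≡ A g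
  adjoin-other {e} {g} g≢e with g Fin.≟ e
  ... | yes g≡e = contradiction g≡e g≢e
  ... | no  _   = ℕ.+-identityʳ _

  adjoin-≥ : ∀ e g → A g ≤ adjoin e g
  adjoin-≥ e g = ℕ.m≤m+n (A g) _

  remove-≤ : ∀ f g → remove f g ≤ A g
  remove-≤ f g = ℕ.m∸n≤m (A g) ⟦ g Fin.≟ f ⟧

exchange : Multiset m → Fin m → Fin m → Multiset m
exchange A f e = adjoin (remove A f) e

remove-adjoin : ∀ (A : Multiset m) {f} → 0 < A f → ∀ g → adjoin (remove A f) f g ≡ A g
remove-adjoin A {f} 0<Af g with g Fin.≟ f
... | yes refl = ℕ.m∸n+n≡m 0<Af
... | no  _    = ℕ.+-identityʳ _

module Inner {n m} (H : Hypergraph n m) where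

  inner : Multiset m → Subset n → ℕ
  inner A X = size (within H A X)

  Forest : Multiset m → Set
  Forest A = ∀ X → Nonempty X → inner A X < ∣ X ∣

  -- For nonempty `X` a forest satisfies the reverse inequality, so this is equality there, stated
  -- without truncated subtraction.
  Tight : Multiset m → Subset n → Set
  Tight A X = ∣ X ∣ ≤ suc (inner A X)

  Base : Multiset m → Set
  Base A = Forest A × suc (size A) ≡ n

  edge-nonempty : ∀ e → Nonempty (edge H e)
  edge-nonempty e with 2≤∣p∣⇒Multi (edge H e) (noLoops H e)
  ... | u , _ , u∈ , _ = u , u∈

  module _ (A : Multiset m) where

    within-in : ∀ {X e} → edge H e ⊆ X → within H A X e ≡ A e
    within-in {X} {e} e⊆X rewrite dec-true (edge H e ⊆? X) e⊆X = refl

    within-out : ∀ {X e} → ¬ (edge H e ⊆ X) → within H A X e ≡ 0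
    within-out {X} {e} e⊈X rewrite dec-false (edge H e ⊆? X) e⊈X = refl

    within-mono : ∀ {X Y} e → (edge H e ⊆ X → edge H e ⊆ Y) → within H A X e ≤ within H A Y e
    within-mono {X} {Y} e imp with edge H e ⊆? X
    ... | yes e⊆X rewrite dec-true (edge H e ⊆? Y) (imp e⊆X) = ℕ.≤-refl
    ... | no  _   = z≤n

    inner-⊆ : ∀ {X Y} → X ⊆ Y → inner A X ≤ inner A Y
    inner-⊆ X⊆Y = sum-mono (λ e → within-mono e (λ e⊆X {v} v∈ → X⊆Y (e⊆X v∈)))

    inner-⊤ : inner A ⊤ ≡ size A
    inner-⊤ = sum-cong-≗ (λ e → within-in {⊤} {e} ⊆⊤)

    -- A hyperedge inside `X` or `Y` is inside the union, and one inside both is also inside the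
    -- intersection. Only hyperedges of the union that lie in neither set make the inequality
    -- strict.
    inner-supermodular : ∀ X Y → inner A X + inner A Y ≤ inner A (X ∪ Y) + inner A (X ∩ Y)
    inner-supermodular X Y = subst₂ _≤_
      (∑-distrib-+ (within H A X) (within H A Y))
      (∑-distrib-+ (within H A (X ∪ Y)) (within H A (X ∩ Y)))
      (sum-mono pointwise)
      where
      pointwise : ∀ e → within H A X e + within H A Y e
                      ≤ within H A (X ∪ Y) e + within H A (X ∩ Y) e
      pointwise e with edge H e ⊆? X | edge H e ⊆? Y
      ... | yes p | yes q
        rewrite dec-true (edge H e ⊆? X ∪ Y) (λ v∈ → p⊆p∪q Y (p v∈))
              | dec-true (edge H e ⊆? X ∩ Y) (λ v∈ → x∈p∩q⁺ (p v∈ , q v∈)) = ℕ.≤-refl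
      ... | yes p | no _
        rewrite dec-true (edge H e ⊆? X ∪ Y) (λ v∈ → p⊆p∪q Y (p v∈)) = ℕ.+-monoʳ-≤ (A e) z≤n
      ... | no _ | yes q
        rewrite dec-true (edge H e ⊆? X ∪ Y) (λ v∈ → q⊆p∪q X Y (q v∈)) = ℕ.m≤m+n (A e) _
      ... | no _ | no _ = z≤n

  inner-mono : ∀ {A B X} → (∀ e → edge H e ⊆ X → A e ≤ B e) → inner A X ≤ inner B X
  inner-mono {A} {B} {X} A≤B = sum-mono pointwise
    where
    pointwise : ∀ e → within H A X e ≤ within H B X e
    pointwise e with edge H e ⊆? X
    ... | yes e⊆X = A≤B e e⊆X
    ... | no  _   = z≤n

  inner-cong : ∀ {A B} X → (∀ e → A e ≡ B e) → inner A X ≡ inner B X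
  inner-cong X A≡B = ℕ.≤-antisym
    (inner-mono (λ e _ → ℕ.≤-reflexive (A≡B e)))
    (inner-mono (λ e _ → ℕ.≤-reflexive (sym (A≡B e))))

  private
    within-adjoin : ∀ A e X g → within H (adjoin A e) X g
                  ≡ within H A X g + (if does (edge H e ⊆? X) then ⟦ g Fin.≟ e ⟧ else 0)
    within-adjoin A e X g with g Fin.≟ e
    within-adjoin A e X g | yes refl with edge H e ⊆? X
    ... | yes _ = refl
    ... | no  _ = refl
    within-adjoin A e X g | no g≢e with edge H g ⊆? X | edge H e ⊆? X
    ... | yes _ | yes _ = refl
    ... | yes _ | no  _ = refl
    ... | no  _ | yes _ = refl
    ... | no  _ | no  _ = refl

    inner-adjoin : ∀ A e X → inner (adjoin A e) X
      ≡ inner A X + sum (λ g → if does (edge H e ⊆? X) then ⟦ g Fin.≟ e ⟧ else 0)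
    inner-adjoin A e X = trans (sum-cong-≗ (within-adjoin A e X)) (∑-distrib-+ (within H A X) _)

  inner-adjoin-in : ∀ A {e X} → edge H e ⊆ X → inner (adjoin A e) X ≡ suc (inner A X)
  inner-adjoin-in A {e} {X} e⊆X = trans (inner-adjoin A e X)
    (trans (cong (inner A X +_) (trans (sum-cong-≗ chosen) (sum-unit e))) (ℕ.+-comm _ 1))
    where
    chosen : ∀ g → (if does (edge H e ⊆? X) then ⟦ g Fin.≟ e ⟧ else 0) ≡ ⟦ g Fin.≟ e ⟧
    chosen g rewrite dec-true (edge H e ⊆? X) e⊆X = refl

  inner-adjoin-out : ∀ A {e X} → ¬ (edge H e ⊆ X) → inner (adjoin A e) X ≡ inner A X
  inner-adjoin-out A {e} {X} e⊈X = trans (inner-adjoin A e X)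
    (trans (cong (inner A X +_) (sum-zero absent)) (ℕ.+-identityʳ _))
    where
    absent : ∀ g → (if does (edge H e ⊆? X) then ⟦ g Fin.≟ e ⟧ else 0) ≡ 0
    absent g rewrite dec-false (edge H e ⊆? X) e⊈X = refl

  inner-remove-in : ∀ A {f X} → 0 < A f → edge H f ⊆ X → suc (inner (remove A f) X) ≡ inner A X
  inner-remove-in A {f} {X} 0<Af f⊆X =
    trans (sym (inner-adjoin-in (remove A f) f⊆X)) (inner-cong X (remove-adjoin A 0<Af))

  inner-remove-out : ∀ A {f X} → 0 < A f → ¬ (edge H f ⊆ X) → inner (remove A f) X ≡ inner A X
  inner-remove-out A {f} {X} 0<Af f⊈X =
    trans (sym (inner-adjoin-out (remove A f) f⊈X)) (inner-cong X (remove-adjoin A 0<Af))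

  size-adjoin : ∀ A e → size (adjoin A e) ≡ suc (size A)
  size-adjoin A e = trans (sym (inner-⊤ (adjoin A e)))
    (trans (inner-adjoin-in A {e} {⊤} ⊆⊤) (cong suc (inner-⊤ A)))

  size-exchange : ∀ A {f} e → 0 < A f → size (exchange A f e) ≡ size A
  size-exchange A {f} e 0<Af = trans (size-adjoin (remove A f) e)
    (trans (sym (size-adjoin (remove A f) f)) (sum-cong-≗ (remove-adjoin A 0<Af)))

  forest? : ∀ A → Dec (Forest A)
  forest? A with anySubset? (λ X → nonempty? X ×-dec (∣ X ∣ ℕ.≤? inner A X))
  ... | yes (X , ne , ≤inner) = no (λ forest → ℕ.<⇒≱ (forest X ne) ≤inner)
  ... | no  none = yes (λ X ne → ℕ.≰⇒> (λ ≤inner → none (X , ne , ≤inner)))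

  tight? : ∀ A X → Dec (Tight A X)
  tight? A X = ∣ X ∣ ℕ.≤? suc (inner A X)

  forest-mono : ∀ {A B} → (∀ e → A e ≤ B e) → Forest B → Forest A
  forest-mono A≤B forest X ne = ℕ.≤-<-trans (inner-mono (λ e _ → A≤B e)) (forest X ne)

  module _ {A} (forest : Forest A) {X Y} (tightX : Tight A X) (tightY : Tight A Y)
           (meet : Nonempty (X ∩ Y)) where

    private
      -- Uncrossing: sizes are modular, `inner` is supermodular, and the forest bound for the set of
      -- size `i` pushes the missing amount to the set of size `u`. Union and intersection take
      -- these two roles in turn.
      arith∪ : ∀ {x y u i a b c d} → u + i ≡ x + y → a + b ≤ c + d →
               x ≤ suc a → y ≤ suc b → suc d ≤ i → u ≤ suc c
      arith∪ {x} {y} {u} {i} {a} {b} {c} {d} eq super x≤ y≤ d< =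
        linear-≤ 0 (ℕ.+-mono-≤ super (ℕ.+-mono-≤ x≤ (ℕ.+-mono-≤ y≤ (ℕ.+-mono-≤ d< (ℕ.≤-reflexive eq)))))
          (ring u i x y a b c d)
        where
        ring : ∀ u i x y a b c d →
          u + (c + d + (suc a + (suc b + (i + (x + y))))) + 0
          ≡ suc c + (a + b + (x + (y + (suc d + (u + i)))))
        ring = solve-∀

    tight-∪ : Tight A (X ∪ Y)
    tight-∪ = arith∪ (∣p∪q∣+∣p∩q∣ X Y) (inner-supermodular A X Y) tightX tightY
      (forest (X ∩ Y) meet)

    tight-∩ : Tight A (X ∩ Y)
    tight-∩ = arith∪
      (trans (ℕ.+-comm ∣ X ∩ Y ∣ _) (∣p∪q∣+∣p∩q∣ X Y))
      (ℕ.≤-trans (inner-supermodular A X Y) (ℕ.≤-reflexive (ℕ.+-comm _ (inner A (X ∩ Y)))))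
      tightX tightY (forest (X ∪ Y) (proj₁ meet , p⊆p∪q Y (p∩q⊆p X Y (proj₂ meet))))

  tight-⁅⁆ : ∀ A v → Tight A ⁅ v ⁆
  tight-⁅⁆ A v = ℕ.≤-trans (ℕ.≤-reflexive (∣⁅x⁆∣≡1 v)) (s≤s z≤n)

  tight-⊤ : ∀ {A} → Base A → Tight A ⊤
  tight-⊤ {A} (_ , size≡) = ℕ.≤-reflexive
    (trans (∣⊤∣≡n n) (trans (sym size≡) (cong suc (sym (inner-⊤ A)))))

  -- f leaves every tight set through which e would violate the forest condition.
  exchange-forest : ∀ {A} → Forest A → ∀ {Y e f} → Tight A Y → edge H e ⊆ Y →
    (∀ Z → Tight A Z × edge H e ⊆ Z → ¬ (Z ⊂ Y)) →
    0 < A f → edge H f ⊆ Y → Forest (exchange A f e)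
  exchange-forest {A} forest {Y} {e} {f} tightY e⊆Y minY 0<Af f⊆Y W ne
    with edge H e ⊆? W | edge H f ⊆? W
  ... | no e⊈W | _ = ℕ.≤-<-trans
    (ℕ.≤-trans (ℕ.≤-reflexive (inner-adjoin-out (remove A f) e⊈W))
      (inner-mono (λ g _ → remove-≤ A f g))) (forest W ne)
  ... | yes e⊆W | yes f⊆W = ℕ.≤-<-trans (ℕ.≤-reflexive
    (trans (inner-adjoin-in (remove A f) e⊆W) (inner-remove-in A 0<Af f⊆W))) (forest W ne)
  ... | yes e⊆W | no f⊈W = ℕ.≤-<-trans (ℕ.≤-reflexive
    (trans (inner-adjoin-in (remove A f) e⊆W) (cong suc (inner-remove-out A 0<Af f⊈W))))
    (ℕ.≰⇒> notTight)
    where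
    notTight : ¬ Tight A W
    -- The intersection is tight, still contains `e`, and lacks a vertex of `f`, so it is a smaller
    -- tight set around `e` than `Y`.
    notTight tightW = minY (W ∩ Y)
      ( tight-∩ forest tightW tightY (v , e⊆W∩Y v∈) , e⊆W∩Y)
      ( p∩q⊆q W Y , u , f⊆Y u∈f , λ u∈ → u∉W (p∩q⊆p W Y u∈))
      where
      leaving = ⊈⇒∃ f⊈W
      u = proj₁ leaving
      u∈f = proj₁ (proj₂ leaving)
      u∉W = proj₂ (proj₂ leaving)
      e⊆W∩Y : edge H e ⊆ W ∩ Y
      e⊆W∩Y u∈ = x∈p∩q⁺ (e⊆W u∈ , e⊆Y u∈)
      v = proj₁ (edge-nonempty e)
      v∈ = proj₂ (edge-nonempty e)

-- Components and exchanges

sum-mono-< : {f g : Fin n → ℕ} → (∀ i → f i ≤ g i) → ∀ i → f i < g i → sum f < sum g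
sum-mono-< f≤g zero    f<g = ℕ.+-mono-<-≤ f<g (sum-mono (f≤g ∘ suc))
sum-mono-< f≤g (suc i) f<g = ℕ.+-mono-≤-< (f≤g zero) (sum-mono-< (f≤g ∘ suc) i f<g)

restrict : Subset m → Multiset m → Multiset m
restrict Z A e = if does (e ∈? Z) then A e else 0

module _ (Z : Subset m) (A : Multiset m) where

  restrict-in : ∀ {e} → e ∈ Z → restrict Z A e ≡ A e
  restrict-in {e} e∈Z rewrite dec-true (e ∈? Z) e∈Z = refl

  restrict-out : ∀ {e} → e ∉ Z → restrict Z A e ≡ 0
  restrict-out {e} e∉Z rewrite dec-false (e ∈? Z) e∉Z = refl

  restrict-≤ : ∀ e → restrict Z A e ≤ A e
  restrict-≤ e with e ∈? Z
  ... | yes _ = ℕ.≤-refl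
  ... | no  _ = z≤n

module Trees {n m} (H : Hypergraph n m) where
  open Inner H

  Closed : Subset m → Subset n → Set
  Closed Z W = ∀ e → e ∈ Z → Nonempty (edge H e ∩ W) → edge H e ⊆ W

  -- Connectedness of `W` by hyperedges of `Z` inside `W`. A nonempty set that is `Closed` and
  -- `Linked` is a connected component of the hypergraph with hyperedges `Z`.
  Linked : Subset m → Subset n → Set
  Linked Z W = ∀ X → Nonempty X → X ⊂ W →
    ∃[ e ] (e ∈ Z × edge H e ⊆ W × Nonempty (edge H e ∩ X) × Nonempty (edge H e ∩ (W ─ X)))

  NoExchange : Multiset m → Subset m → Set
  NoExchange A Z = ∀ e f → e ∈ Z → f ∉ Z → 0 < A f → ¬ Forest (exchange A f e)

  closed? : ∀ Z W → Dec (Closed Z W)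
  closed? Z W = Fin.all? (λ e → (e ∈? Z) →-dec (nonempty? (edge H e ∩ W) →-dec (edge H e ⊆? W)))

  -- Take the smallest closed set around `v`. If no hyperedge of `Z` crossed between `X` and
  -- `W ─ X`, both would be closed, and the one containing `v` would be smaller.
  component : ∀ Z v → ∃[ W ] (v ∈ W × Closed Z W × Linked Z W)
  component Z v with minimal (λ W → (v ∈? W) ×-dec closed? Z W) ⊤ (∈⊤ , λ _ _ _ → ⊆⊤)
  ... | W , _ , (v∈W , closedW) , minW = W , v∈W , closedW , linked
    where
    linked : Linked Z W
    linked X (x , x∈X) (X⊆W , y , y∈W , y∉X)
      with Fin.any? (λ e → (e ∈? Z) ×-dec (edge H e ⊆? W)
             ×-dec nonempty? (edge H e ∩ X) ×-dec nonempty? (edge H e ∩ (W ─ X)))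
    ... | yes found = found
    ... | no  none with v ∈? X
    ... | yes v∈X = ⊥-elim (minW X (v∈X , closedX) (X⊆W , y , y∈W , y∉X))
      where
      closedX : Closed Z X
      closedX e e∈Z (u , u∈) {w} w∈e = decidable-stable (w ∈? X) λ w∉X →
        none (e , e∈Z , e⊆W , (u , u∈) , w , x∈p∩q⁺ (w∈e , x∈p∧x∉q⇒x∈p─q (e⊆W w∈e) w∉X))
        where
        e⊆W = closedW e e∈Z (u , ∩-⊇ (p∩q⊆p (edge H e) X) (X⊆W ∘ p∩q⊆q (edge H e) X) u∈)
    ... | no v∉X = ⊥-elim
      (minW (W ─ X) (x∈p∧x∉q⇒x∈p─q v∈W v∉X , closedW─X)
        (p─q⊆p W X , x , X⊆W x∈X , λ x∈ → x∈p─q⇒x∉q W X x∈ x∈X))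
      where
      closedW─X : Closed Z (W ─ X)
      closedW─X e e∈Z (u , u∈) {w} w∈e = x∈p∧x∉q⇒x∈p─q (e⊆W w∈e) λ w∈X →
        none (e , e∈Z , e⊆W , (w , x∈p∩q⁺ (w∈e , w∈X)) , u , u∈)
        where
        e⊆W = closedW e e∈Z
          (u , ∩-⊇ (p∩q⊆p (edge H e) (W ─ X)) (p─q⊆p W X ∘ p∩q⊆q (edge H e) (W ─ X)) u∈)

  exchange-base : ∀ {A f e} → Base A → 0 < A f → Forest (exchange A f e) → Base (exchange A f e)
  exchange-base {A} {f} {e} (_ , size≡) 0<Af forest =
    forest , trans (cong suc (size-exchange A e 0<Af)) size≡

  module _ (connected : Connected (whole H)) where

    -- A maximal tight set `X` around `v` is not everything, because `A` has too few members, so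
    -- some `e` leaves it. If adding `e` broke the forest condition at `W`, then `W` would be tight
    -- and meet `X`, and `X ∪ W` would contradict maximality.
    augment : ∀ {A} → Fin n → Forest A → suc (size A) < n → ∃[ e ] Forest (adjoin A e)
    augment {A} v forest small
      with maximal (λ X → (v ∈? X) ×-dec tight? A X) ⁅ v ⁆ (x∈⁅x⁆ v , tight-⁅⁆ A v)
    ... | X , _ , (v∈X , tightX) , maxX
      with connected X (v , v∈X) (⊆⊤ , proj₁ gap , ∈⊤ , proj₂ (proj₂ gap))
      where
      gap : ∃[ u ] (u ∈ ⊤ × u ∉ X)
      gap = ⊈⇒∃ λ ⊤⊆X → ℕ.<⇒≱ small (begin
        n                    ≡⟨ ∣⊤∣≡n n ⟨
        ∣ ⊤ {n} ∣            ≤⟨ p⊆q⇒∣p∣≤∣q∣ ⊤⊆X ⟩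
        ∣ X ∣                ≤⟨ tightX ⟩
        suc (inner A X)      ≤⟨ s≤s (inner-⊆ A {X} {⊤} ⊆⊤) ⟩
        suc (inner A ⊤)      ≡⟨ cong suc (inner-⊤ A) ⟩
        suc (size A)         ∎)
        where open ℕ.≤-Reasoning
    ... | e , _ , (x , x∈) , (y , y∈) = e , forest′
      where
      forest′ : Forest (adjoin A e)
      forest′ W ne with edge H e ⊆? W
      ... | no  e⊈W = ℕ.≤-<-trans (ℕ.≤-reflexive (inner-adjoin-out A e⊈W)) (forest W ne)
      ... | yes e⊆W = ℕ.≤-<-trans (ℕ.≤-reflexive (inner-adjoin-in A e⊆W)) (ℕ.≰⇒> λ tightW →
        maxX (X ∪ W)
          ( p⊆p∪q W v∈X
          , tight-∪ forest tightX tightW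
              (x , x∈p∩q⁺ (p∩q⊆q (edge H e) X x∈ , e⊆W (p∩q⊆p (edge H e) X x∈))))
          ( p⊆p∪q W , y , q⊆p∪q X W (e⊆W (p∩q⊆p (edge H e) (⊤ ─ X) y∈))
          , x∈p─q⇒x∉q ⊤ X (p∩q⊆q (edge H e) (⊤ ─ X) y∈)))

    base-exists : 1 ≤ n → ∃ Base
    base-exists 1≤n = extend (n ∸ 1) (λ _ → 0) empty
      (trans (cong (λ s → suc (s + (n ∸ 1))) (sum-zero {m} (λ _ → refl))) (ℕ.m+[n∸m]≡n 1≤n))
      where
      empty : Forest (λ _ → 0)
      empty X ne = ℕ.≤-trans (ℕ.≤-reflexive (cong suc (sum-zero {m} zeros))) (nonempty⇒1≤∣p∣ ne)
        where
        zeros : ∀ e → within H (λ _ → 0) X e ≡ 0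
        zeros e with edge H e ⊆? X
        ... | yes _ = refl
        ... | no  _ = refl
      extend : ∀ d A → Forest A → suc (size A + d) ≡ n → ∃ Base
      extend zero    A forest eq = A , forest , trans (cong suc (sym (ℕ.+-identityʳ _))) eq
      extend (suc d) A forest eq with augment (fromℕ< 1≤n) forest
        (subst (suc (suc (size A)) ≤_) eq
          (s≤s (ℕ.≤-trans (s≤s (ℕ.m≤m+n (size A) d)) (ℕ.≤-reflexive (sym (ℕ.+-suc (size A) d))))))
      ... | e , forest′ = extend d (adjoin A e) forest′
        (trans (cong suc (trans (cong (_+ d) (size-adjoin A e)) (sym (ℕ.+-suc (size A) d)))) eq)

  -- Each exchange adds a member in `Z` and deletes one outside, so the number outside decreases and
  -- the process stops. The two comparisons of multiplicities record this direction: the first keeps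
  -- parts tight, the second keeps weights from growing.
  concentrate : ∀ {A} Z → Base A →
    ∃[ T ] (Base T × NoExchange T Z × (∀ g → g ∈ Z → A g ≤ T g) × (∀ g → g ∉ Z → T g ≤ A g))
  concentrate Z base = descend (outer _) _ base ℕ.≤-refl
    where
    outer : Multiset m → ℕ
    outer A = size (λ g → if does (g ∈? Z) then 0 else A g)

    descend : ∀ fuel A → Base A → outer A ≤ fuel →
      ∃[ T ] (Base T × NoExchange T Z × (∀ g → g ∈ Z → A g ≤ T g) × (∀ g → g ∉ Z → T g ≤ A g))
    descend fuel A base bound
      with Fin.any? (λ e → Fin.any? (λ f → (e ∈? Z) ×-dec ¬? (f ∈? Z)
             ×-dec (0 ℕ.<? A f) ×-dec forest? (exchange A f e)))
    ... | no none = A , base , (λ e f e∈Z f∉Z 0<Af forest → none (e , f , e∈Z , f∉Z , 0<Af , forest))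
                      , (λ _ _ → ℕ.≤-refl) , (λ _ _ → ℕ.≤-refl)
    ... | yes (e , f , e∈Z , f∉Z , 0<Af , forest) = step fuel (ℕ.≤-trans smaller bound)
      where
      B = exchange A f e

      B≥A : ∀ g → g ∈ Z → A g ≤ B g
      B≥A g g∈Z = ℕ.≤-trans
        (ℕ.≤-reflexive (sym (remove-other A λ g≡f → f∉Z (subst (_∈ Z) g≡f g∈Z))))
        (adjoin-≥ (remove A f) e g)

      B≡remove : ∀ {g} → g ∉ Z → B g ≡ remove A f g
      B≡remove g∉Z = adjoin-other (remove A f) λ g≡e → g∉Z (subst (_∈ Z) (sym g≡e) e∈Z)

      B≤A : ∀ g → g ∉ Z → B g ≤ A g
      B≤A g g∉Z = ℕ.≤-trans (ℕ.≤-reflexive (B≡remove g∉Z)) (remove-≤ A f g)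

      smaller : outer B < outer A
      smaller = sum-mono-< pointwise f atf
        where
        pointwise : ∀ g → (if does (g ∈? Z) then 0 else B g) ≤ (if does (g ∈? Z) then 0 else A g)
        pointwise g with g ∈? Z
        ... | yes _   = z≤n
        ... | no  g∉Z = B≤A g g∉Z
        atf : (if does (f ∈? Z) then 0 else B f) < (if does (f ∈? Z) then 0 else A f)
        atf rewrite dec-false (f ∈? Z) f∉Z = ℕ.≤-trans
          (ℕ.≤-reflexive (trans (cong suc (B≡remove f∉Z))
            (trans (cong (λ b → suc (A f ∸ (if b then 1 else 0))) (dec-true (f Fin.≟ f) refl))
              (ℕ.m+[n∸m]≡n 0<Af)))) ℕ.≤-refl

      step : ∀ fuel → suc (outer B) ≤ fuel →
        ∃[ T ] (Base T × NoExchange T Z × (∀ g → g ∈ Z → A g ≤ T g) × (∀ g → g ∉ Z → T g ≤ A g))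
      step (suc fuel) (s≤s bound′) with descend fuel B (exchange-base base 0<Af forest) bound′
      ... | T , baseT , stuck , T≥B , T≤B = T , baseT , stuck
        , (λ g g∈Z → ℕ.≤-trans (B≥A g g∈Z) (T≥B g g∈Z))
        , (λ g g∉Z → ℕ.≤-trans (T≤B g g∉Z) (B≤A g g∉Z))

  -- The members from `Z` already exhaust the forest bound on `W`, which leaves no room for another
  -- one.
  tight-members : ∀ {A Z W} → Forest A → Nonempty W → Tight (restrict Z A) W →
    ∀ {g} → 0 < A g → edge H g ⊆ W → g ∈ Z
  tight-members {A} {Z} {W} forest ne tightW {g} 0<Ag g⊆W = decidable-stable (g ∈? Z) λ g∉Z → ℕ.<⇒≱
    (sum-mono-< {f = within H (restrict Z A) W} {g = within H A W} pointwise g (strict g∉Z))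
    (ℕ.≤-pred (ℕ.≤-trans (forest W ne) tightW))
    where
    pointwise : ∀ e → within H (restrict Z A) W e ≤ within H A W e
    pointwise e with edge H e ⊆? W
    ... | yes _ = restrict-≤ Z A e
    ... | no  _ = z≤n
    strict : g ∉ Z → within H (restrict Z A) W g < within H A W g
    strict g∉Z = subst₂ _<_
      (sym (trans (within-in (restrict Z A) g⊆W) (restrict-out Z A g∉Z)))
      (sym (within-in A g⊆W)) 0<Ag

  -- Grow a set X that the Z-part of A spans tightly.  A hyperedge e of Z leaving X lies in a
  -- smallest tight set Y; all hyperedges of A in Y belong to Z, or one of them could be
  -- exchanged for e.  So X ∪ Y is spanned by the Z-part as well.
  tight-component : ∀ {A Z W} → Base A → NoExchange A Z → Nonempty W → Closed Z W → Linked Z W →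
    Tight (restrict Z A) W
  tight-component {A} {Z} {W} base@(forest , _) stuck (v , v∈W) closedW linkedW
    with maximal (λ X → (v ∈? X) ×-dec tight? (restrict Z A) X) ⁅ v ⁆
           (x∈⁅x⁆ v , tight-⁅⁆ (restrict Z A) v)
  ... | X , _ , (v∈X , tightX) , maxX = conclude
    where
    B = restrict Z A

    forestB : Forest B
    forestB = forest-mono (restrict-≤ Z A) forest

    W⊆X : W ⊆ X
    W⊆X = decidable-stable (W ⊆? X) λ W⊈X →
      let (u , u∈W , u∉X) = ⊈⇒∃ W⊈X
          (e , e∈Z , e⊆W , (x , x∈) , (y , y∈)) = linkedW (X ∩ W) (v , x∈p∩q⁺ (v∈X , v∈W))
            (p∩q⊆q X W , u , u∈W , λ u∈ → u∉X (p∩q⊆p X W u∈))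
          (Y , _ , (tightY , e⊆Y) , minY) =
            minimal (λ Y → tight? A Y ×-dec (edge H e ⊆? Y)) ⊤ (tight-⊤ base , ⊆⊤)
          y∈e = p∩q⊆p (edge H e) (W ─ (X ∩ W)) y∈
          y∈W─ = p∩q⊆q (edge H e) (W ─ (X ∩ W)) y∈
          inZ : ∀ f → edge H f ⊆ Y → A f ≤ B f
          inZ f f⊆Y = case f ∈? Z of λ where
            (yes f∈Z) → ℕ.≤-reflexive (sym (restrict-in Z A f∈Z))
            (no  f∉Z) → ℕ.≮⇒≥ λ Bf<Af → stuck e f e∈Z f∉Z
              (ℕ.≤-<-trans z≤n Bf<Af)
              (exchange-forest forest tightY e⊆Y minY (ℕ.≤-<-trans z≤n Bf<Af) f⊆Y)
      in maxX (X ∪ Y)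
        ( p⊆p∪q Y v∈X
        , tight-∪ forestB tightX (ℕ.≤-trans tightY (s≤s (inner-mono {A} {B} {Y} inZ)))
            (x , x∈p∩q⁺ ( p∩q⊆p X W (p∩q⊆q (edge H e) (X ∩ W) x∈)
                        , e⊆Y (p∩q⊆p (edge H e) (X ∩ W) x∈))))
        ( p⊆p∪q Y , y , q⊆p∪q X Y (e⊆Y y∈e)
        , λ y∈X → x∈p─q⇒x∉q W (X ∩ W) y∈W─ (x∈p∩q⁺ (y∈X , e⊆W y∈e)))

    -- The maximal set `X` might reach beyond `W`. Since `W` is closed, no member from `Z` joins `W`
    -- to `X ─ W`, so the count in `X` splits.
    split : inner B X ≤ inner B W + inner B (X ─ W)
    split = ℕ.≤-trans (sum-mono pointwise)
      (ℕ.≤-reflexive (∑-distrib-+ (within H B W) (within H B (X ─ W))))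
      where
      pointwise : ∀ e → within H B X e ≤ within H B W e + within H B (X ─ W) e
      pointwise e = split-at (e ∈? Z) (nonempty? (edge H e ∩ W))
        where
        split-at : Dec (e ∈ Z) → Dec (Nonempty (edge H e ∩ W)) →
          within H B X e ≤ within H B W e + within H B (X ─ W) e
        split-at (no e∉Z) _ = ℕ.≤-trans (ℕ.≤-reflexive vanish) z≤n
          where
          vanish : within H B X e ≡ 0
          vanish = case edge H e ⊆? X of λ where
            (yes e⊆X) → trans (within-in B e⊆X) (restrict-out Z A e∉Z)
            (no  e⊈X) → within-out B e⊈X
        split-at (yes e∈Z) (yes meet) =
          ℕ.≤-trans (within-mono B e (λ _ → closedW e e∈Z meet)) (ℕ.m≤m+n _ _)
        split-at (yes e∈Z) (no miss) = ℕ.≤-trans (within-mono B e λ e⊆X {u} u∈e →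
          x∈p∧x∉q⇒x∈p─q (e⊆X u∈e) λ u∈W → miss (u , x∈p∩q⁺ (u∈e , u∈W))) (ℕ.m≤n+m _ _)

    conclude : Tight B W
    conclude with nonempty? (X ─ W)
    ... | no empty = ℕ.≤-trans (p⊆q⇒∣p∣≤∣q∣ W⊆X) (ℕ.≤-trans tightX (s≤s (inner-⊆ B λ {u} u∈X →
            decidable-stable (u ∈? W) λ u∉W → empty (u , x∈p∧x∉q⇒x∈p─q u∈X u∉W))))
    -- Two blocks without a joining member fall short of spanning `X` by one; the bound thus comes
    -- out one better than required, which is the slack `1`.
    ... | yes ne = linear-≤ 1
      (ℕ.+-mono-≤ split (ℕ.+-mono-≤ tightX (ℕ.+-mono-≤ (forestB (X ─ W) ne) (∣p∣+∣q─p∣≤∣q∣ W⊆X))))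
      (ring (∣ W ∣) (∣ X ─ W ∣) (∣ X ∣) (inner B X) (inner B W) (inner B (X ─ W)))
      where
      ring : ∀ w d x bx bw bd →
        w + (bw + bd + (suc bx + (d + x))) + 1 ≡ suc bw + (bx + (x + (suc bd + (w + d))))
      ring = solve-∀

-- Counting hyperedges across a partition

module _ (P : Partition n k) where

  index : Fin n → Fin k
  index v = proj₁ (covers P v)

  ∈-index : ∀ v → v ∈ part P (index v)
  ∈-index v = proj₁ (proj₂ (covers P v))

  index-unique : ∀ {v i} → v ∈ part P i → index v ≡ i
  index-unique {v} = proj₂ (proj₂ (covers P v))

  index-∈ : ∀ {v i} → index v ≡ i → v ∈ part P i
  index-∈ {v} refl = ∈-index v

module Cuts {n m k} (H : Hypergraph n m) (P : Partition n k) where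
  open Inner H
  open Trees H

  private
    crosses? : ∀ e → Dec (∃[ i ] ∃[ j ] (i ≢ j
      × Nonempty (edge H e ∩ part P i) × Nonempty (edge H e ∩ part P j)))
    crosses? e = Fin.any? λ i → Fin.any? λ j → ¬? (i Fin.≟ j)
      ×-dec nonempty? (edge H e ∩ part P i) ×-dec nonempty? (edge H e ∩ part P j)

  δ⁺ : ∀ {e u w} → u ∈ edge H e → w ∈ edge H e → index P u ≢ index P w → e ∈ δ H P
  δ⁺ {e} {u} {w} u∈ w∈ differ = ∈-fromDec⁺ crosses?
    ( index P u , index P w , differ
    , (u , x∈p∩q⁺ (u∈ , ∈-index P u)) , (w , x∈p∩q⁺ (w∈ , ∈-index P w)))

  δ⁻ : ∀ {e} → e ∈ δ H P → ∃[ u ] ∃[ w ] (u ∈ edge H e × w ∈ edge H e × index P u ≢ index P w)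
  δ⁻ {e} e∈δ with ∈-fromDec⁻ crosses? e∈δ
  ... | i , j , i≢j , (u , u∈) , (w , w∈) =
    u , w , p∩q⊆p (edge H e) _ u∈ , p∩q⊆p (edge H e) _ w∈ , λ eq → i≢j
      (trans (sym (index-unique P (p∩q⊆q (edge H e) _ u∈)))
        (trans eq (index-unique P (p∩q⊆q (edge H e) _ w∈))))

  ∉δ⇒constant : ∀ {e u w} → e ∉ δ H P → u ∈ edge H e → w ∈ edge H e → index P u ≡ index P w
  ∉δ⇒constant {u = u} {w} e∉δ u∈ w∈ =
    decidable-stable (index P u Fin.≟ index P w) (e∉δ ∘ δ⁺ u∈ w∈)

  ∉δ⇒⊆part : ∀ {e u} → e ∉ δ H P → u ∈ edge H e → edge H e ⊆ part P (index P u)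
  ∉δ⇒⊆part e∉δ u∈ w∈ = index-∈ P (∉δ⇒constant e∉δ w∈ u∈)

  ⊆part⇒∉δ : ∀ {e i} → edge H e ⊆ part P i → e ∉ δ H P
  ⊆part⇒∉δ e⊆ e∈δ = let (u , w , u∈ , w∈ , differ) = δ⁻ e∈δ in
    differ (trans (index-unique P (e⊆ u∈)) (sym (index-unique P (e⊆ w∈))))

  δ-leaves : ∀ {e} i → e ∈ δ H P → ∃[ u ] (u ∈ edge H e × u ∉ part P i)
  δ-leaves i e∈δ = ⊈⇒∃ λ e⊆ → ⊆part⇒∉δ e⊆ e∈δ

  PartsTight : Multiset m → Set
  PartsTight A = ∀ i → Tight A (part P i)

  -- Sum the forest bounds for the union of the parts outside J and for the single parts in J.
  cut-lower : ∀ {A} → Base A → (J : Subset k) (C : Subset m) →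
    (∃[ v ] index P v ∉ J) →
    (∀ e → e ∉ C → (∀ v → v ∈ edge H e → index P v ∉ J)
                 ⊎ (∃[ j ] (j ∈ J × edge H e ⊆ part P j))) →
    ∣ J ∣ ≤ size (restrict C A)
  cut-lower {A} (forest , size≡) J C (v₀ , v₀∉J) cover =
    linear-≤ 0
      (ℕ.+-mono-≤ edges≤ (ℕ.+-mono-≤ parts≤ (ℕ.+-mono-≤ (forest U (v₀ , ∈-fromDec⁺ outside? v₀∉J)) vertices≤)))
      (ring (size (restrict C A)) (size A) (inner A U) (∣ U ∣)
        (sum λ j → sum λ e → chosen j e) (sum λ j → sum λ v → inside-part j v) (∣ J ∣))
    where
    outside? : ∀ v → Dec (index P v ∉ J)
    outside? v = ¬? (index P v ∈? J)

    U : Subset n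
    U = fromDec outside?

    chosen : Fin k → Fin m → ℕ
    chosen j e = if does (j ∈? J) then within H A (part P j) e else 0

    inside-part : Fin k → Fin n → ℕ
    inside-part j v = if does (j ∈? J) then ⟦ v ∈? part P j ⟧ else 0

    edges≤ : size A ≤ size (restrict C A) + (inner A U + sum λ j → sum λ e → chosen j e)
    edges≤ = ℕ.≤-trans (sum-mono pointwise) (ℕ.≤-reflexive
      (trans (∑-distrib-+ (restrict C A) _) (cong (size (restrict C A) +_)
        (trans (∑-distrib-+ (within H A U) _) (cong (inner A U +_) (∑-comm (λ e j → chosen j e)))))))
      where
      pointwise : ∀ e → A e ≤ restrict C A e + (within H A U e + sum λ j → chosen j e)
      pointwise e with e ∈? C
      ... | yes _   = ℕ.m≤m+n (A e) _
      ... | no  e∉C with cover e e∉C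
      ...   | inj₁ e⊆U = ℕ.≤-trans
        (ℕ.≤-reflexive (sym (within-in A (λ v∈ → ∈-fromDec⁺ outside? (e⊆U _ v∈))))) (ℕ.m≤m+n _ _)
      ...   | inj₂ (j , j∈J , e⊆) = ℕ.≤-trans (ℕ.≤-trans
        (ℕ.≤-reflexive (sym (trans
          (cong (λ b → if b then within H A (part P j) e else 0) (dec-true (j ∈? J) j∈J)) (within-in A e⊆))))
        (term≤sum (λ j → chosen j e) j)) (ℕ.m≤n+m _ _)

    parts≤ : (sum λ j → sum λ e → chosen j e) + ∣ J ∣ ≤ sum λ j → sum λ v → inside-part j v
    parts≤ = ℕ.≤-trans (ℕ.≤-reflexive
        (trans (cong ((sum λ j → sum (chosen j)) +_) (∣p∣≡∑ J)) (sym (∑-distrib-+ (λ j → sum (chosen j)) _))))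
      (sum-mono pointwise)
      where
      pointwise : ∀ j → sum (chosen j) + ⟦ j ∈? J ⟧ ≤ sum (inside-part j)
      pointwise j with j ∈? J
      ... | yes _ = begin
        inner A (part P j) + 1            ≡⟨ ℕ.+-comm _ 1 ⟩
        suc (inner A (part P j))          ≤⟨ forest (part P j) (nonempty P j) ⟩
        ∣ part P j ∣                      ≡⟨ ∣p∣≡∑ (part P j) ⟩
        sum (λ v → ⟦ v ∈? part P j ⟧)     ∎
        where open ℕ.≤-Reasoning
      ... | no _ = ℕ.≤-trans (ℕ.≤-reflexive (trans (ℕ.+-identityʳ _) (sum-zero {m} λ _ → refl))) z≤n

    vertices≤ : ∣ U ∣ + (sum λ j → sum λ v → inside-part j v) ≤ suc (size A)
    vertices≤ = begin
      ∣ U ∣ + (sum λ j → sum λ v → inside-part j v)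
        ≡⟨ cong₂ _+_ (∣p∣≡∑ U) (∑-comm inside-part) ⟩
      sum (λ v → ⟦ v ∈? U ⟧) + (sum λ v → sum λ j → inside-part j v)
        ≡⟨ ∑-distrib-+ (λ v → ⟦ v ∈? U ⟧) _ ⟨
      (sum λ v → ⟦ v ∈? U ⟧ + sum λ j → inside-part j v)
        ≤⟨ sum-mono pointwise ⟩
      sum {n} (λ _ → 1)
        ≡⟨ trans (sum-ones n) (sym size≡) ⟩
      suc (size A) ∎
      where
      open ℕ.≤-Reasoning
      ⟦⟧≤1 : ∀ {Q : Set} (d : Dec Q) → ⟦ d ⟧ ≤ 1
      ⟦⟧≤1 (yes _) = ℕ.≤-refl
      ⟦⟧≤1 (no  _) = z≤n
      elsewhere : ∀ v j → ¬ (v ∈ part P j × j ∈ J) → inside-part j v ≡ 0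
      elsewhere v j none with j ∈? J | v ∈? part P j
      ... | yes j∈J | yes v∈ = contradiction (v∈ , j∈J) none
      ... | yes _   | no  _  = refl
      ... | no  _   | _      = refl
      pointwise : ∀ v → ⟦ v ∈? U ⟧ + (sum λ j → inside-part j v) ≤ 1
      pointwise v with index P v ∈? J
      ... | no i∉J = ℕ.≤-trans (ℕ.≤-reflexive (trans (cong (⟦ v ∈? U ⟧ +_)
        (sum-zero {f = λ j → inside-part j v} λ j → elsewhere v j λ (v∈ , j∈J) → i∉J (subst (_∈ J) (sym (index-unique P v∈)) j∈J)))
        (ℕ.+-identityʳ _))) (⟦⟧≤1 (v ∈? U))
      ... | yes i∈J = ℕ.≤-trans (ℕ.≤-reflexive (cong₂ _+_
        (cong (λ b → if b then 1 else 0) (dec-false (v ∈? U) λ v∈U → ∈-fromDec⁻ outside? v∈U i∈J))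
        (trans (sum-single (index P v) λ j j≢ → elsewhere v j λ (v∈ , _) → j≢ (sym (index-unique P v∈)))
          (cong (λ b → if b then ⟦ v ∈? part P (index P v) ⟧ else 0) (dec-true (index P v ∈? J) i∈J)))))
        (⟦⟧≤1 (v ∈? part P (index P v)))

    ring : ∀ c a i u s t j →
      j + (c + (i + s) + (t + (u + suc a))) + 0 ≡ c + (a + (s + j + (suc i + (u + t))))
    ring = solve-∀

  -- Counting with `J` all parts but one, so that the union of the parts outside `J` is the single
  -- part `i`.
  δ-lower : ∀ {A} → Base A → 2 ≤ k → k ∸ 1 ≤ size (restrict (δ H P) A)
  δ-lower {A} base 2≤k = subst (_≤ size (restrict (δ H P) A))
    (trans (∣∁p∣≡n∸∣p∣ ⁅ i ⁆) (cong (k ∸_) (∣⁅x⁆∣≡1 i)))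
    (cut-lower base (∁ ⁅ i ⁆) (δ H P)
      (proj₁ (nonempty P i) , x∈p⇒x∉∁p (subst (_∈ ⁅ i ⁆) (sym (index-unique P (proj₂ (nonempty P i)))) (x∈⁅x⁆ i)))
      cover)
    where
    i : Fin k
    i = fromℕ< (ℕ.<-trans ℕ.0<1+n 2≤k)

    cover : ∀ e → e ∉ δ H P → (∀ v → v ∈ edge H e → index P v ∉ ∁ ⁅ i ⁆)
                            ⊎ (∃[ j ] (j ∈ ∁ ⁅ i ⁆ × edge H e ⊆ part P j))
    cover e e∉δ with index P (proj₁ (edge-nonempty e)) ∈? ∁ ⁅ i ⁆
    ... | yes j∈ = inj₂ (_ , j∈ , ∉δ⇒⊆part e∉δ (proj₂ (edge-nonempty e)))
    ... | no  j∉ = inj₁ λ v v∈ i∈ →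
      j∉ (subst (_∈ ∁ ⁅ i ⁆) (∉δ⇒constant e∉δ v∈ (proj₂ (edge-nonempty e))) i∈)

  -- Tight parts together hold at least `n - k` of the `n - 1` members, which leaves at most `k - 1`
  -- for the cut.
  δ-upper : ∀ {A} → Base A → PartsTight A → size (restrict (δ H P) A) < k
  δ-upper {A} (forest , size≡) tight = linear-≤ 0
    (ℕ.+-mono-≤ edges≤ (ℕ.+-mono-≤ parts≤ (ℕ.≤-trans (ℕ.≤-reflexive size≡) vertices≤)))
    (ring (size (restrict (δ H P) A)) (size A) k (sum λ j → inner A (part P j)) (sum λ j → ∣ part P j ∣))
    where
    edges≤ : size (restrict (δ H P) A) + (sum λ j → inner A (part P j)) ≤ size A
    edges≤ = ℕ.≤-trans (ℕ.≤-reflexive (trans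
      (cong (size (restrict (δ H P) A) +_) (∑-comm (λ j e → within H A (part P j) e)))
      (sym (∑-distrib-+ (restrict (δ H P) A) _)))) (sum-mono pointwise)
      where
      pointwise : ∀ e → restrict (δ H P) A e + (sum λ j → within H A (part P j) e) ≤ A e
      pointwise e = case e ∈? δ H P of λ where
        (yes e∈δ) → ℕ.≤-reflexive (trans (cong₂ _+_ (restrict-in (δ H P) A e∈δ)
          (sum-zero {f = λ j → within H A (part P j) e} λ j → within-out A λ e⊆ → ⊆part⇒∉δ e⊆ e∈δ)) (ℕ.+-identityʳ _))
        (no e∉δ) → let (u , u∈) = edge-nonempty e in
          ℕ.≤-reflexive (cong₂ _+_ (restrict-out (δ H P) A e∉δ)
            (trans (sum-single (index P u) λ j j≢ → within-out A λ e⊆ → j≢ (sym (index-unique P (e⊆ u∈))))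
              (within-in A (∉δ⇒⊆part e∉δ u∈))))
    parts≤ : (sum λ j → ∣ part P j ∣) ≤ k + sum λ j → inner A (part P j)
    parts≤ = ℕ.≤-trans (sum-mono tight) (ℕ.≤-reflexive
      (trans (∑-distrib-+ (λ _ → 1) (λ j → inner A (part P j))) (cong (λ s → s + sum λ j → inner A (part P j)) (sum-ones k))))
    vertices≤ : n ≤ sum λ j → ∣ part P j ∣
    vertices≤ = begin
      n                                          ≡⟨ sum-ones n ⟨
      sum {n} (λ _ → 1)                          ≤⟨ sum-mono pointwise ⟩
      (sum λ v → sum λ j → ⟦ v ∈? part P j ⟧)    ≡⟨ ∑-comm (λ v j → ⟦ v ∈? part P j ⟧) ⟩
      (sum λ j → sum λ v → ⟦ v ∈? part P j ⟧)    ≡⟨ sum-cong-≗ (λ j → ∣p∣≡∑ (part P j)) ⟨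
      (sum λ j → ∣ part P j ∣)                   ∎
      where
      open ℕ.≤-Reasoning
      pointwise : ∀ v → 1 ≤ sum λ j → ⟦ v ∈? part P j ⟧
      pointwise v = ℕ.≤-trans
        (ℕ.≤-reflexive (sym (cong (λ b → if b then 1 else 0) (dec-true (v ∈? part P (index P v)) (∈-index P v)))))
        (term≤sum (λ j → ⟦ v ∈? part P j ⟧) (index P v))
    ring : ∀ d a k i p → suc d + (a + (k + i + p)) + 0 ≡ k + (d + i + (p + suc a))
    ring = solve-∀

  feasible⇒linked : Feasible H P → ∀ i → Linked (∁ (δ H P)) (part P i)
  feasible⇒linked feasible i X ne X⊂ with feasible i X ne X⊂
  ... | e , e∈ , meets , leaves = e , x∉p⇒x∈∁p (⊆part⇒∉δ e⊆) , e⊆ , meets , leaves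
    where
    e⊆ : edge H e ⊆ part P i
    e⊆ = proj₂ (∈-fromDec⁻ (λ e → (e ∈? ⊤) ×-dec (edge H e ⊆? part P i)) e∈)

  part-closed : ∀ i → Closed (∁ (δ H P)) (part P i)
  part-closed i e e∈ (u , u∈) = subst (λ j → edge H e ⊆ part P j)
    (index-unique P (p∩q⊆q (edge H e) (part P i) u∈))
    (∉δ⇒⊆part (x∈∁p⇒x∉p e∈) (p∩q⊆p (edge H e) (part P i) u∈))

-- Biconnectedness and exchanges

module Biconnectivity {n m k} (H : Hypergraph n m) (P : Partition n k) where
  open Inner H
  open Trees H
  open Cuts H P

  -- Deletions of single vertices of the shrunk hypergraph, seen in H.
  PartDeletionsConnected : Set
  PartDeletionsConnected = ∀ i X → Nonempty X → X ⊂ ∁ (part P i) →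
    ∃[ e ] (Nonempty (edge H e ∩ X) × Nonempty (edge H e ∩ (∁ (part P i) ─ X)))

  module _ (feasible : Feasible H P) where

    -- All hyperedges inside parts belong to `Z`, and the multiplicities on `Z` only grow, so no
    -- part loses a member.
    concentrate-parts : ∀ {A} Z → ∁ (δ H P) ⊆ Z → Base A →
      ∃[ T ] (Base T × NoExchange T Z × (PartsTight A → PartsTight T))
    concentrate-parts {A} Z ∁δ⊆Z base with concentrate Z base
    ... | T , baseT , stuck , T≥A , _ = T , baseT , stuck , λ tight i →
      ℕ.≤-trans (tight i) (s≤s (inner-mono {A} {T} λ e e⊆ → T≥A e (∁δ⊆Z (x∉p⇒x∈∁p (⊆part⇒∉δ e⊆)))))

    -- By feasibility the parts are the components of the hyperedges outside the cut, so a base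
    -- moved into these spans every part.
    parts-tight-base : ∀ {A} → Base A → ∃[ T ] (Base T × PartsTight T)
    parts-tight-base base with concentrate-parts (∁ (δ H P)) id base
    ... | T , baseT , stuck , _ = T , baseT , λ i → ℕ.≤-trans
      (tight-component baseT stuck (nonempty P i) (part-closed i) (feasible⇒linked feasible i))
      (s≤s (inner-mono {restrict (∁ (δ H P)) T} {T} λ e _ → restrict-≤ (∁ (δ H P)) T e))

    module _ (connected : Connected (whole H)) (S : Subset m) where

      -- Let `U` be the union of the parts met by cut hyperedges in `S`. Either `f` itself meets
      -- such a part, or connectedness gives a hyperedge `h` leaving `U`. It is in the cut because
      -- `U` is a union of parts, and not in `S` because otherwise all its vertices would be in `U`.
      shared-part : ∀ {e f} → e ∈ δ H P → e ∈ S → f ∈ δ H P → f ∉ S →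
        ∃[ i ] ∃[ e′ ] ∃[ f′ ] (e′ ∈ δ H P × e′ ∈ S × Nonempty (edge H e′ ∩ part P i)
                        × f′ ∉ S × f′ ∈ δ H P × Nonempty (edge H f′ ∩ part P i))
      shared-part {e} {f} e∈δ e∈S f∈δ f∉S = search (proj₁ (edge-nonempty f) ∈? U)
        where
        met? : ∀ v → Dec (∃[ g ] (g ∈ δ H P × g ∈ S × Nonempty (edge H g ∩ part P (index P v))))
        met? v = Fin.any? λ g → (g ∈? δ H P) ×-dec (g ∈? S) ×-dec nonempty? (edge H g ∩ part P (index P v))
        U = fromDec met?
        meets-own : ∀ {g v} → v ∈ edge H g → Nonempty (edge H g ∩ part P (index P v))
        meets-own {v = v} v∈ = v , x∈p∩q⁺ (v∈ , ∈-index P v)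
        search : Dec (proj₁ (edge-nonempty f) ∈ U) → _
        search (yes u∈U) = let (g , g∈δ , g∈S , meets) = ∈-fromDec⁻ met? u∈U in
          _ , g , f , g∈δ , g∈S , meets , f∉S , f∈δ , meets-own (proj₂ (edge-nonempty f))
        search (no u∉U) = crossing (connected U
          (_ , ∈-fromDec⁺ met? (e , e∈δ , e∈S , meets-own (proj₂ (edge-nonempty e)))) (⊆⊤ , _ , ∈⊤ , u∉U))
          where
          crossing : _ → _
          crossing (h , _ , (x , x∈) , (y , y∈)) with ∈-fromDec⁻ met? (p∩q⊆q (edge H h) U x∈)
          ... | g , g∈δ , g∈S , meets = index P x , g , h , g∈δ , g∈S , meets , h∉S , h∈δ , meets-own x∈h
            where
            x∈h = p∩q⊆p (edge H h) U x∈
            y∈h = p∩q⊆p (edge H h) (⊤ ─ U) y∈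
            y∉U = x∈p─q⇒x∉q ⊤ U (p∩q⊆q (edge H h) (⊤ ─ U) y∈)
            h∈δ : h ∈ δ H P
            h∈δ = decidable-stable (h ∈? δ H P) λ h∉δ → y∉U (∈-fromDec⁺ met?
              (g , g∈δ , g∈S , subst (λ i → Nonempty (edge H g ∩ part P i)) (∉δ⇒constant h∉δ x∈h y∈h) meets))
            h∉S : h ∉ S
            h∉S h∈S = y∉U (∈-fromDec⁺ met? (h , h∈δ , h∈S , meets-own y∈h))

    module Around (i : Fin k) where

      private
        base? : ∀ e → Dec (e ∉ δ H P ⊎ ¬ Nonempty (edge H e ∩ part P i))
        base? e = ¬? (e ∈? δ H P) ⊎-dec ¬? (nonempty? (edge H e ∩ part P i))

      -- The complement is the star of `i` in the shrunk hypergraph: the cut hyperedges that meet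
      -- the part `i`.
      F : Subset m
      F = fromDec base?

      ∁δ⊆F : ∁ (δ H P) ⊆ F
      ∁δ⊆F e∈ = ∈-fromDec⁺ base? (inj₁ (x∈∁p⇒x∉p e∈))

      F⁻ : ∀ {e} → e ∈ F → Nonempty (edge H e ∩ part P i) → edge H e ⊆ part P i
      F⁻ {e} e∈F (u , u∈) with ∈-fromDec⁻ base? e∈F
      ... | inj₁ e∉δ = part-closed i e (x∉p⇒x∈∁p e∉δ) (u , u∈)
      ... | inj₂ none = ⊥-elim (none (u , u∈))

      ∉F⇒∈δ : ∀ {e} → e ∉ F → e ∈ δ H P
      ∉F⇒∈δ {e} e∉F = decidable-stable (e ∈? δ H P) λ e∉δ → e∉F (∈-fromDec⁺ base? (inj₁ e∉δ))

      ∉F⇒meets : ∀ {e} → e ∉ F → Nonempty (edge H e ∩ part P i)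
      ∉F⇒meets {e} e∉F = decidable-stable (nonempty? (edge H e ∩ part P i))
        λ none → e∉F (∈-fromDec⁺ base? (inj₂ none))

      -- One of the two classes at `i`. Applied to `S` and to `∁ S`, it gives the component `D` of
      -- the part `i` when only this class is added to the hyperedges off the star.
      module Side {A} (base : Base A) (stuckF : NoExchange A F) (S : Subset m)
        (separated : ∀ e f → e ∈ δ H P → f ∈ δ H P → e ∈ S → f ∉ S → 0 < A f → ¬ Forest (exchange A f e))
        where

        Z : Subset m
        Z = F ∪ S

        -- Two reasons combine: bringing in a hyperedge of `F` is excluded by the choice of the
        -- base, bringing in one of `S` by the separation of the classes.
        stuckZ : NoExchange A Z
        stuckZ e f e∈Z f∉Z 0<Af forest with e ∈? F
        ... | yes e∈F = stuckF e f e∈F (λ f∈F → f∉Z (p⊆p∪q S f∈F)) 0<Af forest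
        ... | no  e∉F = separated e f (∉F⇒∈δ e∉F) (∉F⇒∈δ (λ f∈F → f∉Z (p⊆p∪q S f∈F)))
          (case x∈p∪q⁻ F S e∈Z of λ where
            (inj₁ e∈F) → contradiction e∈F e∉F
            (inj₂ e∈S) → e∈S)
          (λ f∈S → f∉Z (q⊆p∪q F S f∈S)) 0<Af forest

        private
          found = component Z (proj₁ (nonempty P i))

        D : Subset n
        D = proj₁ found

        closedD : Closed Z D
        closedD = proj₁ (proj₂ (proj₂ found))

        tightD : Tight (restrict Z A) D
        tightD = tight-component base stuckZ (_ , proj₁ (proj₂ found)) closedD (proj₂ (proj₂ (proj₂ found)))

        part⊆D : part P i ⊆ D
        part⊆D {u} u∈ = decidable-stable (u ∈? D) λ u∉D →
          let v∈ = proj₂ (nonempty P i)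
              (e , e∈ , _ , (x , x∈) , (y , y∈)) =
                feasible⇒linked feasible i (part P i ∩ D) (_ , x∈p∩q⁺ (v∈ , proj₁ (proj₂ found)))
                  (p∩q⊆p (part P i) D , u , u∈ , λ u∈′ → u∉D (p∩q⊆q (part P i) D u∈′))
              x∈D = p∩q⊆q (part P i) D (p∩q⊆q (edge H e) (part P i ∩ D) x∈)
              y∈e = p∩q⊆p (edge H e) (part P i ─ (part P i ∩ D)) y∈
              y∈─ = p∩q⊆q (edge H e) (part P i ─ (part P i ∩ D)) y∈
          in x∈p─q⇒x∉q (part P i) (part P i ∩ D) y∈─ (x∈p∩q⁺
               ( p─q⊆p (part P i) (part P i ∩ D) y∈─
               , closedD e (p⊆p∪q S (∁δ⊆F e∈)) (x , x∈p∩q⁺ (p∩q⊆p (edge H e) (part P i ∩ D) x∈ , x∈D)) y∈e))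

        tightAD : Tight A D
        tightAD = ℕ.≤-trans tightD (s≤s (inner-mono {restrict Z A} {A} λ e _ → restrict-≤ Z A e))

        members-in-D : ∀ {g} → 0 < A g → edge H g ⊆ D → g ∈ Z
        members-in-D = tight-members (proj₁ base) (_ , proj₁ (proj₂ found)) tightD

        ∈S⇒⊆D : ∀ {e} → e ∈ S → Nonempty (edge H e ∩ part P i) → edge H e ⊆ D
        ∈S⇒⊆D {e} e∈S (u , u∈) = closedD e (q⊆p∪q F S e∈S)
          (u , ∩-⊇ (p∩q⊆p (edge H e) (part P i)) (part⊆D ∘ p∩q⊆q (edge H e) (part P i)) u∈)

      -- No member in `X` joins the part `i` to the rest `R`. If `R` is nonempty, the forest bounds
      -- for both blocks leave at most `∣ X ∣ - 2` members in `X`, one too few.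
      tight⊆part : ∀ {A X} → Base A → Tight A X → part P i ⊆ X →
        (∀ {g} → 0 < A g → edge H g ⊆ X → g ∈ F) → X ⊆ part P i
      tight⊆part {A} {X} (forest , _) tightX part⊆X members {x} x∈X =
        decidable-stable (x ∈? part P i) λ x∉ → ℕ.<⇒≱ (bound (x , x∈p∧x∉q⇒x∈p─q x∈X x∉)) tightX
        where
        R = X ─ part P i
        pointwise : ∀ e → within H A X e ≤ within H A (part P i) e + within H A R e
        pointwise e = cases (edge H e ⊆? X) (0 ℕ.<? A e) (nonempty? (edge H e ∩ part P i))
          where
          cases : Dec (edge H e ⊆ X) → Dec (0 < A e) → Dec (Nonempty (edge H e ∩ part P i)) →
            within H A X e ≤ within H A (part P i) e + within H A R e
          cases (no e⊈X) _ _ = ℕ.≤-trans (ℕ.≤-reflexive (within-out A e⊈X)) z≤n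
          cases (yes e⊆X) (no A≯0) _ =
            ℕ.≤-trans (ℕ.≤-reflexive (within-in A e⊆X)) (ℕ.≤-trans (ℕ.≮⇒≥ A≯0) z≤n)
          cases (yes e⊆X) (yes 0<Ae) (yes meets) =
            ℕ.≤-trans (within-mono A e λ _ → F⁻ (members 0<Ae e⊆X) meets) (ℕ.m≤m+n _ _)
          cases (yes e⊆X) (yes _) (no misses) =
            ℕ.≤-trans (within-mono A e λ _ {u} u∈ → x∈p∧x∉q⇒x∈p─q (e⊆X u∈)
              λ u∈P → misses (u , x∈p∩q⁺ (u∈ , u∈P))) (ℕ.m≤n+m _ _)
        split : inner A X ≤ inner A (part P i) + inner A R
        split = ℕ.≤-trans (sum-mono pointwise)
          (ℕ.≤-reflexive (∑-distrib-+ (within H A (part P i)) (within H A R)))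
        bound : Nonempty R → suc (inner A X) < ∣ X ∣
        bound ne = linear-≤ 0
          (ℕ.+-mono-≤ split (ℕ.+-mono-≤ (forest (part P i) (nonempty P i))
            (ℕ.+-mono-≤ (forest R ne) (∣p∣+∣q─p∣≤∣q∣ part⊆X))))
          (ring (inner A X) (inner A (part P i)) (inner A R) (∣ part P i ∣) (∣ R ∣) (∣ X ∣))
          where
          ring : ∀ a b c p r x → suc (suc a) + (b + c + (p + (r + x))) + 0 ≡ x + (a + (suc b + (suc c + (p + r))))
          ring = solve-∀

    module _ (deletions : PartDeletionsConnected) (S : Subset m)
      (classes : ∀ {A} e f → Base A → PartsTight A → e ∈ δ H P → f ∈ δ H P → 0 < A f →
        Forest (exchange A f e) → (e ∈ S → f ∈ S) × (f ∈ S → e ∈ S)) where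

      -- The components of e₁ and f₁ at the part i would overlap in i alone, making i a cut vertex.
      no-shared-part : ∀ {A} i e₁ f₁ → Base A → PartsTight A → NoExchange A (Around.F i) →
        e₁ ∈ δ H P → e₁ ∈ S → Nonempty (edge H e₁ ∩ part P i) →
        f₁ ∈ δ H P → f₁ ∉ S → ¬ Nonempty (edge H f₁ ∩ part P i)
      no-shared-part {A} i e₁ f₁ base tightA stuck e₁∈δ e₁∈S e₁-meets f₁∈δ f₁∉S f₁-meets =
        x∈p─q⇒x∉q D₁ (part P i) x∈X (D₁∩D₂⊆part (x∈p∩q⁺ (x∈D₁ , x∈D₂)))
        where
        open Around i
        separated₁ : ∀ a b → a ∈ δ H P → b ∈ δ H P → a ∈ S → b ∉ S → 0 < A b → ¬ Forest (exchange A b a)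
        separated₁ a b a∈δ b∈δ a∈S b∉S 0<Ab forest =
          b∉S (proj₁ (classes a b base tightA a∈δ b∈δ 0<Ab forest) a∈S)
        separated₂ : ∀ a b → a ∈ δ H P → b ∈ δ H P → a ∈ ∁ S → b ∉ ∁ S → 0 < A b → ¬ Forest (exchange A b a)
        separated₂ a b a∈δ b∈δ a∈∁S b∉∁S 0<Ab forest =
          x∈∁p⇒x∉p a∈∁S (proj₂ (classes a b base tightA a∈δ b∈δ 0<Ab forest) (x∉∁p⇒x∈p b∉∁S))
        module S₁ = Side base stuck S separated₁
        module S₂ = Side base stuck (∁ S) separated₂
        D₁ = S₁.D
        D₂ = S₂.D
        -- Members inside the intersection lie in `F ∪ S` and in `F ∪ ∁ S`, hence in `F`.
        D₁∩D₂⊆part : D₁ ∩ D₂ ⊆ part P i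
        D₁∩D₂⊆part = tight⊆part base
          (tight-∩ (proj₁ base) S₁.tightAD S₂.tightAD
            (_ , x∈p∩q⁺ (S₁.part⊆D (proj₂ (nonempty P i)) , S₂.part⊆D (proj₂ (nonempty P i)))))
          (∩-⊇ S₁.part⊆D S₂.part⊆D) λ {g} 0<Ag g⊆ →
            case x∈p∪q⁻ F S (S₁.members-in-D 0<Ag (λ v∈ → p∩q⊆p D₁ D₂ (g⊆ v∈))) of λ where
              (inj₁ g∈F) → g∈F
              (inj₂ g∈S) → case x∈p∪q⁻ F (∁ S) (S₂.members-in-D 0<Ag (λ v∈ → p∩q⊆q D₁ D₂ (g⊆ v∈))) of λ where
                (inj₁ g∈F)  → g∈F
                (inj₂ g∈∁S) → contradiction g∈S (x∈∁p⇒x∉p g∈∁S)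
        X = D₁ ─ part P i
        e₁-leaves = δ-leaves i e₁∈δ
        f₁-leaves = δ-leaves i f₁∈δ
        -- Biconnectedness gives `g` leaving `X` away from the part `i`. As `D₁` is closed, `g` is
        -- not in `Z` of the first side, so it lies in the star and in the other class, hence inside
        -- `D₂`. Its vertex in `X` is then in both sets but not in the part.
        cut : ∃[ g ] (Nonempty (edge H g ∩ X) × Nonempty (edge H g ∩ (∁ (part P i) ─ X)))
        cut = deletions i X
          (_ , x∈p∧x∉q⇒x∈p─q (S₁.∈S⇒⊆D e₁∈S e₁-meets (proj₁ (proj₂ e₁-leaves))) (proj₂ (proj₂ e₁-leaves)))
          ( (λ u∈ → x∉p⇒x∈∁p (x∈p─q⇒x∉q D₁ (part P i) u∈))
          , proj₁ f₁-leaves , x∉p⇒x∈∁p (proj₂ (proj₂ f₁-leaves))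
          , λ u∈X → proj₂ (proj₂ f₁-leaves) (D₁∩D₂⊆part (x∈p∩q⁺
              ( p─q⊆p D₁ (part P i) u∈X
              , S₂.∈S⇒⊆D (x∉p⇒x∈∁p f₁∉S) f₁-meets (proj₁ (proj₂ f₁-leaves))))))
        g = proj₁ cut
        x∈g = p∩q⊆p (edge H g) X (proj₂ (proj₁ (proj₂ cut)))
        x∈X = p∩q⊆q (edge H g) X (proj₂ (proj₁ (proj₂ cut)))
        x∈D₁ = p─q⊆p D₁ (part P i) x∈X
        y∈g = p∩q⊆p (edge H g) (∁ (part P i) ─ X) (proj₂ (proj₂ (proj₂ cut)))
        y∈─ = p∩q⊆q (edge H g) (∁ (part P i) ─ X) (proj₂ (proj₂ (proj₂ cut)))
        g∉Z₁ : g ∉ S₁.Z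
        g∉Z₁ g∈Z₁ = x∈p─q⇒x∉q (∁ (part P i)) X y∈─ (x∈p∧x∉q⇒x∈p─q
          (S₁.closedD g g∈Z₁ (_ , x∈p∩q⁺ (x∈g , x∈D₁)) y∈g)
          (x∈∁p⇒x∉p (p─q⊆p (∁ (part P i)) X y∈─)))
        x∈D₂ = S₂.∈S⇒⊆D (x∉p⇒x∈∁p (λ g∈S → g∉Z₁ (q⊆p∪q F S g∈S)))
          (∉F⇒meets (λ g∈F → g∉Z₁ (p⊆p∪q S g∈F))) x∈g

      exchange-classes : Connected (whole H) → 1 ≤ n →
        ∀ e f → e ∈ δ H P → f ∈ δ H P → e ∈ S → f ∈ S
      exchange-classes connected 1≤n e f e∈δ f∈δ e∈S = decidable-stable (f ∈? S) λ f∉S →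
        let (i , e₁ , f₁ , e₁∈δ , e₁∈S , e₁-meets , f₁∉S , f₁∈δ , f₁-meets) =
              shared-part connected S e∈δ e∈S f∈δ f∉S
            (_ , base₀ , tight₀) = parts-tight-base (proj₂ (base-exists connected 1≤n))
            (_ , base , stuck , keeps) = concentrate-parts (Around.F i) (Around.∁δ⊆F i) base₀
        in no-shared-part i e₁ f₁ base (keeps tight₀) stuck e₁∈δ e₁∈S e₁-meets f₁∈δ f₁∉S f₁-meets

-- The shrunk hypergraph

least-singleton : (p : Subset n) → Nonempty p → ∃[ v ] (v ∈ p × least p ≡ ⁅ v ⁆)
least-singleton (inside  ∷ p) _ = zero , here , refl
least-singleton (outside ∷ p) (suc v , there v∈p) with least-singleton p (v , v∈p)
... | w , w∈p , eq = suc w , there w∈p , cong (outside ∷_) eq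

module Merging (p : Subset n) (ne : Nonempty p) where

  private
    found = least-singleton p ne
    ℓ = proj₁ found

  collapse : Fin n → Fin n
  collapse w = if does (w ∈? p) then ℓ else w

  collapse-in : ∀ {w} → w ∈ p → collapse w ≡ ℓ
  collapse-in {w} w∈p = cong (λ b → if b then ℓ else w) (dec-true (w ∈? p) w∈p)

  collapse-out : ∀ {w} → w ∉ p → collapse w ≡ w
  collapse-out {w} w∉p = cong (λ b → if b then ℓ else w) (dec-false (w ∈? p) w∉p)

  merge⁻ : ∀ X {x} → x ∈ merge p X → ∃[ w ] (w ∈ X × collapse w ≡ x)
  merge⁻ X {x} x∈ with nonempty? (X ∩ p)
  ... | no  none = x , x∈ , collapse-out (λ x∈p → none (x , x∈p∩q⁺ (x∈ , x∈p)))
  ... | yes (w , w∈) with x∈p∪q⁻ (X ─ p) (least p) x∈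
  ...   | inj₁ x∈X─p = x , p─q⊆p X p x∈X─p , collapse-out (x∈p─q⇒x∉q X p x∈X─p)
  ...   | inj₂ x∈ℓ = w , p∩q⊆p X p w∈ , trans (collapse-in (p∩q⊆q X p w∈))
          (sym (x∈⁅y⁆⇒x≡y ℓ (subst (x ∈_) (proj₂ (proj₂ found)) x∈ℓ)))

  merge⁺ : ∀ X {w} → w ∈ X → collapse w ∈ merge p X
  merge⁺ X {w} w∈X = place (nonempty? (X ∩ p)) (w ∈? p)
    where
    place : (d : Dec (Nonempty (X ∩ p))) (e : Dec (w ∈ p)) →
      (if does e then ℓ else w) ∈ (if does d then (X ─ p) ∪ least p else X)
    place (yes _) (yes _)  = q⊆p∪q (X ─ p) (least p)
      (subst (ℓ ∈_) (sym (proj₂ (proj₂ found))) (x∈⁅x⁆ ℓ))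
    place (yes _) (no w∉p) = p⊆p∪q (least p) (x∈p∧x∉q⇒x∈p─q w∈X w∉p)
    place (no none) (yes w∈p) = ⊥-elim (none (w , x∈p∩q⁺ (w∈X , w∈p)))
    place (no _) (no _) = w∈X

module Contraction {n m} (H : Hypergraph n m) where
  open Inner H using (edge-nonempty)

  -- The invariant of iterated contraction: `G` is the image of `H` under `π`, which sends a vertex
  -- to its present name. Later arguments use it in place of `merge`.
  record Quotient (G : Minor n m) (π : Fin n → Fin n) : Set where
    field
      vertices⁺ : ∀ u → π u ∈ vertices G
      vertices⁻ : ∀ {x} → x ∈ vertices G → ∃[ u ] (π u ≡ x)
      ends⁺     : ∀ e {u} → u ∈ edge H e → π u ∈ ends G e
      ends⁻     : ∀ e {x} → x ∈ ends G e → ∃[ u ] (u ∈ edge H e × π u ≡ x)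
      edges⁺    : ∀ e → Multi (ends G e) → e ∈ edges G

  open Quotient

  whole-quotient : Quotient (whole H) id
  whole-quotient = record
    { vertices⁺ = λ _ → ∈⊤
    ; vertices⁻ = λ {x} _ → x , refl
    ; ends⁺ = λ _ u∈ → u∈
    ; ends⁻ = λ _ {x} x∈ → x , x∈ , refl
    ; edges⁺ = λ _ _ → ∈⊤
    }

  -- The last two components say that the new map identifies exactly what `π` identified, together
  -- with the vertices of `f`.
  contract : ∀ {G π} f → Quotient G π → ∃[ κ ] (Quotient (G / f) (κ ∘ π)
    × (∀ {u w} → u ∈ edge H f → w ∈ edge H f → κ (π u) ≡ κ (π w))
    × (∀ {u w} → κ (π u) ≡ κ (π w) → π u ≡ π w
         ⊎ (∃[ a ] ∃[ b ] (a ∈ edge H f × b ∈ edge H f × π u ≡ π a × π w ≡ π b))))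
  contract {G} {π} f Q = collapse , quotient , collapsed , refines
    where
    p = ends G f
    open Merging p (_ , ends⁺ Q f (proj₂ (edge-nonempty f)))

    collapsed : ∀ {u w} → u ∈ edge H f → w ∈ edge H f → collapse (π u) ≡ collapse (π w)
    collapsed u∈ w∈ = trans (collapse-in (ends⁺ Q f u∈)) (sym (collapse-in (ends⁺ Q f w∈)))

    quotient : Quotient (G / f) (collapse ∘ π)
    quotient = record
      { vertices⁺ = λ u → merge⁺ (vertices G) (vertices⁺ Q u)
      ; vertices⁻ = λ x∈ → let (w , w∈ , eq) = merge⁻ (vertices G) x∈
                               (u , eq′) = vertices⁻ Q w∈
                           in u , trans (cong collapse eq′) eq
      ; ends⁺ = λ e u∈ → merge⁺ (ends G e) (ends⁺ Q e u∈)
      ; ends⁻ = λ e x∈ → let (w , w∈ , eq) = merge⁻ (ends G e) x∈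
                             (u , u∈ , eq′) = ends⁻ Q e w∈
                         in u , u∈ , trans (cong collapse eq′) eq
      ; edges⁺ = λ e multi → ∈-fromDec⁺ (λ e → (e ∈? edges G) ×-dec (2 ℕ.≤? ∣ merge p (ends G e) ∣))
          (edges⁺ Q e (lift e multi) , Multi⇒2≤∣p∣ _ multi)
      }
      where
      lift : ∀ e → Multi (merge p (ends G e)) → Multi (ends G e)
      lift e (x , y , x∈ , y∈ , x≢y) =
        let (v , v∈ , eq) = merge⁻ (ends G e) x∈
            (w , w∈ , eq′) = merge⁻ (ends G e) y∈
        in v , w , v∈ , w∈ , λ v≡w → x≢y (trans (sym eq) (trans (cong collapse v≡w) eq′))

    refines : ∀ {u w} → collapse (π u) ≡ collapse (π w) → π u ≡ π w
         ⊎ (∃[ a ] ∃[ b ] (a ∈ edge H f × b ∈ edge H f × π u ≡ π a × π w ≡ π b))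
    refines {u} {w} eq = cases (π u ∈? p) (π w ∈? p)
      where
      Goal = π u ≡ π w ⊎ (∃[ a ] ∃[ b ] (a ∈ edge H f × b ∈ edge H f × π u ≡ π a × π w ≡ π b))
      stays : ∀ {x y} → x ∈ p → y ∉ p → collapse x ≢ collapse y
      stays x∈p y∉p eq = y∉p (subst (_∈ p)
        (trans (sym (collapse-in x∈p)) (trans eq (collapse-out y∉p)))
        (proj₁ (proj₂ (least-singleton p (_ , ends⁺ Q f (proj₂ (edge-nonempty f)))))))
      cases : Dec (π u ∈ p) → Dec (π w ∈ p) → Goal
      cases (yes u∈) (yes w∈) = let (a , a∈ , eqa) = ends⁻ Q f u∈
                                    (b , b∈ , eqb) = ends⁻ Q f w∈
                                in inj₂ (a , b , a∈ , b∈ , sym eqa , sym eqb)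
      cases (yes u∈) (no w∉)  = contradiction eq (stays u∈ w∉)
      cases (no u∉)  (yes w∈) = contradiction (sym eq) (stays w∈ u∉)
      cases (no u∉)  (no w∉)  = inj₁ (trans (sym (collapse-out u∉)) (trans eq (collapse-out w∉)))

  -- Bounds the fibres of the final map on both sides: vertices with one image have one colour, and
  -- every contracted hyperedge has a single image. The colouring is by parts in the application.
  contract-all : ∀ {k} (colour : Fin n → Fin k) {G π} fs → Quotient G π →
    (∀ {u w} → π u ≡ π w → colour u ≡ colour w) →
    (∀ f → f List.∈ fs → ∀ {u w} → u ∈ edge H f → w ∈ edge H f → colour u ≡ colour w) →
    ∃[ κ ] (Quotient (foldl _/_ G fs) (κ ∘ π)
      × (∀ {u w} → κ (π u) ≡ κ (π w) → colour u ≡ colour w)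
      × (∀ f → f List.∈ fs → ∀ {u w} → u ∈ edge H f → w ∈ edge H f → κ (π u) ≡ κ (π w)))
  contract-all colour [] Q compatible _ = id , Q , compatible , λ _ ()
  contract-all colour {π = π} (f ∷ fs) Q compatible constant with contract f Q
  ... | κ , Q′ , collapsed , refines
    with contract-all colour fs Q′ compatible′ (λ g g∈ → constant g (Any.there g∈))
    where
    compatible′ : ∀ {u w} → κ (π u) ≡ κ (π w) → colour u ≡ colour w
    compatible′ eq = case refines eq of λ where
      (inj₁ eq′) → compatible eq′
      (inj₂ (a , b , a∈ , b∈ , eqa , eqb)) →
        trans (compatible eqa) (trans (constant f (Any.here refl) a∈ b∈) (sym (compatible eqb)))
  ... | κ′ , Q″ , compatible″ , collapsed″ = κ′ ∘ κ , Q″ , compatible″ , λ where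
    _ (Any.here refl) u∈ w∈ → cong κ′ (collapsed u∈ w∈)
    g (Any.there g∈)  u∈ w∈ → collapsed″ g g∈ u∈ w∈

module Collapsing {n m k} (H : Hypergraph n m) (P : Partition n k) (feasible : Feasible H P)
  {G : Minor n m} {π : Fin n → Fin n} (Q : Contraction.Quotient H G π)
  (π⇒index : ∀ {u w} → π u ≡ π w → index P u ≡ index P w)
  (collapsed : ∀ {f u w} → f ∉ δ H P → u ∈ edge H f → w ∈ edge H f → π u ≡ π w) where
  open Inner H
  open Cuts H P
  open Biconnectivity H P
  open Contraction.Quotient Q

  private
    -- If only some vertices of the part had the image of `u`, feasibility would give a hyperedge of
    -- the part leaving this set; but it was contracted to a single image.
    index⇒π : ∀ {u w} → index P u ≡ index P w → π u ≡ π w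
    index⇒π {u} {w} eq = decidable-stable (π u Fin.≟ π w) λ πu≢πw →
      let (e , e∈ , _ , (x , x∈) , (y , y∈)) = feasible⇒linked feasible (index P u) X
            (u , ∈-fromDec⁺ same? (∈-index P u , refl))
            ( (λ v∈ → proj₁ (∈-fromDec⁻ same? v∈))
            , w , index-∈ P (sym eq) , λ w∈ → πu≢πw (sym (proj₂ (∈-fromDec⁻ same? w∈))))
          y∈─ = p∩q⊆q (edge H e) (part P (index P u) ─ X) y∈
      in x∈p─q⇒x∉q (part P (index P u)) X y∈─ (∈-fromDec⁺ same?
           ( p─q⊆p (part P (index P u)) X y∈─
           , trans (collapsed (x∈∁p⇒x∉p e∈) (p∩q⊆p (edge H e) (part P (index P u) ─ X) y∈)
                     (p∩q⊆p (edge H e) X x∈))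
               (proj₂ (∈-fromDec⁻ same? (p∩q⊆q (edge H e) X x∈)))))
      where
      same? : ∀ v → Dec (v ∈ part P (index P u) × π v ≡ π u)
      same? v = (v ∈? part P (index P u)) ×-dec (π v Fin.≟ π u)
      X = fromDec same?

  -- The set `X` need not be a union of parts. If it divides a part, feasibility already supplies a
  -- crossing hyperedge; otherwise `X` is determined by its image in `G`, and deleting the image of
  -- the part `i` supplies one.
  biconnected⇒deletions : VertexBiconnected G → PartDeletionsConnected
  biconnected⇒deletions (_ , deletions) i X (x , x∈X) (X⊆ , y , y∈ , y∉X) =
    case Fin.any? (λ a → Fin.any? λ b → (index P a Fin.≟ index P b) ×-dec (a ∈? X) ×-dec ¬? (b ∈? X)) of λ where
      (yes (a , b , same , a∈X , b∉X)) → inside-part a b same a∈X b∉X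
      (no none) → between λ {a} {b} same a∈X → decidable-stable (b ∈? X) λ b∉X → none (a , b , same , a∈X , b∉X)
    where
    Goal = ∃[ e ] (Nonempty (edge H e ∩ X) × Nonempty (edge H e ∩ (∁ (part P i) ─ X)))

    inside-part : ∀ a b → index P a ≡ index P b → a ∈ X → b ∉ X → Goal
    inside-part a b same a∈X b∉X
      with feasible⇒linked feasible (index P a) (part P (index P a) ∩ X)
             (a , x∈p∩q⁺ (∈-index P a , a∈X))
             ( p∩q⊆p (part P (index P a)) X , b , index-∈ P (sym same)
             , λ b∈ → b∉X (p∩q⊆q (part P (index P a)) X b∈))
    ... | e , _ , _ , (u , u∈) , (w , w∈) = e
      , (u , ∩-⊇ (p∩q⊆p (edge H e) (R ∩ X)) (p∩q⊆q R X ∘ p∩q⊆q (edge H e) (R ∩ X)) u∈)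
      , (w , x∈p∩q⁺ (p∩q⊆p (edge H e) (R ─ R ∩ X) w∈ , x∈p∧x∉q⇒x∈p─q
          (x∉p⇒x∈∁p λ w∈i → x∈∁p⇒x∉p (X⊆ a∈X)
            (index-∈ P (trans (sym (index-unique P w∈R)) (index-unique P w∈i))))
          (λ w∈X → x∈p─q⇒x∉q R (R ∩ X) w∈─ (x∈p∩q⁺ (w∈R , w∈X)))))
      where
      R = part P (index P a)
      w∈─ = p∩q⊆q (edge H e) (R ─ R ∩ X) w∈
      w∈R = p─q⊆p R (R ∩ X) w∈─

    between : (∀ {a b} → index P a ≡ index P b → a ∈ X → b ∈ X) → Goal
    between saturated = let (e , _ , meets , leaves) = crossing in e , pull-in e meets , pull-out e leaves
      where
      v = π (proj₁ (nonempty P i))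
      image? : ∀ z → Dec (∃[ a ] (a ∈ X × π a ≡ z))
      image? z = Fin.any? λ a → (a ∈? X) ×-dec (π a Fin.≟ z)
      X̄ = fromDec image?
      X̄⁺ : ∀ {a} → a ∈ X → π a ∈ X̄
      X̄⁺ {a} a∈X = ∈-fromDec⁺ image? (a , a∈X , refl)
      X̄⁻ : ∀ {b} → π b ∈ X̄ → b ∈ X
      X̄⁻ πb∈ = let (a , a∈X , eq) = ∈-fromDec⁻ image? πb∈ in saturated (π⇒index eq) a∈X
      v-index : ∀ {a} → a ∈ part P i → π a ≡ v
      v-index a∈i = index⇒π (trans (index-unique P a∈i) (sym (index-unique P (proj₂ (nonempty P i)))))
      avoid : ∀ {a} → a ∉ part P i → π a ∈ vertices G - v
      avoid {a} a∉i = x∈p∧x≢y⇒x∈p-y (vertices⁺ a) λ πa≡v →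
        a∉i (index-∈ P (trans (π⇒index πa≡v) (index-unique P (proj₂ (nonempty P i)))))
      crossing : ∃[ e ] (e ∈ edges (G ∖ v) × Nonempty ((ends G e - v) ∩ X̄)
                        × Nonempty ((ends G e - v) ∩ (vertices G - v ─ X̄)))
      crossing = deletions v (vertices⁺ (proj₁ (nonempty P i))) X̄ (π x , X̄⁺ x∈X)
        ( (λ z∈ → let (a , a∈X , eq) = ∈-fromDec⁻ image? z∈ in
            subst (_∈ vertices G - v) eq (avoid (x∈∁p⇒x∉p (X⊆ a∈X))))
        , π y , avoid (x∈∁p⇒x∉p y∈) , λ πy∈ → y∉X (X̄⁻ πy∈))
      pull-in : ∀ e → Nonempty ((ends G e - v) ∩ X̄) → Nonempty (edge H e ∩ X)
      pull-in e (z , z∈) =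
        let (b , b∈ , eq) = ends⁻ e (p─q⊆p (ends G e) ⁅ v ⁆ (p∩q⊆p (ends G e - v) X̄ z∈))
        in b , x∈p∩q⁺ (b∈ , X̄⁻ (subst (_∈ X̄) (sym eq) (p∩q⊆q (ends G e - v) X̄ z∈)))
      pull-out : ∀ e → Nonempty ((ends G e - v) ∩ (vertices G - v ─ X̄)) →
        Nonempty (edge H e ∩ (∁ (part P i) ─ X))
      pull-out e (t , t∈) =
        let (c , c∈ , eq) = ends⁻ e (p─q⊆p (ends G e) ⁅ v ⁆ (p∩q⊆p (ends G e - v) (vertices G - v ─ X̄) t∈))
            t∈─ = p∩q⊆q (ends G e - v) (vertices G - v ─ X̄) t∈
        in c , x∈p∩q⁺ (c∈ , x∈p∧x∉q⇒x∈p─q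
             (x∉p⇒x∈∁p λ c∈i → x∈p─q⇒x∉q (vertices G) ⁅ v ⁆ (p─q⊆p (vertices G - v) X̄ t∈─)
               (subst (_∈ ⁅ v ⁆) (trans (sym (v-index c∈i)) eq) (x∈⁅x⁆ v)))
             (λ c∈X → x∈p─q⇒x∉q (vertices G - v) X̄ t∈─ (subst (_∈ X̄) eq (X̄⁺ c∈X))))

  -- Sets of `G` are pulled back along `π`. The deleted vertex pulls back to a whole part, by
  -- `index⇒π`.
  deletions⇒biconnected : Connected (whole H) → PartDeletionsConnected → VertexBiconnected G
  deletions⇒biconnected connected deletions = connectedG , deletedG
    where
    module _ (X : Subset n) where
      preimage? : ∀ u → Dec (π u ∈ X)
      preimage? u = π u ∈? X
      X̃ = fromDec preimage?

    connectedG : Connected G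
    connectedG X (x , x∈X) (X⊆ , y , y∈ , y∉X)
      with vertices⁻ (X⊆ x∈X) | vertices⁻ y∈
    ... | a , eqa | b , eqb
      with connected (X̃ X) (a , ∈-fromDec⁺ (preimage? X) (subst (_∈ X) (sym eqa) x∈X))
             (⊆⊤ , b , ∈⊤ , λ b∈ → y∉X (subst (_∈ X) eqb (∈-fromDec⁻ (preimage? X) b∈)))
    ... | e , _ , (c , c∈) , (d , d∈) = e , edges⁺ e (π c , π d , πc∈ , πd∈ , λ eq → πd∉X (subst (_∈ X) eq πc∈X))
      , (π c , x∈p∩q⁺ (πc∈ , πc∈X)) , (π d , x∈p∩q⁺ (πd∈ , x∈p∧x∉q⇒x∈p─q (vertices⁺ d) πd∉X))
      where
      πc∈ = ends⁺ e (p∩q⊆p (edge H e) (X̃ X) c∈)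
      πd∈ = ends⁺ e (p∩q⊆p (edge H e) (⊤ ─ X̃ X) d∈)
      πc∈X = ∈-fromDec⁻ (preimage? X) (p∩q⊆q (edge H e) (X̃ X) c∈)
      πd∉X : π d ∉ X
      πd∉X πd∈X = x∈p─q⇒x∉q ⊤ (X̃ X) (p∩q⊆q (edge H e) (⊤ ─ X̃ X) d∈) (∈-fromDec⁺ (preimage? X) πd∈X)

    deletedG : ∀ v → v ∈ vertices G → Connected (G ∖ v)
    deletedG v v∈ X (x , x∈X) (X⊆ , y , y∈ , y∉X) =
      let (e , meets , leaves) = crossing in e , edge-kept e meets leaves , push-in e meets , push-out e leaves
      where
      s = proj₁ (vertices⁻ v∈)
      eqs : π s ≡ v
      eqs = proj₂ (vertices⁻ v∈)
      R = part P (index P s)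

      ≢v : ∀ {z} → z ∈ vertices G - v → z ∉ ⁅ v ⁆
      ≢v = x∈p─q⇒x∉q (vertices G) ⁅ v ⁆

      away : ∀ {u} → π u ∉ ⁅ v ⁆ → u ∈ ∁ R
      away πu≢v = x∉p⇒x∈∁p λ u∈ → πu≢v (subst (_∈ ⁅ v ⁆)
        (trans (sym eqs) (index⇒π (sym (index-unique P u∈)))) (x∈⁅x⁆ v))

      pulled : ∀ {z} → z ∈ vertices G - v → ∃[ u ] (π u ≡ z × u ∈ ∁ R)
      pulled z∈ = let (u , eq) = vertices⁻ (p─q⊆p (vertices G) ⁅ v ⁆ z∈) in
        u , eq , away (subst (_∉ ⁅ v ⁆) (sym eq) (≢v z∈))

      crossing : ∃[ e ] (Nonempty (edge H e ∩ X̃ X) × Nonempty (edge H e ∩ (∁ R ─ X̃ X)))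
      crossing =
        let (a , eqa , _) = pulled (X⊆ x∈X)
            (b , eqb , b∈) = pulled y∈
        in deletions (index P s) (X̃ X) (a , ∈-fromDec⁺ (preimage? X) (subst (_∈ X) (sym eqa) x∈X))
             ( (λ u∈ → away (≢v (X⊆ (∈-fromDec⁻ (preimage? X) u∈))))
             , b , b∈ , λ b∈X̃ → y∉X (subst (_∈ X) eqb (∈-fromDec⁻ (preimage? X) b∈X̃)))

      push-in : ∀ e → Nonempty (edge H e ∩ X̃ X) → Nonempty ((ends G e - v) ∩ X)
      push-in e (c , c∈) = π c , x∈p∩q⁺
        (x∈p∧x∉q⇒x∈p─q (ends⁺ e (p∩q⊆p (edge H e) (X̃ X) c∈)) (≢v (X⊆ πc∈X)) , πc∈X)
        where
        πc∈X : π c ∈ X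
        πc∈X = ∈-fromDec⁻ (preimage? X) (p∩q⊆q (edge H e) (X̃ X) c∈)

      push-out : ∀ e → Nonempty (edge H e ∩ (∁ R ─ X̃ X)) →
        Nonempty ((ends G e - v) ∩ (vertices G - v ─ X))
      push-out e (d , d∈) = π d , x∈p∩q⁺
        ( x∈p∧x∉q⇒x∈p─q (ends⁺ e (p∩q⊆p (edge H e) (∁ R ─ X̃ X) d∈)) πd≢v
        , x∈p∧x∉q⇒x∈p─q (x∈p∧x∉q⇒x∈p─q (vertices⁺ d) πd≢v) λ πd∈X →
            x∈p─q⇒x∉q (∁ R) (X̃ X) d∈─ (∈-fromDec⁺ (preimage? X) πd∈X))
        where
        d∈─ = p∩q⊆q (edge H e) (∁ R ─ X̃ X) d∈
        πd≢v : π d ∉ ⁅ v ⁆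
        πd≢v πd∈ = x∈∁p⇒x∉p (p─q⊆p (∁ R) (X̃ X) d∈─)
          (index-∈ P (π⇒index (trans (x∈⁅y⁆⇒x≡y v πd∈) (sym eqs))))

      edge-kept : ∀ e → Nonempty (edge H e ∩ X̃ X) → Nonempty (edge H e ∩ (∁ R ─ X̃ X)) →
        e ∈ edges (G ∖ v)
      edge-kept e meets leaves = ∈-fromDec⁺ (λ e → (e ∈? edges G) ×-dec (2 ℕ.≤? ∣ ends G e - v ∣))
        (edges⁺ e (_ , _ , p─q⊆p (ends G e) ⁅ v ⁆ c∈ , p─q⊆p (ends G e) ⁅ v ⁆ d∈ , differ)
        , Multi⇒2≤∣p∣ (ends G e - v) (_ , _ , c∈ , d∈ , differ))
        where
        pushed-in = push-in e meets
        pushed-out = push-out e leaves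
        c∈ = p∩q⊆p (ends G e - v) X (proj₂ pushed-in)
        d∈ = p∩q⊆p (ends G e - v) (vertices G - v ─ X) (proj₂ pushed-out)
        differ : proj₁ pushed-in ≢ proj₁ pushed-out
        differ eq = x∈p─q⇒x∉q (vertices G - v) X
          (p∩q⊆q (ends G e - v) (vertices G - v ─ X) (proj₂ pushed-out))
          (subst (_∈ X) eq (p∩q⊆q (ends G e - v) X (proj₂ pushed-in)))

module Shrinking {n m k} (H : Hypergraph n m) (P : Partition n k) (feasible : Feasible H P) where
  open Cuts H P
  open Biconnectivity H P
  open Contraction H

  private
    shrunk-quotient : ∃[ π ] (Quotient (shrunk H P) π
      × (∀ {u w} → π u ≡ π w → index P u ≡ index P w)
      × (∀ {f u w} → f ∉ δ H P → u ∈ edge H f → w ∈ edge H f → π u ≡ π w))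
    shrunk-quotient = let (π , Q , compatible , collapsed) = all in
      π , Q , compatible , λ {f} f∉δ →
        collapsed f (∈-filter⁺ (_∈? ∁ (δ H P)) (∈-allFin f) (x∉p⇒x∈∁p f∉δ))
      where
      all = contract-all (index P) (filter (_∈? ∁ (δ H P)) (allFin m)) whole-quotient (cong (index P))
        (λ f f∈ u∈ w∈ → ∉δ⇒constant
          (x∈∁p⇒x∉p (proj₂ (∈-filter⁻ (_∈? ∁ (δ H P)) {xs = allFin m} f∈))) u∈ w∈)

  biconnected⇒deletions : VertexBiconnected (shrunk H P) → PartDeletionsConnected
  biconnected⇒deletions = let (π , Q , compatible , collapsed) = shrunk-quotient in
    Collapsing.biconnected⇒deletions H P feasible Q compatible collapsed

  deletions⇒biconnected : Connected (whole H) → PartDeletionsConnected → VertexBiconnected (shrunk H P)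
  deletions⇒biconnected = let (π , Q , compatible , collapsed) = shrunk-quotient in
    Collapsing.deletions⇒biconnected H P feasible Q compatible collapsed

-- Multi-trees

∈⇒⊆⋃ : {X : Subset n} {Xs : List (Subset n)} → X List.∈ Xs → X ⊆ ⋃ Xs
∈⇒⊆⋃ {Xs = Y ∷ Xs} (Any.here refl) v∈ = p⊆p∪q (⋃ Xs) v∈
∈⇒⊆⋃ {Xs = Y ∷ Xs} (Any.there X∈)  v∈ = q⊆p∪q Y (⋃ Xs) (∈⇒⊆⋃ X∈ v∈)

module MultiTrees {n m} (H : Hypergraph n m) where
  open Inner H

  edge⊆span : ∀ A {e} → 0 < A e → edge H e ⊆ span H A
  edge⊆span A {e} 0<Ae = ∈⇒⊆⋃ (∈-map⁺ (edge H) (∈-filter⁺ (λ e → 1 ℕ.≤? A e) (∈-allFin e) 0<Ae))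

  private
    ≤∸1⇒< : ∀ {a b} → 1 ≤ b → a ≤ b ∸ 1 → a < b
    ≤∸1⇒< 1≤b a≤ = ℕ.≤-trans (s≤s a≤) (ℕ.≤-reflexive (ℕ.m+[n∸m]≡n 1≤b))

  multiTree⇒base : 1 ≤ n → ∀ {A} → IsMultiTree H A → Base A
  multiTree⇒base 1≤n {A} ((forest , size≡) , span≡⊤) =
    (λ X ne → ≤∸1⇒< (nonempty⇒1≤∣p∣ ne) (forest X ne (subst (X ⊆_) (sym span≡⊤) ⊆⊤)))
    , trans (cong suc (trans size≡ (cong (_∸ 1) (trans (cong ∣_∣ span≡⊤) (∣⊤∣≡n n))))) (ℕ.m+[n∸m]≡n 1≤n)

  -- All `n - 1` members lie inside the span, so the forest bound there gives it at least `n`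
  -- vertices. That bound requires a nonempty span, and this is where `2 ≤ n` enters: it forces the
  -- base to have a member.
  base⇒multiTree : 2 ≤ n → ∀ {A} → Base A → IsMultiTree H A
  base⇒multiTree 2≤n {A} (forest , size≡) =
    ( (λ X ne _ → ℕ.<⇒≤pred (forest X ne))
    , trans (cong (_∸ 1) size≡) (cong (_∸ 1) (sym (trans (cong ∣_∣ span≡⊤) (∣⊤∣≡n n)))))
    , span≡⊤
    where
    used : ∃[ e ] (0 < A e)
    used with Fin.any? (λ e → 0 ℕ.<? A e)
    ... | yes found = found
    ... | no  none  = contradiction (subst (2 ≤_) (trans (sym size≡) (cong suc
      (sum-zero λ e → ℕ.n≤0⇒n≡0 (ℕ.≮⇒≥ λ 0<Ae → none (e , 0<Ae))))) 2≤n) λ { (s≤s ()) }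
    pointwise : ∀ e → A e ≤ within H A (span H A) e
    pointwise e with 0 ℕ.<? A e
    ... | yes 0<Ae = ℕ.≤-reflexive (sym (within-in A (edge⊆span A 0<Ae)))
    ... | no  A≯0  = ℕ.≤-trans (ℕ.≮⇒≥ A≯0) z≤n
    span≡⊤ : span H A ≡ ⊤
    span≡⊤ = ∣p∣≡n⇒p≡⊤ (ℕ.≤-antisym (∣p∣≤n (span H A))
      (ℕ.≤-trans (ℕ.≤-reflexive (sym size≡)) (ℕ.≤-trans (s≤s (sum-mono pointwise))
        (forest (span H A) (_ , edge⊆span A (proj₂ used) (proj₂ (edge-nonempty (proj₁ used))))))))

-- Ordered fields and weights

module OrderedFieldProperties {c ℓ₁ ℓ₂ ℓ₃} (K : OrderedField c ℓ₁ ℓ₂ ℓ₃) where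
  open OrderedField K public
    using (Carrier; 0#; 1#; _≈_; _#_; _⋆_; recip; 0<1; 0<1+n; 1+n-invertible)
    renaming (_+_ to _⊕_; _*_ to _⊗_; -_ to ⊖_; _-_ to _⊝_; _<_ to _≺_; _≤_ to _≼_)
  open OrderedField K using
    ( commutativeRing; isStrictPartialOrder; #⇔<⊎>; +-monoˡ-<; *-pos; tight; #-cotrans; invertible⇒#)
  open CommutativeRing commutativeRing public
    using (setoid; +-cong; +-congˡ; +-congʳ; *-congˡ; *-congʳ; +-identityˡ; +-identityʳ; *-identityˡ
          ; *-identityʳ; +-assoc; +-comm; *-assoc; *-comm; distribˡ; distribʳ; zeroˡ; zeroʳ; -‿inverseˡ; -‿inverseʳ)
    renaming (refl to ≈-refl; sym to ≈-sym; trans to ≈-trans)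
  open CommutativeRing commutativeRing using (semiring; commutativeSemiring; +-group; +-commutativeMonoid)
  module ≺ = IsStrictPartialOrder isStrictPartialOrder
  open SemiringSum semiring public
    using () renaming (sum to ∑; sum-cong-≋ to ∑-cong; ∑-distrib-+ to ∑-distrib-⊕; *-distribˡ-sum to *-distribˡ-∑)
  open SemiringMult semiring public
    using (×-assoc-*; ×-comm-*; ×-congʳ; ×-homo-+)
  open SemiringSolver commutativeSemiring public using (solve; _:+_; _:=_)
  open GroupProperties +-group using (∙-cancelʳ)
  open Mult +-commutativeMonoid using (×-distrib-+)

  private variable
    a b s t w x y z : Carrier

  #⇒≺⊎≻ : x # y → x ≺ y ⊎ y ≺ x
  #⇒≺⊎≻ {x} {y} = Equivalence.to (#⇔<⊎> x y)

  ≺⇒# : x ≺ y → x # y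
  ≺⇒# {x} {y} x≺y = Equivalence.from (#⇔<⊎> x y) (inj₁ x≺y)

  #-from-≻ : y ≺ x → x # y
  #-from-≻ {y} {x} y≺x = Equivalence.from (#⇔<⊎> x y) (inj₂ y≺x)

  #-irreflexive : x ≈ y → ¬ (x # y)
  #-irreflexive {x} {y} = proj₂ (tight x y)

  ≡⇒≈ : x ≡ y → x ≈ y
  ≡⇒≈ refl = ≈-refl

  -- By tightness equality is the negation of apartness. Hence equalities in `K` may be proved with
  -- classical case distinctions.
  ≈-stable : ¬ ¬ (x ≈ y) → x ≈ y
  ≈-stable {x} {y} ¬¬x≈y = proj₁ (tight x y) λ x#y → ¬¬x≈y λ x≈y → proj₂ (tight x y) x≈y x#y

  ≺-cotrans : x ≺ y → ∀ z → x ≺ z ⊎ z ≺ y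
  ≺-cotrans x≺y z with #-cotrans (≺⇒# x≺y) z
  ... | inj₁ x#z = case #⇒≺⊎≻ x#z of λ where
    (inj₁ x≺z) → inj₁ x≺z
    (inj₂ z≺x) → inj₂ (≺.trans z≺x x≺y)
  ... | inj₂ z#y = case #⇒≺⊎≻ z#y of λ where
    (inj₁ z≺y) → inj₂ z≺y
    (inj₂ y≺z) → inj₁ (≺.trans x≺y y≺z)

  ≼-trans : x ≼ y → y ≼ z → x ≼ z
  ≼-trans {y = y} x≼y y≼z z≺x = case ≺-cotrans z≺x y of λ where
    (inj₁ z≺y) → y≼z z≺y
    (inj₂ y≺x) → x≼y y≺x

  ≈⇒≼ : x ≈ y → x ≼ y
  ≈⇒≼ x≈y = ≺.irrefl (≈-sym x≈y)

  ≺⇒≼ : x ≺ y → x ≼ y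
  ≺⇒≼ = ≺.asym

  ≼-antisym : x ≼ y → y ≼ x → x ≈ y
  ≼-antisym {x} {y} x≼y y≼x = proj₁ (tight x y) λ x#y → case #⇒≺⊎≻ x#y of λ where
    (inj₁ x≺y) → y≼x x≺y
    (inj₂ y≺x) → x≼y y≺x

  -- Order is not decidable, but it may be decided when proving a negation.
  ≼⇒¬¬≺⊎≈ : x ≼ y → ¬ ¬ (x ≺ y ⊎ x ≈ y)
  ≼⇒¬¬≺⊎≈ x≼y none = none (inj₂ (≼-antisym x≼y (λ x≺y → none (inj₁ x≺y))))

  ≺-≼-trans : x ≺ y → y ≼ z → x ≺ z
  ≺-≼-trans {z = z} x≺y y≼z = case ≺-cotrans x≺y z of λ where
    (inj₁ x≺z) → x≺z
    (inj₂ z≺y) → contradiction z≺y y≼z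

  +-cancelʳ-≺ : ∀ z → x ⊕ z ≺ y ⊕ z → x ≺ y
  +-cancelʳ-≺ z lt = ≺.<-respʳ-≈ (undo _) (≺.<-respˡ-≈ (undo _) (+-monoˡ-< (⊖ z) lt))
    where
    undo : ∀ x → x ⊕ z ⊕ ⊖ z ≈ x
    undo x = ≈-trans (+-assoc x z (⊖ z)) (≈-trans (+-congˡ (-‿inverseʳ z)) (+-identityʳ x))

  +-monoˡ-≼ : ∀ z → x ≼ y → x ⊕ z ≼ y ⊕ z
  +-monoˡ-≼ z x≼y lt = x≼y (+-cancelʳ-≺ z lt)

  +-mono-≼ : w ≼ x → y ≼ z → w ⊕ y ≼ x ⊕ z
  +-mono-≼ {w} {x} {y} {z} w≼x y≼z = ≼-trans (+-monoˡ-≼ y w≼x)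
    (≼-trans (≈⇒≼ (+-comm x y)) (≼-trans (+-monoˡ-≼ x y≼z) (≈⇒≼ (+-comm z x))))

  +-mono-≺-≼ : w ≺ x → y ≼ z → w ⊕ y ≺ x ⊕ z
  +-mono-≺-≼ {w} {x} {y} {z} w≺x y≼z = ≺-≼-trans (+-monoˡ-< y w≺x)
    (≼-trans (≈⇒≼ (+-comm x y)) (≼-trans (+-monoˡ-≼ x y≼z) (≈⇒≼ (+-comm z x))))

  +-cancelʳ-≼ : ∀ z → x ⊕ z ≼ y ⊕ z → x ≼ y
  +-cancelʳ-≼ z le y≺x = le (+-monoˡ-< z y≺x)

  +-cancelʳ-≈ : ∀ z → x ⊕ z ≈ y ⊕ z → x ≈ y
  +-cancelʳ-≈ {x} {y} z = ∙-cancelʳ z x y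

  x≺y⇒0≺y-x : x ≺ y → 0# ≺ y ⊝ x
  x≺y⇒0≺y-x {x} x≺y = ≺.<-respˡ-≈ (-‿inverseʳ x) (+-monoˡ-< (⊖ x) x≺y)

  y-x+x≈y : ∀ y x → (y ⊝ x) ⊕ x ≈ y
  y-x+x≈y y x = ≈-trans (+-assoc y (⊖ x) x) (≈-trans (+-congˡ (-‿inverseˡ x)) (+-identityʳ y))

  *-monoˡ-≺ : 0# ≺ t → x ≺ y → t ⊗ x ≺ t ⊗ y
  *-monoˡ-≺ {t} {x} {y} 0≺t x≺y = ≺.<-respʳ-≈
    (≈-trans (≈-sym (distribˡ t (y ⊝ x) x)) (*-congˡ (y-x+x≈y y x)))
    (≺.<-respˡ-≈ (+-identityˡ (t ⊗ x)) (+-monoˡ-< (t ⊗ x) (*-pos 0≺t (x≺y⇒0≺y-x x≺y))))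

  *-monoˡ-≼ : 0# ≺ t → x ≼ y → t ⊗ x ≼ t ⊗ y
  *-monoˡ-≼ 0≺t x≼y lt = ≼⇒¬¬≺⊎≈ x≼y λ where
    (inj₁ x≺y) → ≺.asym (*-monoˡ-≺ 0≺t x≺y) lt
    (inj₂ x≈y) → ≺.irrefl (*-congˡ (≈-sym x≈y)) lt

  *-cancelˡ-≼ : 0# ≺ t → t ⊗ x ≼ t ⊗ y → x ≼ y
  *-cancelˡ-≼ 0≺t le y≺x = le (*-monoˡ-≺ 0≺t y≺x)

  *-cancelˡ-≈ : 0# ≺ t → t ⊗ x ≈ t ⊗ y → x ≈ y
  *-cancelˡ-≈ 0≺t eq = ≼-antisym (*-cancelˡ-≼ 0≺t (≈⇒≼ eq)) (*-cancelˡ-≼ 0≺t (≈⇒≼ (≈-sym eq)))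

  *-nonneg : 0# ≺ t → 0# ≼ x → 0# ≼ t ⊗ x
  *-nonneg {t} 0≺t 0≼x = ≼-trans (≈⇒≼ (≈-sym (zeroʳ t))) (*-monoˡ-≼ 0≺t 0≼x)

  inverse-pos : 0# ≺ t → t ⊗ x ≈ 1# → 0# ≺ x
  inverse-pos {t} {x} 0≺t tx≈1 = case #⇒≺⊎≻ x#0 of λ where
      (inj₁ x≺0) → contradiction
        (≺.<-respʳ-≈ (zeroʳ t) (≺.<-respˡ-≈ tx≈1 (*-monoˡ-≺ 0≺t x≺0))) (≺.asym 0<1)
      (inj₂ 0≺x) → 0≺x
    where
    xt≈1 : (x ⊝ 0#) ⊗ t ≈ 1#
    xt≈1 = ≈-trans (*-congʳ (≈-trans (≈-sym (+-identityʳ _)) (y-x+x≈y x 0#))) (≈-trans (*-comm x t) tx≈1)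
    x#0 : x # 0#
    x#0 = invertible⇒# (t , ≈-trans (*-comm t (x ⊝ 0#)) xt≈1 , xt≈1)

  -- A convex combination can attain a common lower bound only if both points do. It is used with
  -- bound zero off the cut and bound one for the weights of bases.
  convex-tight : 0# ≺ s → 0# ≺ t → a ≼ x → a ≼ y → s ⊗ x ⊕ t ⊗ y ≈ s ⊗ a ⊕ t ⊗ a → x ≈ a
  convex-tight 0≺s 0≺t a≼x a≼y eq = ≼-antisym
    (λ a≺x → ≺.irrefl (≈-sym eq) (+-mono-≺-≼ (*-monoˡ-≺ 0≺s a≺x) (*-monoˡ-≼ 0≺t a≼y)))
    a≼x

  ⋆-nonneg : ∀ p → 0# ≼ x → 0# ≼ p ⋆ x
  ⋆-nonneg zero    0≼x = ≈⇒≼ ≈-refl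
  ⋆-nonneg (suc p) 0≼x = ≼-trans (≈⇒≼ (≈-sym (+-identityˡ 0#))) (+-mono-≼ 0≼x (⋆-nonneg p 0≼x))

  ⋆-monoˡ-≼ : ∀ {p q} → 0# ≼ x → p ≤ q → p ⋆ x ≼ q ⋆ x
  ⋆-monoˡ-≼ {q = q} 0≼x z≤n = ⋆-nonneg q 0≼x
  ⋆-monoˡ-≼ 0≼x (s≤s p≤q) = +-mono-≼ (≈⇒≼ ≈-refl) (⋆-monoˡ-≼ 0≼x p≤q)

  ⋆-zero : ∀ p → p ⋆ 0# ≈ 0#
  ⋆-zero zero    = ≈-refl
  ⋆-zero (suc p) = ≈-trans (+-identityˡ _) (⋆-zero p)

  ⋆-1⊗ : ∀ p x → (p ⋆ 1#) ⊗ x ≈ p ⋆ x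
  ⋆-1⊗ p x = ≈-trans (×-assoc-* p 1# x) (×-congʳ p (*-identityˡ x))

  ∑-mono-≼ : {f g : Vector Carrier n} → (∀ i → f i ≼ g i) → ∑ f ≼ ∑ g
  ∑-mono-≼ {n = zero}  f≼g = ≈⇒≼ ≈-refl
  ∑-mono-≼ {n = suc n} f≼g = +-mono-≼ (f≼g zero) (∑-mono-≼ (f≼g ∘ suc))

  ∑-⋆ : ∀ (f : Fin n → ℕ) x → ∑ (λ i → f i ⋆ x) ≈ sum f ⋆ x
  ∑-⋆ {n = zero}  f x = ≈-refl
  ∑-⋆ {n = suc n} f x = ≈-trans (+-congˡ (∑-⋆ (f ∘ suc) x)) (≈-sym (×-homo-+ x (f zero) (sum (f ∘ suc))))

  recip-inverse : ∀ p .{{_ : NonZero p}} → p ⋆ recip p ≈ 1#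
  recip-inverse (suc p) = ≈-trans (≈-sym (⋆-1⊗ (suc p) _)) (proj₂ (1+n-invertible p))

  recip-pos : ∀ p .{{_ : NonZero p}} → 0# ≺ recip p
  recip-pos (suc p) = inverse-pos (0<1+n p) (proj₂ (1+n-invertible p))

  recip-unique : ∀ p .{{_ : NonZero p}} → p ⋆ x ≈ 1# → x ≈ recip p
  recip-unique {x} (suc p) eq = *-cancelˡ-≈ (0<1+n p) (≈-trans (⋆-1⊗ (suc p) x)
    (≈-trans eq (≈-sym (proj₂ (1+n-invertible p)))))

  weight : Multiset m → Vector Carrier m → Carrier
  weight A ρ = ∑ (λ e → A e ⋆ ρ e)

  spread : Carrier → Subset m → Vector Carrier m
  spread x F e = if does (e ∈? F) then x else 0#

  spread-in : ∀ {F : Subset m} {e} → e ∈ F → spread x F e ≡ x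
  spread-in {F = F} {e} e∈F rewrite dec-true (e ∈? F) e∈F = refl

  spread-out : ∀ {F : Subset m} {e} → e ∉ F → spread x F e ≡ 0#
  spread-out {F = F} {e} e∉F rewrite dec-false (e ∈? F) e∉F = refl

  spread-nonneg : ∀ {F : Subset m} → 0# ≼ x → ∀ e → 0# ≼ spread x F e
  spread-nonneg {F = F} 0≼x e with e ∈? F
  ... | yes _ = 0≼x
  ... | no  _ = ≈⇒≼ ≈-refl

  ⋆-spread : ∀ (A : Multiset m) x F e → A e ⋆ spread x F e ≈ restrict F A e ⋆ x
  ⋆-spread A x F e with e ∈? F
  ... | yes _ = ≈-refl
  ... | no  _ = ⋆-zero (A e)

  weight-spread : ∀ (A : Multiset m) x F → weight A (spread x F) ≈ size (restrict F A) ⋆ x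
  weight-spread A x F = ≈-trans (∑-cong (⋆-spread A x F)) (∑-⋆ (restrict F A) x)

  weight-cong : ∀ (A : Multiset m) {ρ σ} → (∀ e → ρ e ≈ σ e) → weight A ρ ≈ weight A σ
  weight-cong A ρ≈σ = ∑-cong (λ e → ×-congʳ (A e) (ρ≈σ e))

  -- The alternative `ρ e ≈ 0#` permits any multiplicities on the zero set, which is what comparing
  -- a base with its concentrated form requires.
  weight-mono : ∀ (A B : Multiset m) {ρ} → (∀ e → 0# ≼ ρ e) → (∀ e → A e ≤ B e ⊎ ρ e ≈ 0#) →
    weight A ρ ≼ weight B ρ
  weight-mono A B {ρ} 0≼ρ A≤B = ∑-mono-≼ λ e → case A≤B e of λ where
    (inj₁ Ae≤Be) → ⋆-monoˡ-≼ (0≼ρ e) Ae≤Be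
    (inj₂ ρe≈0)  → ≈⇒≼ (≈-trans (≈-trans (×-congʳ (A e) ρe≈0) (⋆-zero (A e)))
                     (≈-sym (≈-trans (×-congʳ (B e) ρe≈0) (⋆-zero (B e)))))

  weight-linear : ∀ (A : Multiset m) s t ρ σ →
    weight A (λ e → s ⊗ ρ e ⊕ t ⊗ σ e) ≈ s ⊗ weight A ρ ⊕ t ⊗ weight A σ
  weight-linear A s t ρ σ = ≈-trans (∑-cong pointwise)
    (≈-trans (∑-distrib-⊕ (λ e → s ⊗ (A e ⋆ ρ e)) (λ e → t ⊗ (A e ⋆ σ e)))
      (+-cong (≈-sym (*-distribˡ-∑ s (λ e → A e ⋆ ρ e))) (≈-sym (*-distribˡ-∑ t (λ e → A e ⋆ σ e)))))
    where
    pointwise : ∀ e → A e ⋆ (s ⊗ ρ e ⊕ t ⊗ σ e) ≈ s ⊗ (A e ⋆ ρ e) ⊕ t ⊗ (A e ⋆ σ e)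
    pointwise e = ≈-trans (×-distrib-+ _ _ (A e))
      (+-cong (≈-sym (×-comm-* (A e) s (ρ e))) (≈-sym (×-comm-* (A e) t (σ e))))

  weight-unit : ∀ e (ρ : Vector Carrier m) → weight (λ g → ⟦ g Fin.≟ e ⟧) ρ ≈ ρ e
  weight-unit zero ρ = ≈-trans (+-cong (+-identityʳ (ρ zero)) (vanish (ρ ∘ suc))) (+-identityʳ (ρ zero))
    where
    vanish : ∀ {n} (σ : Vector Carrier n) → ∑ (λ i → 0 ⋆ σ i) ≈ 0#
    vanish {zero}  σ = ≈-refl
    vanish {suc n} σ = ≈-trans (+-identityˡ _) (vanish (σ ∘ suc))
  weight-unit (suc e) ρ = ≈-trans (+-identityˡ _) (weight-unit e (ρ ∘ suc))

  weight-adjoin : ∀ (A : Multiset m) e ρ → weight (adjoin A e) ρ ≈ weight A ρ ⊕ ρ e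
  weight-adjoin A e ρ = ≈-trans (∑-cong (λ g → ×-homo-+ (ρ g) (A g) ⟦ g Fin.≟ e ⟧))
    (≈-trans (∑-distrib-⊕ (λ g → A g ⋆ ρ g) (λ g → ⟦ g Fin.≟ e ⟧ ⋆ ρ g)) (+-congˡ (weight-unit e ρ)))

  weight-exchange : ∀ (A : Multiset m) {f} e ρ → 0 < A f → weight (exchange A f e) ρ ⊕ ρ f ≈ weight A ρ ⊕ ρ e
  weight-exchange A {f} e ρ 0<Af = begin
    weight (exchange A f e) ρ ⊕ ρ f         ≈⟨ +-congʳ (weight-adjoin (remove A f) e ρ) ⟩
    (weight (remove A f) ρ ⊕ ρ e) ⊕ ρ f     ≈⟨ solve 3 (λ w x y → (w :+ x) :+ y := (w :+ y) :+ x) ≈-refl _ (ρ e) (ρ f) ⟩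
    (weight (remove A f) ρ ⊕ ρ f) ⊕ ρ e     ≈⟨ +-congʳ (weight-adjoin (remove A f) f ρ) ⟨
    weight (adjoin (remove A f) f) ρ ⊕ ρ e
      ≈⟨ +-congʳ (∑-cong λ g → ≡⇒≈ (cong (_⋆ ρ g) (remove-adjoin A 0<Af g))) ⟩
    weight A ρ ⊕ ρ e                        ∎
    where open SetoidReasoning setoid

-- Partition vectors are vertices

-- Finiteness of the index set allows all undecidable case distinctions to be made at once inside a
-- negation.
∀¬¬⇒¬¬∀ : ∀ {p} {P : Fin m → Set p} → (∀ i → ¬ ¬ P i) → ¬ ¬ (∀ i → P i)
∀¬¬⇒¬¬∀ {m = zero}  ¬¬P none = none λ ()
∀¬¬⇒¬¬∀ {m = suc m} ¬¬P none = ¬¬P zero λ p → ∀¬¬⇒¬¬∀ (¬¬P ∘ suc) λ ps →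
  none λ { zero → p ; (suc i) → ps i }

module Admissibility {c ℓ₁ ℓ₂ ℓ₃} (K : OrderedField c ℓ₁ ℓ₂ ℓ₃) {n m} (H : Hypergraph n m) (2≤n : 2 ≤ n) where
  open OrderedFieldProperties K
  open Inner H
  open MultiTrees H

  Admissible : Vector Carrier m → Set _
  Admissible ρ = (∀ e → 0# ≼ ρ e) × (∀ {A} → Base A → 1# ≼ weight A ρ)

  adm⁻ : ∀ {ρ} → Adm K (Ω K H) ρ → Admissible ρ
  adm⁻ {ρ} (0≼ρ , 1≼) = 0≼ρ , λ {A} base → ≼-trans
    (1≼ (multiplicityVector K A) (A , base⇒multiTree 2≤n base , λ _ → ≈-refl))
    (≈⇒≼ (∑-cong λ e → ⋆-1⊗ (A e) (ρ e)))

  adm⁺ : ∀ {ρ} → Admissible ρ → Adm K (Ω K H) ρ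
  adm⁺ {ρ} (0≼ρ , 1≼) = 0≼ρ , λ γ (A , multiTree , γ≈) → ≼-trans
    (1≼ (multiTree⇒base (ℕ.≤-trans (s≤s z≤n) 2≤n) multiTree))
    (≈⇒≼ (∑-cong λ e → ≈-trans (≈-sym (⋆-1⊗ (A e) (ρ e))) (*-congʳ (≈-sym (γ≈ e)))))

  module _ {k} (P : Partition n k) (2≤k : 2 ≤ k) where
    open Cuts H P

    k∸1≢0 : NonZero (k ∸ 1)
    k∸1≢0 = >-nonZero (ℕ.m<n⇒0<n∸m 2≤k)

    cutValue : Carrier
    cutValue = recip (k ∸ 1) {{k∸1≢0}}

    cutVector : Vector Carrier m
    cutVector = spread cutValue (δ H P)

    partitionVector≈ : ∀ e → partitionVector K H P 2≤k e ≈ cutVector e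
    partitionVector≈ e with e ∈? δ H P
    ... | yes _ = *-identityʳ _
    ... | no  _ = zeroʳ _

    cutValue-pos : 0# ≺ cutValue
    cutValue-pos = recip-pos (k ∸ 1) {{k∸1≢0}}

    cutVector-admissible : Admissible cutVector
    cutVector-admissible = spread-nonneg (≺⇒≼ cutValue-pos) , λ {A} base →
      ≼-trans (≈⇒≼ (≈-sym (recip-inverse (k ∸ 1) {{k∸1≢0}})))
        (≼-trans (⋆-monoˡ-≼ (≺⇒≼ cutValue-pos) (δ-lower base 2≤k))
          (≈⇒≼ (≈-sym (weight-spread A cutValue (δ H P)))))

    δ-exact : ∀ {A} → Base A → PartsTight A → size (restrict (δ H P) A) ≡ k ∸ 1
    δ-exact base tight = ℕ.≤-antisym (ℕ.<⇒≤pred (δ-upper base tight)) (δ-lower base 2≤k)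

    weight-cut : ∀ {A x} → Base A → PartsTight A → weight A (spread x (δ H P)) ≈ (k ∸ 1) ⋆ x
    weight-cut {A} {x} base tight = ≈-trans (weight-spread A x (δ H P))
      (≡⇒≈ (cong (_⋆ x) (δ-exact base tight)))

module CutExtremality {c ℓ₁ ℓ₂ ℓ₃} (K : OrderedField c ℓ₁ ℓ₂ ℓ₃) {n m k} (H : Hypergraph n m) (2≤n : 2 ≤ n)
  (connected : Connected (whole H)) (P : Partition n k) (2≤k : 2 ≤ k) (feasible : Feasible H P) where
  open OrderedFieldProperties K
  open Inner H
  open Cuts H P
  open Biconnectivity H P
  open Admissibility K H 2≤n

  private
    1≤n : 1 ≤ n
    1≤n = ℕ.≤-trans (s≤s z≤n) 2≤n

  -- The removed `f` is a cut hyperedge and so lies inside no part.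
  exchange-partsTight : ∀ {A f} e → PartsTight A → f ∈ δ H P → PartsTight (exchange A f e)
  exchange-partsTight {A} {f} e tight f∈δ i = ℕ.≤-trans (tight i)
    (s≤s (inner-mono {A} {exchange A f e} λ g g⊆ → ℕ.≤-trans
      (ℕ.≤-reflexive (sym (remove-other A λ g≡f → ⊆part⇒∉δ g⊆ (subst (_∈ δ H P) (sym g≡f) f∈δ))))
      (adjoin-≥ (remove A f) e g)))

  module _ (deletions : PartDeletionsConnected) {y : Vector Carrier m}
    (vanishes : ∀ e → e ∉ δ H P → y e ≈ 0#)
    (unit : ∀ {A} → Base A → PartsTight A → weight A y ≈ 1#) where

    -- An exchange of cut hyperedges leads between two bases of weight one, so both have the same
    -- value under `y`. The class `S` is the level set of `y` through `e`; that it is decidable may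
    -- be assumed because the goal is stable.
    cut-constant : ∀ e f → e ∈ δ H P → f ∈ δ H P → y f ≈ y e
    cut-constant e f e∈δ f∈δ = ≈-stable λ y-differs →
      ∀¬¬⇒¬¬∀ (λ g → ¬¬-excluded-middle {A = y g ≈ y e}) λ same? →
        y-differs (∈-fromDec⁻ same? (exchange-classes feasible deletions (fromDec same?) (classes same?)
          connected 1≤n e f e∈δ f∈δ (∈-fromDec⁺ same? ≈-refl)))
      where
      classes : (same? : ∀ g → Dec (y g ≈ y e)) → ∀ {A} a b → Base A → PartsTight A →
        a ∈ δ H P → b ∈ δ H P → 0 < A b → Forest (exchange A b a) →
        (a ∈ fromDec same? → b ∈ fromDec same?) × (b ∈ fromDec same? → a ∈ fromDec same?)
      classes same? {A} a b base tight a∈δ b∈δ 0<Ab forest =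
          (λ a∈ → ∈-fromDec⁺ same? (≈-trans (≈-sym equal) (∈-fromDec⁻ same? a∈)))
        , (λ b∈ → ∈-fromDec⁺ same? (≈-trans equal (∈-fromDec⁻ same? b∈)))
        where
        equal : y a ≈ y b
        equal = +-cancelʳ-≈ 1# (begin
          y a ⊕ 1#                        ≈⟨ +-comm (y a) 1# ⟩
          1# ⊕ y a                        ≈⟨ +-congʳ (unit base tight) ⟨
          weight A y ⊕ y a                ≈⟨ weight-exchange A a y 0<Ab ⟨
          weight (exchange A b a) y ⊕ y b ≈⟨ +-congʳ (unit
            (Trees.exchange-base H base 0<Ab forest) (exchange-partsTight a tight b∈δ)) ⟩
          1# ⊕ y b                        ≈⟨ +-comm 1# (y b) ⟩
          y b ⊕ 1#                        ∎)
          where open SetoidReasoning setoid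

    -- Once `y` is constant on the cut, a base spanning all parts fixes the constant: `k - 1` equal
    -- summands add up to one.
    cut-determined : ∀ e → y e ≈ cutVector P 2≤k e
    cut-determined e = determined (e ∈? δ H P)
      where
      determined : (d : Dec (e ∈ δ H P)) → y e ≈ (if does d then cutValue P 2≤k else 0#)
      determined (no  e∉δ) = vanishes e e∉δ
      determined (yes e∈δ) = recip-unique (k ∸ 1) {{k∸1≢0 P 2≤k}} (begin
        (k ∸ 1) ⋆ y e                   ≈⟨ weight-cut P 2≤k base tight ⟨
        weight T (spread (y e) (δ H P)) ≈⟨ weight-cong T constant ⟨
        weight T y                      ≈⟨ unit base tight ⟩
        1#                              ∎)
        where
        open SetoidReasoning setoid
        tightBase = parts-tight-base feasible (proj₂ (Trees.base-exists H connected 1≤n))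
        T = proj₁ tightBase
        base = proj₁ (proj₂ tightBase)
        tight = proj₂ (proj₂ tightBase)
        constant : ∀ g → y g ≈ spread (y e) (δ H P) g
        constant g with g ∈? δ H P
        ... | yes g∈δ = cut-constant e g e∈δ g∈δ
        ... | no  g∉δ = vanishes g g∉δ

  cut-extreme : PartDeletionsConnected → ∀ {ρ} → (∀ e → ρ e ≈ cutVector P 2≤k e) → Blocker K (Ω K H) ρ
  cut-extreme deletions {ρ} ρ≈ = adm⁺
      ( (λ e → ≼-trans (proj₁ (cutVector-admissible P 2≤k) e) (≈⇒≼ (≈-sym (ρ≈ e))))
      , λ {A} base → ≼-trans (proj₂ (cutVector-admissible P 2≤k) base) (≈⇒≼ (weight-cong A (λ e → ≈-sym (ρ≈ e)))))
    , λ y z t admY admZ 0≺t t≺1 eq →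
        let 0≺1-t = x≺y⇒0≺y-x t≺1
            total = ≈-trans (+-comm t (1# ⊝ t)) (y-x+x≈y 1# t) in
          component 0≺t 0≺1-t total (adm⁻ admY) (adm⁻ admZ) eq
        , component 0≺1-t 0≺t (y-x+x≈y 1# t) (adm⁻ admZ) (adm⁻ admY)
            (λ e → ≈-trans (eq e) (+-comm _ _))
    where
    component : ∀ {s t} {y z : Vector Carrier m} → 0# ≺ s → 0# ≺ t → s ⊕ t ≈ 1# →
      Admissible y → Admissible z → (∀ e → ρ e ≈ s ⊗ y e ⊕ t ⊗ z e) → ∀ e → ρ e ≈ y e
    component {s} {t} {y} {z} 0≺s 0≺t s+t≈1 (0≼y , 1≼y) (0≼z , 1≼z) eq e =
      ≈-trans (ρ≈ e) (≈-sym (cut-determined deletions vanishes unit e))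
      where
      vanishes : ∀ e → e ∉ δ H P → y e ≈ 0#
      vanishes e e∉δ = convex-tight 0≺s 0≺t (0≼y e) (0≼z e) (begin
        s ⊗ y e ⊕ t ⊗ z e  ≈⟨ eq e ⟨
        ρ e                ≈⟨ ρ≈ e ⟩
        cutVector P 2≤k e  ≡⟨ spread-out e∉δ ⟩
        0#                 ≈⟨ +-identityʳ 0# ⟨
        0# ⊕ 0#            ≈⟨ +-cong (zeroʳ s) (zeroʳ t) ⟨
        s ⊗ 0# ⊕ t ⊗ 0#    ∎)
        where open SetoidReasoning setoid
      unit : ∀ {A} → Base A → PartsTight A → weight A y ≈ 1#
      unit {A} base tight = convex-tight 0≺s 0≺t (1≼y base) (1≼z base) (begin
        s ⊗ weight A y ⊕ t ⊗ weight A z          ≈⟨ weight-linear A s t y z ⟨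
        weight A (λ e → s ⊗ y e ⊕ t ⊗ z e)       ≈⟨ weight-cong A eq ⟨
        weight A ρ                               ≈⟨ weight-cong A ρ≈ ⟩
        weight A (cutVector P 2≤k)               ≈⟨ weight-cut P 2≤k base tight ⟩
        (k ∸ 1) ⋆ cutValue P 2≤k                 ≈⟨ recip-inverse (k ∸ 1) {{k∸1≢0 P 2≤k}} ⟩
        1#                                       ≈⟨ s+t≈1 ⟨
        s ⊕ t                                    ≈⟨ +-cong (*-identityʳ s) (*-identityʳ t) ⟨
        s ⊗ 1# ⊕ t ⊗ 1#                          ∎)
        where open SetoidReasoning setoid

-- Partitions into components

anyVec? : ∀ {p} {P : Vec (Fin k) n → Set p} → (∀ xs → Dec (P xs)) → Dec (∃ P)
anyVec? {n = zero}  P? = map′ ([] ,_) (λ { ([] , p) → p }) (P? [])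
anyVec? {n = suc n} P? = map′ (λ (x , xs , p) → x ∷ xs , p) (λ { (x ∷ xs , p) → x , xs , p })
  (Fin.any? λ x → anyVec? λ xs → P? (x ∷ xs))

module _ {n k} (xs : Vec (Fin k) n) where

  Surjective : Set
  Surjective = ∀ i → ∃[ v ] (lookup xs v ≡ i)

  surjective? : Dec Surjective
  surjective? = Fin.all? λ i → Fin.any? λ v → lookup xs v Fin.≟ i

  -- Presenting partitions by colour vectors makes them a finite type that can be searched.
  colouring : Surjective → Partition n k
  colouring surjective = record
    { part     = λ i → fromDec (coloured? i)
    ; nonempty = λ i → proj₁ (surjective i) , ∈-fromDec⁺ (coloured? i) (proj₂ (surjective i))
    ; covers   = λ v → lookup xs v , ∈-fromDec⁺ (coloured? (lookup xs v)) refl , λ {i} → ∈-fromDec⁻ (coloured? i)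
    }
    where
    coloured? : ∀ i v → Dec (lookup xs v ≡ i)
    coloured? i v = lookup xs v Fin.≟ i

  surjective⇒≤ : Surjective → k ≤ n
  surjective⇒≤ surjective = Fin.injective⇒≤ {f = λ i → proj₁ (surjective i)}
    λ {i} {j} eq → trans (sym (proj₂ (surjective i))) (trans (cong (lookup xs) eq) (proj₂ (surjective j)))

module Refinement {n m} (H : Hypergraph n m) (Z : Subset m) where
  open Trees H

  Respects : Vec (Fin k) n → Set
  Respects xs = ∀ {e u w} → e ∈ Z → u ∈ edge H e → w ∈ edge H e → lookup xs u ≡ lookup xs w

  -- An uncrossed `X` becomes a part of its own with the new colour `zero`. The old colour of the
  -- part survives on a vertex outside `X`.
  split : (xs : Vec (Fin k) n) (surjective : Surjective xs) → Respects xs → ∀ i X → Nonempty X →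
    X ⊂ part (colouring xs surjective) i →
    (∀ e → e ∈ Z → edge H e ⊆ part (colouring xs surjective) i → Nonempty (edge H e ∩ X) →
      ¬ Nonempty (edge H e ∩ (part (colouring xs surjective) i ─ X))) →
    Σ[ ys ∈ Vec (Fin (suc k)) n ] (Surjective ys × Respects ys)
  split {k} xs surjective respects i X (x , x∈X) (X⊆ , y , y∈ , y∉X) uncrossed = ys , surjective′ , respects′
    where
    P = colouring xs surjective
    colour : Fin n → Fin (suc k)
    colour v = if does (v ∈? X) then zero else suc (lookup xs v)
    ys = tabulate colour
    ys-in : ∀ {v} → v ∈ X → lookup ys v ≡ zero
    ys-in {v} v∈X = trans (lookup∘tabulate colour v)
      (cong (λ b → if b then zero else suc (lookup xs v)) (dec-true (v ∈? X) v∈X))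
    ys-out : ∀ {v} → v ∉ X → lookup ys v ≡ suc (lookup xs v)
    ys-out {v} v∉X = trans (lookup∘tabulate colour v)
      (cong (λ b → if b then zero else suc (lookup xs v)) (dec-false (v ∈? X) v∉X))
    surjective′ : Surjective ys
    surjective′ zero    = x , ys-in x∈X
    surjective′ (suc j) with i Fin.≟ j
    ... | yes refl = y , trans (ys-out y∉X) (cong suc (index-unique P y∈))
    ... | no  i≢j  = proj₁ (surjective j) , trans
      (ys-out λ v∈X → i≢j (trans (sym (index-unique P (X⊆ v∈X))) (proj₂ (surjective j))))
      (cong suc (proj₂ (surjective j)))
    stays : ∀ {e u w} → e ∈ Z → u ∈ edge H e → w ∈ edge H e → u ∈ X → w ∈ X
    stays {e} {u} {w} e∈Z u∈ w∈ u∈X = decidable-stable (w ∈? X) λ w∉X →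
      uncrossed e e∈Z e⊆ (u , x∈p∩q⁺ (u∈ , u∈X)) (w , x∈p∩q⁺ (w∈ , x∈p∧x∉q⇒x∈p─q (e⊆ w∈) w∉X))
      where
      e⊆ : edge H e ⊆ part P i
      e⊆ v∈ = index-∈ P (trans (respects e∈Z v∈ u∈) (index-unique P (X⊆ u∈X)))
    respects′ : Respects ys
    respects′ {e} {u} {w} e∈Z u∈ w∈ = cases (u ∈? X) (w ∈? X)
      where
      cases : Dec (u ∈ X) → Dec (w ∈ X) → lookup ys u ≡ lookup ys w
      cases (yes u∈X) (yes w∈X) = trans (ys-in u∈X) (sym (ys-in w∈X))
      cases (yes u∈X) (no  w∉X) = contradiction (stays e∈Z u∈ w∈ u∈X) w∉X
      cases (no  u∉X) (yes w∈X) = contradiction (stays e∈Z w∈ u∈ w∈X) u∉X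
      cases (no  u∉X) (no  w∉X) = trans (ys-out u∉X) (trans (cong suc (respects e∈Z u∈ w∈)) (sym (ys-out w∉X)))

  LinkedColouring : Set
  LinkedColouring = ∃[ k ] Σ[ xs ∈ Vec (Fin k) n ] Σ[ surjective ∈ Surjective xs ]
    (Respects xs × (∀ i → Linked Z (part (colouring xs surjective) i)))

  -- Every split adds a colour, and a surjective colouring has at most `n` of them, so the fuel
  -- cannot run out. When no split is possible, every part is linked by `Z`.
  refine : ∀ fuel (xs : Vec (Fin k) n) → Surjective xs → Respects xs → n < fuel + k → LinkedColouring
  refine zero xs surjective respects n<k = contradiction (surjective⇒≤ xs surjective) (ℕ.<⇒≱ n<k)
  refine {k} (suc fuel) xs surjective respects bound = improve
    (Fin.any? λ i → anySubset? λ X → nonempty? X ×-dec (X ⊂? part P i) ×-dec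
      ¬? (Fin.any? λ e → (e ∈? Z) ×-dec (edge H e ⊆? part P i)
        ×-dec nonempty? (edge H e ∩ X) ×-dec nonempty? (edge H e ∩ (part P i ─ X))))
    where
    P = colouring xs surjective
    Crossed : Fin k → Subset n → Set
    Crossed i X = ∃[ e ] (e ∈ Z × edge H e ⊆ part P i × Nonempty (edge H e ∩ X) × Nonempty (edge H e ∩ (part P i ─ X)))
    improve : Dec (∃[ i ] ∃[ X ] (Nonempty X × X ⊂ part P i × ¬ Crossed i X)) → LinkedColouring
    improve (yes (i , X , ne , X⊂ , uncrossed)) =
      let (ys , surjective′ , respects′) = split xs surjective respects i X ne X⊂
            (λ e e∈Z e⊆ meets leaves → uncrossed (e , e∈Z , (λ {_} → e⊆) , meets , leaves))
      in refine fuel ys surjective′ respects′ (subst (n <_) (sym (ℕ.+-suc fuel k)) bound)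
    improve (no none) = k , xs , surjective , respects , λ i X ne X⊂ →
      decidable-stable (crossed? i X) λ uncrossed → none (i , X , ne , X⊂ , uncrossed)
      where
      crossed? : ∀ i X → Dec (Crossed i X)
      crossed? i X = Fin.any? λ e → (e ∈? Z) ×-dec (edge H e ⊆? part P i)
        ×-dec nonempty? (edge H e ∩ X) ×-dec nonempty? (edge H e ∩ (part P i ─ X))

  linked-colouring : 1 ≤ n → LinkedColouring
  linked-colouring 1≤n = refine {1} n (tabulate λ _ → zero)
    (λ { zero → fromℕ< 1≤n , lookup∘tabulate _ (fromℕ< 1≤n) })
    (λ {_} {u} {w} _ _ _ → trans (lookup∘tabulate _ u) (sym (lookup∘tabulate _ w)))
    (ℕ.≤-reflexive (ℕ.+-comm 1 n))

connected? : (G : Minor n m) → Dec (Connected G)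
connected? G = map′
  (λ none X ne X⊂ → decidable-stable (crossed? X) λ uncrossed → none (X , ne , X⊂ , uncrossed))
  (λ connected (X , ne , X⊂ , uncrossed) → uncrossed (connected X ne X⊂))
  (¬? (anySubset? λ X → nonempty? X ×-dec (X ⊂? vertices G) ×-dec ¬? (crossed? X)))
  where
  crossed? : ∀ X → Dec (∃[ e ] (e ∈ edges G × Nonempty (ends G e ∩ X) × Nonempty (ends G e ∩ (vertices G ─ X))))
  crossed? X = Fin.any? λ e → (e ∈? edges G) ×-dec nonempty? (ends G e ∩ X) ×-dec nonempty? (ends G e ∩ (vertices G ─ X))

module Cutting {n m k} (H : Hypergraph n m) (P : Partition n k) where
  open Inner H
  open Trees H
  open Cuts H P
  open Biconnectivity H P

  feasible? : Dec (Feasible H P)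
  feasible? = Fin.all? λ i → connected? (whole H [ part P i ])

  -- A cut vertex i of the shrunk hypergraph.
  record CutPart : Set where
    field
      i        : Fin k
      J J′     : Subset k
      i∉J      : i ∉ J
      i∉J′     : i ∉ J′
      J-nonempty  : Nonempty J
      J′-nonempty : Nonempty J′
      total    : suc (∣ J ∣ + ∣ J′ ∣) ≡ k
      covering : ∀ j → j ≢ i → j ∈ J ⊎ j ∈ J′
      separate : ∀ {e u w} → u ∈ edge H e → w ∈ edge H e → index P u ∈ J → index P w ∉ J′

  private
    crossing? : ∀ i X → Dec (∃[ e ] (Nonempty (edge H e ∩ X) × Nonempty (edge H e ∩ (∁ (part P i) ─ X))))
    crossing? i X = Fin.any? λ e → nonempty? (edge H e ∩ X) ×-dec nonempty? (edge H e ∩ (∁ (part P i) ─ X))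

    Separated : Fin k → Subset n → Set
    Separated i X = Nonempty X × X ⊂ ∁ (part P i)
      × ¬ (∃[ e ] (Nonempty (edge H e ∩ X) × Nonempty (edge H e ∩ (∁ (part P i) ─ X))))

    separated? : Dec (∃[ i ] ∃[ X ] Separated i X)
    separated? = Fin.any? λ i → anySubset? λ X → nonempty? X ×-dec (X ⊂? ∁ (part P i)) ×-dec ¬? (crossing? i X)

    none⇒deletions : ¬ (∃[ i ] ∃[ X ] Separated i X) → PartDeletionsConnected
    none⇒deletions none i X ne X⊂ =
      decidable-stable (crossing? i X) λ uncrossed → none (i , X , ne , X⊂ , uncrossed)

  deletions? : Dec PartDeletionsConnected
  deletions? = map′ none⇒deletions
    (λ deletions (i , X , ne , X⊂ , uncrossed) → uncrossed (deletions i X ne X⊂)) (¬? separated?)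

  deletions⊎cutPart : Feasible H P → PartDeletionsConnected ⊎ CutPart
  deletions⊎cutPart feasible with separated?
  ... | no none = inj₁ (none⇒deletions none)
  ... | yes (i , X , (x , x∈X) , (X⊆ , y , y∈ , y∉X) , uncrossed) = inj₂ record
    { i = i
    ; J = J
    ; J′ = J′
    ; i∉J = i∉J
    ; i∉J′ = λ i∈J′ → x∈∁p⇒x∉p i∈J′ (p⊆p∪q J (x∈⁅x⁆ i))
    ; J-nonempty = index P x , J⁺ x∈X
    ; J′-nonempty = index P y , x∉p⇒x∈∁p (uncovered y∈ y∉X)
    ; total = total
    ; covering = covering
    ; separate = λ {e} {u} {w} u∈ w∈ u∈J w∈J′ → uncrossed
        ( e , (u , x∈p∩q⁺ (u∈ , J⁻ u∈J))
        , w , x∈p∩q⁺ (w∈ , x∈p∧x∉q⇒x∈p─q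
            (x∉p⇒x∈∁p λ w∈i → x∈∁p⇒x∉p w∈J′ (p⊆p∪q J (subst (_∈ ⁅ i ⁆) (sym (index-unique P w∈i)) (x∈⁅x⁆ i))))
            (λ w∈X → x∈∁p⇒x∉p w∈J′ (q⊆p∪q ⁅ i ⁆ J (J⁺ w∈X)))))
    }
    where
    meets? : ∀ j → Dec (∃[ v ] (v ∈ X × index P v ≡ j))
    meets? j = Fin.any? λ v → (v ∈? X) ×-dec (index P v Fin.≟ j)
    J J′ : Subset k
    J = fromDec meets?
    J′ = ∁ (⁅ i ⁆ ∪ J)
    J⁺ : ∀ {v} → v ∈ X → index P v ∈ J
    J⁺ {v} v∈X = ∈-fromDec⁺ meets? (v , v∈X , refl)
    -- Since no hyperedge crosses `X`, feasibility makes it a union of parts, so it is described by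
    -- the set `J` of their indices.
    saturated : ∀ {u w} → u ∈ X → index P u ≡ index P w → w ∈ X
    saturated {u} {w} u∈X same = decidable-stable (w ∈? X) λ w∉X →
      let R = part P (index P u)
          (e , _ , _ , (a , a∈) , (b , b∈)) = feasible⇒linked feasible (index P u) (R ∩ X)
            (u , x∈p∩q⁺ (∈-index P u , u∈X))
            (p∩q⊆p R X , w , index-∈ P (sym same) , λ w∈ → w∉X (p∩q⊆q R X w∈))
          b∈─ = p∩q⊆q (edge H e) (R ─ R ∩ X) b∈
          b∈R = p─q⊆p R (R ∩ X) b∈─
      in uncrossed
        ( e , (a , ∩-⊇ (p∩q⊆p (edge H e) (R ∩ X)) (p∩q⊆q R X ∘ p∩q⊆q (edge H e) (R ∩ X)) a∈)
        , b , x∈p∩q⁺ (p∩q⊆p (edge H e) (R ─ R ∩ X) b∈ , x∈p∧x∉q⇒x∈p─q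
            (x∉p⇒x∈∁p λ b∈i → x∈∁p⇒x∉p (X⊆ u∈X)
              (index-∈ P (trans (sym (index-unique P b∈R)) (index-unique P b∈i))))
            (λ b∈X → x∈p─q⇒x∉q R (R ∩ X) b∈─ (x∈p∩q⁺ (b∈R , b∈X)))))
    J⁻ : ∀ {v} → index P v ∈ J → v ∈ X
    J⁻ v∈J = let (u , u∈X , eq) = ∈-fromDec⁻ meets? v∈J in saturated u∈X eq
    i∉J : i ∉ J
    i∉J i∈J = let (u , u∈X , eq) = ∈-fromDec⁻ meets? i∈J in x∈∁p⇒x∉p (X⊆ u∈X) (index-∈ P eq)
    uncovered : ∀ {v} → v ∈ ∁ (part P i) → v ∉ X → index P v ∉ ⁅ i ⁆ ∪ J
    uncovered {v} v∈ v∉X j∈ = case x∈p∪q⁻ ⁅ i ⁆ J j∈ of λ where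
      (inj₁ j∈i) → x∈∁p⇒x∉p v∈ (index-∈ P (x∈⁅y⁆⇒x≡y i j∈i))
      (inj₂ j∈J) → v∉X (J⁻ j∈J)
    covering : ∀ j → j ≢ i → j ∈ J ⊎ j ∈ J′
    covering j j≢i = case j ∈? J of λ where
      (yes j∈J) → inj₁ j∈J
      (no  j∉J) → inj₂ (x∉p⇒x∈∁p λ j∈ → case x∈p∪q⁻ ⁅ i ⁆ J j∈ of λ where
        (inj₁ j∈i) → j≢i (x∈⁅y⁆⇒x≡y i j∈i)
        (inj₂ j∈J) → j∉J j∈J)
    size-union : ∣ ⁅ i ⁆ ∪ J ∣ ≡ suc (∣ J ∣)
    size-union = begin
      ∣ ⁅ i ⁆ ∪ J ∣                        ≡⟨ ℕ.+-identityʳ _ ⟨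
      ∣ ⁅ i ⁆ ∪ J ∣ + 0                    ≡⟨ cong (∣ ⁅ i ⁆ ∪ J ∣ +_) (trans (cong ∣_∣
        (Empty-unique λ (j , j∈) → i∉J (subst (_∈ J) (x∈⁅y⁆⇒x≡y i (p∩q⊆p ⁅ i ⁆ J j∈)) (p∩q⊆q ⁅ i ⁆ J j∈))))
        (∣⊥∣≡0 k)) ⟨
      ∣ ⁅ i ⁆ ∪ J ∣ + ∣ ⁅ i ⁆ ∩ J ∣        ≡⟨ ∣p∪q∣+∣p∩q∣ ⁅ i ⁆ J ⟩
      ∣ ⁅ i ⁆ ∣ + ∣ J ∣                    ≡⟨ cong (_+ ∣ J ∣) (∣⁅x⁆∣≡1 i) ⟩
      suc (∣ J ∣)                          ∎
      where open ≡-Reasoning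
    total : suc (∣ J ∣ + ∣ J′ ∣) ≡ k
    total = trans (cong₂ _+_ (sym size-union) (∣∁p∣≡n∸∣p∣ (⁅ i ⁆ ∪ J))) (ℕ.m+[n∸m]≡n (∣p∣≤n (⁅ i ⁆ ∪ J)))

-- Vertices are partition vectors

module Meeting {n m k} (H : Hypergraph n m) (P : Partition n k) where
  open Inner H
  open Cuts H P

  module _ (J : Subset k) where

    private
      meets? : ∀ e → Dec (e ∈ δ H P × ∃[ v ] (v ∈ edge H e × index P v ∈ J))
      meets? e = (e ∈? δ H P) ×-dec Fin.any? λ v → (v ∈? edge H e) ×-dec (index P v ∈? J)

    -- When some part is outside `J`, this is the cut of the partition obtained by merging all parts
    -- outside `J` into one. It has `∣ J ∣ + 1` parts, whence the bound of `meeting-lower`.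
    meeting : Subset m
    meeting = fromDec meets?

    meeting⁺ : ∀ {e v} → e ∈ δ H P → v ∈ edge H e → index P v ∈ J → e ∈ meeting
    meeting⁺ e∈δ v∈ v∈J = ∈-fromDec⁺ meets? (e∈δ , _ , v∈ , v∈J)

    meeting⁻ : ∀ {e} → e ∈ meeting → e ∈ δ H P × ∃[ v ] (v ∈ edge H e × index P v ∈ J)
    meeting⁻ = ∈-fromDec⁻ meets?

    meeting-lower : ∀ {A i} → Base A → i ∉ J → ∣ J ∣ ≤ size (restrict meeting A)
    meeting-lower {i = i} base i∉J = cut-lower base J meeting
      (_ , λ v∈J → i∉J (subst (_∈ J) (index-unique P (proj₂ (nonempty P i))) v∈J))
      λ e e∉ → cover e e∉ (e ∈? δ H P) (index P (proj₁ (edge-nonempty e)) ∈? J)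
      where
      cover : ∀ e → e ∉ meeting → Dec (e ∈ δ H P) → Dec (index P (proj₁ (edge-nonempty e)) ∈ J) →
        (∀ v → v ∈ edge H e → index P v ∉ J) ⊎ (∃[ j ] (j ∈ J × edge H e ⊆ part P j))
      cover e e∉ (yes e∈δ) _ = inj₁ λ v v∈ v∈J → e∉ (meeting⁺ e∈δ v∈ v∈J)
      cover e e∉ (no e∉δ) (yes j∈J) = inj₂ (_ , j∈J , ∉δ⇒⊆part e∉δ (proj₂ (edge-nonempty e)))
      cover e e∉ (no e∉δ) (no j∉J) = inj₁ λ v v∈ v∈J →
        j∉J (subst (_∈ J) (∉δ⇒constant e∉δ v∈ (proj₂ (edge-nonempty e))) v∈J)

    meeting-nonempty : ∀ {i} → Connected (whole H) → Nonempty J → i ∉ J → Nonempty meeting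
    meeting-nonempty {i} connected (j , j∈J) i∉J =
      let (e , _ , (u , u∈) , (w , w∈)) = connected U
            (_ , ∈-fromDec⁺ inJ? (subst (_∈ J) (sym (index-unique P (proj₂ (nonempty P j)))) j∈J))
            (⊆⊤ , _ , ∈⊤ , λ v∈U → i∉J (subst (_∈ J) (index-unique P (proj₂ (nonempty P i))) (∈-fromDec⁻ inJ? v∈U)))
          u∈J = ∈-fromDec⁻ inJ? (p∩q⊆q (edge H e) U u∈)
          w∉J = λ w∈J → x∈p─q⇒x∉q ⊤ U (p∩q⊆q (edge H e) (⊤ ─ U) w∈) (∈-fromDec⁺ inJ? w∈J)
          u∈e = p∩q⊆p (edge H e) U u∈
          w∈e = p∩q⊆p (edge H e) (⊤ ─ U) w∈
      in e , meeting⁺ (δ⁺ u∈e w∈e λ same → w∉J (subst (_∈ J) same u∈J)) u∈e u∈J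
      where
      inJ? : ∀ v → Dec (index P v ∈ J)
      inJ? v = index P v ∈? J
      U = fromDec inJ?

module Reciprocals {c ℓ₁ ℓ₂ ℓ₃} (K : OrderedField c ℓ₁ ℓ₂ ℓ₃) where
  open OrderedFieldProperties K

  private variable
    x y : Carrier

  invert : 0# ≺ x → ∃[ y ] (x ⊗ y ≈ 1# × 0# ≺ y)
  invert {x} 0≺x =
    let (y , _ , eq) = OrderedField.#⇒invertible K (#-from-≻ 0≺x)
        xy≈1 = ≈-trans (*-congʳ (≈-trans (≈-sym (y-x+x≈y x 0#)) (+-identityʳ _))) eq
    in y , xy≈1 , inverse-pos 0≺x xy≈1

  x≺x+y : 0# ≺ y → x ≺ x ⊕ y
  x≺x+y {y} {x} 0≺y = ≺.<-respʳ-≈ (+-comm y x) (≺.<-respˡ-≈ (+-identityˡ x) (OrderedField.+-monoˡ-< K x 0≺y))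

  ⋆-monoˡ-≺ : ∀ {p q} → 0# ≺ x → p < q → p ⋆ x ≺ q ⋆ x
  ⋆-monoˡ-≺ 0≺x p<q = ≺-≼-trans
    (≺.<-respʳ-≈ (+-comm _ _) (x≺x+y 0≺x)) (⋆-monoˡ-≼ (≺⇒≼ 0≺x) p<q)

  -- Multiply the inequality of the denominators by the product of the two reciprocals.
  recip-anti : ∀ {p q} → p < q → recip (suc q) ≺ recip (suc p)
  recip-anti {p} {q} p<q = ≺.<-respʳ-≈ right (≺.<-respˡ-≈ left
      (⋆-monoˡ-≺ (OrderedField.*-pos K (recip-pos (suc p)) (recip-pos (suc q))) (s≤s p<q)))
    where
    r = recip (suc p)
    s = recip (suc q)
    left : suc p ⋆ (r ⊗ s) ≈ s
    left = ≈-trans (≈-sym (×-assoc-* (suc p) r s)) (≈-trans (*-congʳ (recip-inverse (suc p))) (*-identityˡ s))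
    right : suc q ⋆ (r ⊗ s) ≈ r
    right = ≈-trans (≈-sym (×-comm-* (suc q) r s)) (≈-trans (*-congˡ (recip-inverse (suc q))) (*-identityʳ r))

  -- 1 / p, with 0 in the place of 1 / 0.
  value : ℕ → Carrier
  value zero    = 0#
  value (suc p) = recip (suc p)

  recip≡value : ∀ p .{{_ : NonZero p}} → recip p ≡ value p
  recip≡value (suc p) = refl

  value-apart : ∀ p q → p ≢ q → value p # value q
  value-apart zero    zero    p≢q = contradiction refl p≢q
  value-apart zero    (suc q) _   = ≺⇒# (recip-pos (suc q))
  value-apart (suc p) zero    _   = #-from-≻ (recip-pos (suc p))
  value-apart (suc p) (suc q) p≢q with ℕ.<-cmp p q
  ... | tri< p<q _ _ = #-from-≻ (recip-anti p<q)
  ... | tri≈ _ p≡q _ = contradiction (cong suc p≡q) p≢q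
  ... | tri> _ _ q<p = ≺⇒# (recip-anti q<p)

  value-injective : ∀ p q → value p ≈ value q → p ≡ q
  value-injective p q eq = decidable-stable (p ℕ.≟ q) λ p≢q → #-irreflexive eq (value-apart p q p≢q)

  -- By cotransitivity x is apart from all but at most one of the v i.
  pick : ∀ N (v : Fin N → Carrier) → (∀ i j → i ≢ j → v i # v j) →
    ¬ ¬ (∃[ i ] (x ≈ v i)) → ∃[ i ] (x ≈ v i)
  pick zero    v apart ¬¬found = ⊥-elim (¬¬found λ ())
  pick {x} (suc N) v apart ¬¬found with compare N (v ∘ suc) (λ j → apart zero (suc j) λ ())
    where
    compare : ∀ N (w : Fin N → Carrier) → (∀ j → v zero # w j) → v zero # x ⊎ (∀ j → x # w j)
    compare zero    w _ = inj₂ λ ()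
    compare (suc N) w v#w with OrderedField.#-cotrans K (v#w zero) x | compare N (w ∘ suc) (v#w ∘ suc)
    ... | inj₁ v#x | _        = inj₁ v#x
    ... | inj₂ _   | inj₁ v#x = inj₁ v#x
    ... | inj₂ x#w | inj₂ x#ws = inj₂ λ { zero → x#w ; (suc j) → x#ws j }
  ... | inj₂ x#v = zero , ≈-stable λ x≉v → ¬¬found λ where
    (zero  , eq) → x≉v eq
    (suc j , eq) → #-irreflexive eq (x#v j)
  ... | inj₁ v#x =
    let (j , eq) = pick N (v ∘ suc) (λ i j i≢j → apart (suc i) (suc j) (i≢j ∘ Fin.suc-injective)) λ none →
          ¬¬found λ where
            (zero  , eq) → #-irreflexive (≈-sym eq) v#x
            (suc j , eq) → none (j , eq)
    in suc j , eq

  -- The minimum of finitely many positive numbers. Choosing the smaller of two elements requires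
  -- deciding the order, hence the double negation.
  lower-bound : (σ : Vector Carrier m) → (∀ e → 0# ≺ σ e) → ¬ ¬ (∃[ ε ] (0# ≺ ε × (∀ e → ε ≼ σ e)))
  lower-bound {zero}  σ 0≺σ none = none (1# , 0<1 , λ ())
  lower-bound {suc m} σ 0≺σ none = lower-bound (σ ∘ suc) (0≺σ ∘ suc) λ (ε , 0≺ε , ε≼) →
    ¬¬-excluded-middle {A = σ zero ≺ ε} λ where
      (yes σ≺ε) → none (σ zero , 0≺σ zero , λ where
        zero    → ≈⇒≼ ≈-refl
        (suc e) → ≼-trans (≺⇒≼ σ≺ε) (ε≼ e))
      (no σ⊀ε) → none (ε , 0≺ε , λ where
        zero    → σ⊀ε
        (suc e) → ε≼ e)

module BlockerVertices {c ℓ₁ ℓ₂ ℓ₃} (K : OrderedField c ℓ₁ ℓ₂ ℓ₃) {n m} (H : Hypergraph n m) (2≤n : 2 ≤ n)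
  (connected : Connected (whole H)) where
  open OrderedFieldProperties K
  open Reciprocals K
  open Inner H
  open Trees H
  open Admissibility K H 2≤n

  private
    1≤n : 1 ≤ n
    1≤n = ℕ.≤-trans (s≤s z≤n) 2≤n

    someBase : ∃[ A ] Base A
    someBase = base-exists connected 1≤n

  module _ {k} (P : Partition n k) (2≤k : 2 ≤ k) where
    open Cuts H P
    open Cutting H P
    open Meeting H P

    private
      r : Carrier
      r = cutValue P 2≤k

      1≤∣_∣ : {J : Subset k} → Nonempty J → NonZero (∣ J ∣)
      1≤∣ ne ∣ = >-nonZero (nonempty⇒1≤∣p∣ ne)

    -- At a cut vertex the cut vector is a convex combination of those of the two sides.
    cutPart⇒¬extreme : CutPart → ∀ {ρ} → Blocker K (Ω K H) ρ → ¬ (∀ e → ρ e ≈ cutVector P 2≤k e)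
    cutPart⇒¬extreme C {ρ} (_ , extreme) ρ≈ =
      -- On a hyperedge meeting `J` the vector `z` vanishes while `ρ` has the positive value `r`, so
      -- the combination is proper.
      let (e , e∈J) = meeting-nonempty J connected J-nonempty i∉J
          (_ , ρ≈z) = extreme y z t (adm⁺ admissibleY) (adm⁺ admissibleZ) 0≺t t≺1 combination
          r≈0 : r ≈ 0#
          r≈0 = ≈-trans (≡⇒≈ (sym (spread-in (proj₁ (meeting⁻ J e∈J)))))
            (≈-trans (≈-sym (ρ≈ e)) (≈-trans (ρ≈z e) (≡⇒≈ (spread-out (separated e∈J)))))
      in ≺.irrefl (≈-sym r≈0) (cutValue-pos P 2≤k)
      where
      open CutPart C
      a b t : Carrier
      a = recip (∣ J ∣) {{1≤∣ J-nonempty ∣}}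
      b = recip (∣ J′ ∣) {{1≤∣ J′-nonempty ∣}}
      -- With `r` equal to `1 / (k - 1)`, the identity `total` gives the other coefficient
      -- `∣ J′ ∣ ⋆ r`. The coefficients cancel the denominators `∣ J ∣` and `∣ J′ ∣`, leaving `r` on
      -- both sides of the cut vertex.
      t = ∣ J ∣ ⋆ r
      y z : Vector Carrier m
      y = spread a (meeting J)
      z = spread b (meeting J′)

      separated : ∀ {e} → e ∈ meeting J → e ∉ meeting J′
      separated e∈J e∈J′ =
        let (_ , u , u∈ , u∈J) = meeting⁻ J e∈J
            (_ , w , w∈ , w∈J′) = meeting⁻ J′ e∈J′
        in separate u∈ w∈ u∈J w∈J′

      side-admissible : ∀ {J} .{{_ : NonZero (∣ J ∣)}} → i ∉ J → Admissible (spread (recip (∣ J ∣)) (meeting J))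
      side-admissible {J} i∉J = spread-nonneg (≺⇒≼ (recip-pos (∣ J ∣))) , λ {A} base →
        ≼-trans (≈⇒≼ (≈-sym (recip-inverse (∣ J ∣))))
          (≼-trans (⋆-monoˡ-≼ (≺⇒≼ (recip-pos (∣ J ∣))) (meeting-lower J base i∉J))
            (≈⇒≼ (≈-sym (weight-spread A (recip (∣ J ∣)) (meeting J)))))

      admissibleY : Admissible y
      admissibleY = side-admissible {J} {{1≤∣ J-nonempty ∣}} i∉J

      admissibleZ : Admissible z
      admissibleZ = side-admissible {J′} {{1≤∣ J′-nonempty ∣}} i∉J′

      side-pos : ∀ {J : Subset k} → Nonempty J → 0# ≺ ∣ J ∣ ⋆ r
      side-pos ne = ⋆-monoˡ-≺ (cutValue-pos P 2≤k) (nonempty⇒1≤∣p∣ ne)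

      0≺t : 0# ≺ t
      0≺t = side-pos J-nonempty

      t+s≈1 : t ⊕ ∣ J′ ∣ ⋆ r ≈ 1#
      t+s≈1 = ≈-trans (≈-sym (×-homo-+ r (∣ J ∣) (∣ J′ ∣)))
        (≈-trans (≡⇒≈ (cong (λ k → (k ∸ 1) ⋆ r) total)) (recip-inverse (k ∸ 1) {{k∸1≢0 P 2≤k}}))

      t≺1 : t ≺ 1#
      t≺1 = ≺.<-respʳ-≈ t+s≈1 (x≺x+y (side-pos J′-nonempty))

      1-t≈s : 1# ⊝ t ≈ ∣ J′ ∣ ⋆ r
      1-t≈s = +-cancelʳ-≈ t (≈-trans (y-x+x≈y 1# t) (≈-trans (≈-sym t+s≈1) (+-comm t _)))

      scale : ∀ p .{{_ : NonZero p}} → (p ⋆ r) ⊗ recip p ≈ r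
      scale p = ≈-trans (×-assoc-* p r (recip p))
        (≈-trans (≈-sym (×-comm-* p r (recip p))) (≈-trans (*-congˡ (recip-inverse p)) (*-identityʳ r)))

      sides : ∀ {e} → e ∈ δ H P → e ∈ meeting J ⊎ e ∈ meeting J′
      sides e∈δ = let (u , w , u∈ , w∈ , differ) = δ⁻ e∈δ in
        case index P u Fin.≟ i of λ where
          (no  u≢i) → place e∈δ u∈ u≢i
          (yes u≡i) → place e∈δ w∈ λ w≡i → differ (trans u≡i (sym w≡i))
        where
        place : ∀ {e v} → e ∈ δ H P → v ∈ edge H e → index P v ≢ i → e ∈ meeting J ⊎ e ∈ meeting J′
        place e∈δ v∈ v≢i = case covering _ v≢i of λ where
          (inj₁ v∈J)  → inj₁ (meeting⁺ J e∈δ v∈ v∈J)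
          (inj₂ v∈J′) → inj₂ (meeting⁺ J′ e∈δ v∈ v∈J′)

      combination : ∀ e → ρ e ≈ t ⊗ y e ⊕ (1# ⊝ t) ⊗ z e
      combination e = ≈-trans (ρ≈ e) (≈-sym (≈-trans (+-congˡ (*-congʳ 1-t≈s)) (cases (e ∈? δ H P))))
        where
        open SetoidReasoning setoid
        s = ∣ J′ ∣ ⋆ r
        cases : (d : Dec (e ∈ δ H P)) → t ⊗ y e ⊕ s ⊗ z e ≈ (if does d then r else 0#)
        cases (no e∉δ) = begin
          t ⊗ y e ⊕ s ⊗ z e  ≡⟨ cong₂ (λ y z → t ⊗ y ⊕ s ⊗ z)
            (spread-out (e∉δ ∘ proj₁ ∘ meeting⁻ J)) (spread-out (e∉δ ∘ proj₁ ∘ meeting⁻ J′)) ⟩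
          t ⊗ 0# ⊕ s ⊗ 0#    ≈⟨ +-cong (zeroʳ t) (zeroʳ s) ⟩
          0# ⊕ 0#            ≈⟨ +-identityʳ 0# ⟩
          0#                 ∎
        cases (yes e∈δ) = case sides e∈δ of λ where
          (inj₁ e∈J) → begin
            t ⊗ y e ⊕ s ⊗ z e  ≡⟨ cong₂ (λ y z → t ⊗ y ⊕ s ⊗ z) (spread-in e∈J) (spread-out (separated e∈J)) ⟩
            t ⊗ a ⊕ s ⊗ 0#     ≈⟨ +-cong (scale (∣ J ∣) {{1≤∣ J-nonempty ∣}}) (zeroʳ s) ⟩
            r ⊕ 0#             ≈⟨ +-identityʳ r ⟩
            r                  ∎
          (inj₂ e∈J′) → begin
            t ⊗ y e ⊕ s ⊗ z e  ≡⟨ cong₂ (λ y z → t ⊗ y ⊕ s ⊗ z)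
              (spread-out (λ e∈J → separated e∈J e∈J′)) (spread-in e∈J′) ⟩
            t ⊗ 0# ⊕ s ⊗ b     ≈⟨ +-cong (zeroʳ t) (scale (∣ J′ ∣) {{1≤∣ J′-nonempty ∣}}) ⟩
            0# ⊕ r             ≈⟨ +-identityˡ r ⟩
            r                  ∎

  module _ {ρ : Vector Carrier m} (blocker : Blocker K (Ω K H) ρ) (Z : Subset m)
    (zero-on : ∀ {e} → e ∈ Z → ρ e ≈ 0#) (pos-off : ∀ {e} → e ∉ Z → 0# ≺ ρ e)
    {k} (P : Partition n k) (disjoint : ∀ {e} → e ∈ Z → e ∉ δ H P) (linked : ∀ i → Linked Z (part P i)) where
    open Cuts H P

    private
      0≼ρ = proj₁ (adm⁻ (proj₁ blocker))
      1≼ρ = proj₂ (adm⁻ (proj₁ blocker))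

    zero-closed : ∀ i → Closed Z (part P i)
    zero-closed i e e∈Z = part-closed i e (x∉p⇒x∈∁p (disjoint e∈Z))

    zero-tight : ∀ {A} → Base A → NoExchange A Z → ∀ i → Tight (restrict Z A) (part P i)
    zero-tight base stuck i = tight-component base stuck (nonempty P i) (zero-closed i) (linked i)

    zero-partsTight : ∀ {A} → Base A → NoExchange A Z → PartsTight A
    zero-partsTight {A} base stuck i = ℕ.≤-trans (zero-tight base stuck i)
      (s≤s (inner-mono {restrict Z A} {A} λ e _ → restrict-≤ Z A e))

    -- With a single part, some base would live on the hyperedges of weight zero.
    several-parts : 2 ≤ k
    several-parts = ℕ.≰⇒> λ k≤1 →
      let (T , base , stuck , _) = concentrate Z (proj₂ someBase)
          i = index P (fromℕ< 1≤n)
          everything : ∀ {e} → edge H e ⊆ part P i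
          everything {_} {v} _ = index-∈ P (one-colour k≤1 (index P v) i)
          inZ : ∀ e → 0 < T e → e ∈ Z
          inZ e 0<Te = tight-members (proj₁ base) (nonempty P i) (zero-tight base stuck i) 0<Te everything
      in ≼-trans (1≼ρ base) (≼-trans
           (weight-mono T (λ _ → 0) 0≼ρ λ e → case 0 ℕ.<? T e of λ where
             (yes 0<Te) → inj₂ (zero-on (inZ e 0<Te))
             (no  T≯0)  → inj₁ (ℕ.≮⇒≥ T≯0))
           (≈⇒≼ (≈-trans (∑-⋆-zero ρ) ≈-refl))) 0<1
      where
      one-colour : ∀ {k} → k ≤ 1 → (i j : Fin k) → i ≡ j
      one-colour (s≤s z≤n) zero zero = refl
      ∑-⋆-zero : ∀ {m} (σ : Vector Carrier m) → weight (λ _ → 0) σ ≈ 0#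
      ∑-⋆-zero {zero}  σ = ≈-refl
      ∑-⋆-zero {suc m} σ = ≈-trans (+-identityˡ _) (∑-⋆-zero (σ ∘ suc))

    zero-feasible : Feasible H P
    zero-feasible i X ne X⊂ = let (e , e∈Z , e⊆ , meets , leaves) = linked i X ne X⊂ in
      e , ∈-fromDec⁺ (λ e → (e ∈? ⊤) ×-dec (edge H e ⊆? part P i)) (∈⊤ , λ {_} → e⊆) , meets , leaves

    -- The cut vector can be subtracted in a small multiple without leaving Adm (Ω H), since the
    -- minimum weight is attained at a base concentrated on Z, which meets the cut in k ∸ 1 members.
    equals-cut : ∀ e → ρ e ≈ cutVector P several-parts e
    equals-cut e = ≈-stable λ differs → lower-bound σ 0≺σ λ (ε , 0≺ε , ε≼σ) →
      differs (proj₁ (split ε 0≺ε ε≼σ) e)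
      where
      r = cutValue P several-parts
      κ = cutVector P several-parts

      σ : Vector Carrier m
      -- The number `ε` has to stay below `ρ` only on the cut. Elsewhere `ρ` may be zero, and the
      -- value one keeps `σ` positive.
      σ e = if does (e ∈? δ H P) then ρ e else 1#

      0≺σ : ∀ e → 0# ≺ σ e
      0≺σ e with e ∈? δ H P
      ... | yes e∈δ = pos-off λ e∈Z → disjoint e∈Z e∈δ
      ... | no  _   = 0<1

      r≼1 : r ≼ 1#
      r≼1 = ≼-trans (≈⇒≼ (≈-sym (+-identityʳ r))) (≼-trans
        (⋆-monoˡ-≼ {p = 1} (≺⇒≼ (cutValue-pos P several-parts)) (ℕ.m<n⇒0<n∸m several-parts))
        (≈⇒≼ (recip-inverse (k ∸ 1) {{k∸1≢0 P several-parts}})))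

      module Split (ε : Carrier) (0≺ε : 0# ≺ ε) (ε≼σ : ∀ e → ε ≼ σ e) where
        q : Carrier
        q = 1# ⊕ ε

        1≺q : 1# ≺ q
        1≺q = x≺x+y 0≺ε

        0≺q : 0# ≺ q
        0≺q = ≺.trans 0<1 1≺q

        s : Carrier
        s = proj₁ (invert 0≺q)

        qs≈1 : q ⊗ s ≈ 1#
        qs≈1 = proj₁ (proj₂ (invert 0≺q))

        0≺s : 0# ≺ s
        0≺s = proj₂ (proj₂ (invert 0≺q))

        -- The point beyond `ρ` on the line from `κ`, scaled so that `ρ` is the combination of `κ`
        -- and `z` with coefficients `ε / (1 + ε)` and `1 / (1 + ε)`. It is nonnegative because `κ`
        -- is at most one and `ε` at most `ρ` on the cut.
        z : Vector Carrier m
        z e = q ⊗ ρ e ⊝ ε ⊗ κ e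

        balance : ∀ e → ε ⊗ κ e ⊕ z e ≈ q ⊗ ρ e
        balance e = ≈-trans (+-comm _ _) (y-x+x≈y (q ⊗ ρ e) (ε ⊗ κ e))

        εκ≼qρ : ∀ e → ε ⊗ κ e ≼ q ⊗ ρ e
        εκ≼qρ e = bounded (e ∈? δ H P) (ε≼σ e)
          where
          bounded : (d : Dec (e ∈ δ H P)) → ε ≼ (if does d then ρ e else 1#) →
            ε ⊗ (if does d then r else 0#) ≼ q ⊗ ρ e
          bounded (no _) _ = ≼-trans (≈⇒≼ (zeroʳ ε)) (*-nonneg 0≺q (0≼ρ e))
          bounded (yes _) ε≼ρe = ≼-trans (*-monoˡ-≼ 0≺ε r≼1) (≼-trans (≈⇒≼ (*-identityʳ ε))
            (≼-trans ε≼ρe (≼-trans (≈⇒≼ (≈-sym (+-identityʳ (ρ e))))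
              (≼-trans (+-mono-≼ (≈⇒≼ (≈-sym (*-identityˡ (ρ e)))) (*-nonneg 0≺ε (0≼ρ e)))
                (≈⇒≼ (≈-sym (distribʳ (ρ e) 1# ε)))))))

        0≼z : ∀ e → 0# ≼ z e
        0≼z e = +-cancelʳ-≼ (ε ⊗ κ e) (≼-trans (≈⇒≼ (+-identityˡ _))
          (≼-trans (εκ≼qρ e) (≈⇒≼ (≈-sym (y-x+x≈y (q ⊗ ρ e) (ε ⊗ κ e))))))

        z-zero : ∀ {e} → e ∈ Z → z e ≈ 0#
        z-zero {e} e∈Z = +-cancelʳ-≈ (ε ⊗ κ e) (begin
          z e ⊕ ε ⊗ κ e   ≈⟨ y-x+x≈y (q ⊗ ρ e) (ε ⊗ κ e) ⟩
          q ⊗ ρ e         ≈⟨ *-congˡ (zero-on e∈Z) ⟩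
          q ⊗ 0#          ≈⟨ zeroʳ q ⟩
          0#              ≈⟨ zeroʳ ε ⟨
          ε ⊗ 0#          ≡⟨ cong (ε ⊗_) (spread-out (disjoint e∈Z)) ⟨
          ε ⊗ κ e         ≈⟨ +-identityˡ (ε ⊗ κ e) ⟨
          0# ⊕ ε ⊗ κ e    ∎)
          where open SetoidReasoning setoid

        1≼z : ∀ {A} → Base A → 1# ≼ weight A z
        1≼z {A} baseA =
          let (T , base , stuck , _ , T≤A) = concentrate Z baseA in
          ≼-trans (tight-weight base stuck) (weight-mono T A 0≼z λ e → case e ∈? Z of λ where
            (yes e∈Z) → inj₂ (z-zero e∈Z)
            (no  e∉Z) → inj₁ (T≤A e e∉Z))
          where
          -- A concentrated base has weight one under `κ`, so its weight under `z` is at least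
          -- `q - ε`, which is one.
          tight-weight : ∀ {T} → Base T → NoExchange T Z → 1# ≼ weight T z
          tight-weight {T} base stuck = +-cancelʳ-≼ ε (≼-trans (≈⇒≼ (≈-sym (*-identityʳ q)))
            (≼-trans (*-monoˡ-≼ 0≺q (1≼ρ base)) (≈⇒≼ (begin
              q ⊗ weight T ρ                                ≈⟨ +-identityʳ _ ⟨
              q ⊗ weight T ρ ⊕ 0#                           ≈⟨ +-congˡ (zeroˡ (weight T ρ)) ⟨
              q ⊗ weight T ρ ⊕ 0# ⊗ weight T ρ              ≈⟨ weight-linear T q 0# ρ ρ ⟨
              weight T (λ e → q ⊗ ρ e ⊕ 0# ⊗ ρ e)           ≈⟨ weight-cong T (λ e → begin
                q ⊗ ρ e ⊕ 0# ⊗ ρ e   ≈⟨ +-congˡ (zeroˡ (ρ e)) ⟩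
                q ⊗ ρ e ⊕ 0#         ≈⟨ +-identityʳ _ ⟩
                q ⊗ ρ e              ≈⟨ y-x+x≈y (q ⊗ ρ e) (ε ⊗ κ e) ⟨
                z e ⊕ ε ⊗ κ e        ≈⟨ +-congʳ (*-identityˡ (z e)) ⟨
                1# ⊗ z e ⊕ ε ⊗ κ e   ∎) ⟩
              weight T (λ e → 1# ⊗ z e ⊕ ε ⊗ κ e)           ≈⟨ weight-linear T 1# ε z κ ⟩
              1# ⊗ weight T z ⊕ ε ⊗ weight T κ              ≈⟨ +-cong (*-identityˡ _) (*-congˡ (≈-trans
                (weight-cut P several-parts base (zero-partsTight base stuck))
                (recip-inverse (k ∸ 1) {{k∸1≢0 P several-parts}}))) ⟩
              weight T z ⊕ ε ⊗ 1#                           ≈⟨ +-congˡ (*-identityʳ ε) ⟩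
              weight T z ⊕ ε                                ∎))))
            where open SetoidReasoning setoid

        t : Carrier
        t = s ⊗ ε

        0≺t : 0# ≺ t
        0≺t = OrderedField.*-pos K 0≺s 0≺ε

        t+s≈1 : t ⊕ s ≈ 1#
        t+s≈1 = begin
          s ⊗ ε ⊕ s        ≈⟨ +-congˡ (*-identityʳ s) ⟨
          s ⊗ ε ⊕ s ⊗ 1#   ≈⟨ distribˡ s ε 1# ⟨
          s ⊗ (ε ⊕ 1#)     ≈⟨ *-congˡ (+-comm ε 1#) ⟩
          s ⊗ q            ≈⟨ *-comm s q ⟩
          q ⊗ s            ≈⟨ qs≈1 ⟩
          1#               ∎
          where open SetoidReasoning setoid

        t≺1 : t ≺ 1#
        t≺1 = ≺.<-respʳ-≈ t+s≈1 (x≺x+y 0≺s)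

        1-t≈s : 1# ⊝ t ≈ s
        1-t≈s = +-cancelʳ-≈ t (≈-trans (y-x+x≈y 1# t) (≈-trans (≈-sym t+s≈1) (+-comm t s)))

        combination : ∀ e → ρ e ≈ t ⊗ κ e ⊕ (1# ⊝ t) ⊗ z e
        combination e = begin
          ρ e                            ≈⟨ *-identityˡ (ρ e) ⟨
          1# ⊗ ρ e                       ≈⟨ *-congʳ (≈-trans (*-comm s q) qs≈1) ⟨
          (s ⊗ q) ⊗ ρ e                  ≈⟨ *-assoc s q (ρ e) ⟩
          s ⊗ (q ⊗ ρ e)                  ≈⟨ *-congˡ (balance e) ⟨
          s ⊗ (ε ⊗ κ e ⊕ z e)            ≈⟨ distribˡ s (ε ⊗ κ e) (z e) ⟩
          s ⊗ (ε ⊗ κ e) ⊕ s ⊗ z e        ≈⟨ +-cong (≈-sym (*-assoc s ε (κ e))) (*-congʳ (≈-sym 1-t≈s)) ⟩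
          t ⊗ κ e ⊕ (1# ⊝ t) ⊗ z e       ∎
          where open SetoidReasoning setoid

      split : ∀ ε → 0# ≺ ε → (∀ e → ε ≼ σ e) → Equal K ρ κ × _
      split ε 0≺ε ε≼σ = proj₂ blocker κ z t (adm⁺ (cutVector-admissible P several-parts))
        (adm⁺ (0≼z , 1≼z)) 0≺t t≺1 combination
        where open Split ε 0≺ε ε≼σ

  Candidate : Vector Carrier m → (k : ℕ) → Vec (Fin k) n → Set _
  Candidate ρ k xs = Σ[ surjective ∈ Surjective xs ] Σ[ 2≤k ∈ 2 ≤ k ]
    let P = colouring xs surjective in
    Feasible H P × Biconnectivity.PartDeletionsConnected H P × (∀ e → ρ e ≈ cutVector P 2≤k e)

  ¬¬candidate : ∀ {ρ} → Blocker K (Ω K H) ρ → ¬ ¬ (∃[ k ] ∃[ xs ] Candidate ρ k xs)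
  ¬¬candidate {ρ} blocker none =
    -- Two things are assumed inside the negation: it is decided which entries vanish, and the
    -- others, being nonnegative, are strictly positive.
    ∀¬¬⇒¬¬∀ (λ e → ¬¬-excluded-middle {A = ρ e ≈ 0#}) λ zero? →
    ∀¬¬⇒¬¬∀ (λ e none → ≼⇒¬¬≺⊎≈ (proj₁ (adm⁻ (proj₁ blocker)) e) λ where
        (inj₁ 0≺ρ) → none λ _ → 0≺ρ
        (inj₂ 0≈ρ) → none λ ρ≉0 → ⊥-elim (ρ≉0 (≈-sym 0≈ρ))) λ positive →
    let Z = fromDec zero?
        (k , xs , surjective , respects , linked) = Refinement.linked-colouring H Z 1≤n
        P = colouring xs surjective
        zero-on : ∀ {e} → e ∈ Z → ρ e ≈ 0#
        zero-on = ∈-fromDec⁻ zero?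
        pos-off : ∀ {e} → e ∉ Z → 0# ≺ ρ e
        pos-off {e} e∉Z = positive e λ ρ≈0 → e∉Z (∈-fromDec⁺ zero? ρ≈0)
        disjoint : ∀ {e} → e ∈ Z → e ∉ δ H P
        disjoint e∈Z e∈δ = let (u , w , u∈ , w∈ , differ) = Cuts.δ⁻ H P e∈δ in differ (respects e∈Z u∈ w∈)
        2≤k = several-parts blocker Z zero-on pos-off P disjoint linked
        feasible = zero-feasible blocker Z zero-on pos-off P disjoint linked
        ρ≈ = equals-cut blocker Z zero-on pos-off P disjoint linked
    in case Cutting.deletions⊎cutPart H P feasible of λ where
      (inj₁ deletions) → none (k , xs , surjective , 2≤k , feasible , deletions , ρ≈)
      (inj₂ C)         → cutPart⇒¬extreme P 2≤k C blocker ρ≈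

  module _ {ρ : Vector Carrier m} (code : ∀ e → ∃[ p ] (ρ e ≈ value p)) where

    -- Naming each entry by a natural number turns equality with a cut vector into equality of
    -- naturals, with code `k ∸ 1` on the cut and `0` off it.
    candidate? : ∀ k xs → Dec (Candidate ρ k xs)
    candidate? k xs with surjective? xs | 2 ℕ.≤? k
    ... | no ¬surjective | _ = no (¬surjective ∘ proj₁)
    ... | yes _ | no 2≰k = no (2≰k ∘ proj₁ ∘ proj₂)
    ... | yes surjective | yes 2≤k = map′ (λ found → surjective , 2≤k , found) (proj₂ ∘ proj₂)
      (Cutting.feasible? H P ×-dec Cutting.deletions? H P ×-dec Fin.all? equal?)
      where
      P = colouring xs surjective
      equal? : ∀ e → Dec (ρ e ≈ cutVector P 2≤k e)
      equal? e with e ∈? δ H P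
      ... | yes _ = map′
        (λ eq → ≈-trans (proj₂ (code e)) (≡⇒≈ (trans (cong value eq) (sym (recip≡value (k ∸ 1) {{k∸1≢0 P 2≤k}})))))
        (λ eq → value-injective _ _ (≈-trans (≈-sym (proj₂ (code e)))
          (≈-trans eq (≡⇒≈ (recip≡value (k ∸ 1) {{k∸1≢0 P 2≤k}})))))
        (proj₁ (code e) ℕ.≟ k ∸ 1)
      ... | no _ = map′
        (λ eq → ≈-trans (proj₂ (code e)) (≡⇒≈ (cong value eq)))
        (λ eq → value-injective _ 0 (≈-trans (≈-sym (proj₂ (code e))) eq))
        (proj₁ (code e) ℕ.≟ 0)

  candidate : ∀ {ρ} → Blocker K (Ω K H) ρ → ∃[ k ] ∃[ xs ] Candidate ρ k xs
  candidate {ρ} blocker = let (i , found) = decidable-stable search ¬¬search in toℕ i , found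
    where
    bounded : ∀ {k} xs → Candidate ρ k xs → k < suc n
    bounded xs (surjective , _) = s≤s (surjective⇒≤ xs surjective)

    -- A partition has at most `n` parts, so each entry is one of `value 0`, ..., `value n`. These
    -- are pairwise apart, and knowing up to double negation that one of them is attained suffices
    -- to find it.
    code : ∀ e → ∃[ p ] (ρ e ≈ value p)
    code e = let (i , eq) = pick (suc n) (value ∘ toℕ) (λ i j i≢j → value-apart _ _ (i≢j ∘ Fin.toℕ-injective)) ¬¬code
             in toℕ i , eq
      where
      at : ∀ {p} → p < suc n → ρ e ≈ value p → ∃[ i ] (ρ e ≈ value (toℕ {suc n} i))
      at p<n eq = fromℕ< p<n , ≈-trans eq (≡⇒≈ (cong value (sym (Fin.toℕ-fromℕ< p<n))))
      ¬¬code : ¬ ¬ (∃[ i ] (ρ e ≈ value (toℕ {suc n} i)))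
      ¬¬code none = ¬¬candidate blocker λ (k , xs , found@(surjective , 2≤k , _ , _ , ρ≈)) →
        none (case e ∈? δ H (colouring xs surjective) of λ where
          (yes e∈δ) → at {k ∸ 1} (ℕ.≤-<-trans (ℕ.m∸n≤m k 1) (bounded xs found)) (≈-trans (ρ≈ e)
            (≡⇒≈ (trans (spread-in e∈δ) (recip≡value (k ∸ 1) {{k∸1≢0 (colouring xs surjective) 2≤k}}))))
          (no e∉δ) → at {0} (s≤s z≤n) (≈-trans (ρ≈ e) (≡⇒≈ (spread-out e∉δ))))

    search : Dec (∃[ i ] ∃[ xs ] Candidate ρ (toℕ {suc n} i) xs)
    search = Fin.any? λ i → anyVec? (candidate? code (toℕ i))

    ¬¬search : ¬ ¬ (∃[ i ] ∃[ xs ] Candidate ρ (toℕ {suc n} i) xs)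
    ¬¬search none = ¬¬candidate blocker λ (k , xs , found) → none
      ( fromℕ< (bounded xs found)
      , subst (λ k → ∃[ xs ] Candidate ρ k xs) (sym (Fin.toℕ-fromℕ< (bounded xs found))) (xs , found))

theorem1p6 : ∀ {c ℓ₁ ℓ₂ ℓ₃} (K : OrderedField c ℓ₁ ℓ₂ ℓ₃) {n m} (H : Hypergraph n m) →
    2 ≤ n → Connected (whole H) →
    Blocker K (Ω K H) ≐ (λ ρ →
    ∃[ k ] Σ[ P ∈ Partition n k ] Σ[ 2≤k ∈ 2 ≤ k ]
    (Feasible H P × VertexBiconnected (shrunk H P)
    × Equal K ρ (partitionVector K H P 2≤k)))
theorem1p6 K {n} H 2≤n connected =
    (λ blocker →
      let (k , xs , surjective , 2≤k , feasible , deletions , ρ≈) =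
            BlockerVertices.candidate K H 2≤n connected blocker
          P = colouring xs surjective
      in k , P , 2≤k , feasible , Shrinking.deletions⇒biconnected H P feasible connected deletions
         , λ e → ≈-trans (ρ≈ e) (≈-sym (partitionVector≈ P 2≤k e)))
  , (λ (k , P , 2≤k , feasible , biconnected , ρ≈) →
      CutExtremality.cut-extreme K H 2≤n connected P 2≤k feasible
        (Shrinking.biconnected⇒deletions H P feasible biconnected)
        λ e → ≈-trans (ρ≈ e) (partitionVector≈ P 2≤k e))
  where
  open OrderedFieldProperties K
  open Admissibility K H 2≤n
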